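{- Every internally 4-connected graph has exactly one 4-tangle. Moreover, for every finite graph $G$ and every 4-tangle $\tau$ in $G$ there exist an internally 4-connected graph $H$ and a minor-map $\varphi\colon G\succcurlyeq H$ such that the $\varphi$-lift to $G$ of the unique 4-tangle in $H$ is $\tau$.
   Context: All graphs are finite and simple. A separation of a graph $G$ is a set $\{A,B\}$ with $A\cup B=V(G)$ and no edge of $G$ between $A\setminus B$ and $B\setminus A$; its order is $|A\cap B|$. Its two orientations are the oriented separations $(A,B)$ and $(B,A)$. A $k$-tangle in $G$ is a set $\tau$ of oriented separations of order $<k$ that contains exactly one orientation of every separation of $G$ of order $<k$, and contains no three (not necessarily distinct) elements $(A_1,B_1),(A_2,B_2),(A_3,B_3)$ with $G[A_1]\cup G[A_2]\cup G[A_3]=G$. A graph $G$ is internally 4-connected if it is 3-connected, has more than four vertices, and for every set $S$ of three vertices such that $G-S$ is disconnected, $S$ is independent and $G-S$ has exactly two components, one of which is a single vertex. A minor-map $\varphi\colon G\succcurlyeq H$ is a pair $(U,f)$ with $U\subseteq V(G)$ and $f\colon U\to V(H)$ a surjection such that the sets $f^{ -1}(x)$ ($x\in V(H)$), called branch sets, induce connected subgraphs of $G$ and for every edge $xy$ of $H$ there is an edge of $G$ between $f^{ -1}(x)$ and $f^{ -1}(y)$. For an oriented separation $(A,B)$ of $G$, let $\varphi(A,B):=(A_\varphi,B_\varphi)$, where $A_\varphi$ is the set of vertices of $H$ whose branch set meets $A$, and $B_\varphi$ analogously. If $\tau$ is a $k$-tangle in $H$, the $\varphi$-lift of $\tau$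 to $G$ is the set of all oriented separations $s$ of $G$ of order $<k$ with $\varphi(s)\in\tau$. -}

module Defs where

open import Data.Nat using (ℕ; _<_)
open import Data.Fin using (Fin)
open import Data.Fin.Subset using (Subset; _∈_; _∉_; _∩_; ∣_∣; ∁)
open import Data.Bool using (Bool; true; false)
open import Data.Maybe using (Maybe; just)
open import Data.Product using (Σ; _×_; ∃; ∃-syntax)
open import Data.Sum using (_⊎_)
open import Relation.Nullary using (¬_)
open import Relation.Binary.PropositionalEquality using (_≡_; _≢_)

record Graph (n : ℕ) : Set where
  field
    E     : Fin n → Fin n → Bool
    sym   : ∀ u v → E u v ≡ E v u
    irref : ∀ u → E u u ≡ false
open Graph public

data Reach {n : ℕ} (G : Graph n) (W : Fin n → Set) : Fin n → Fin n → Set where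
  here : ∀ {u} → W u → Reach G W u u
  step : ∀ {u w v} → W u → E G u w ≡ true → Reach G W w v → Reach G W u v

-- G[W] is connected (W nonempty is guaranteed where used).
Connected : {n : ℕ} → Graph n → (Fin n → Set) → Set
Connected G W = ∀ u v → W u → W v → Reach G W u v

Del : {n : ℕ} → Subset n → Fin n → Set
Del X v = v ∈ ∁ X

KConnected : {n : ℕ} → ℕ → Graph n → Set
KConnected {n} k G = (k < n) × (∀ (X : Subset n) → ∣ X ∣ < k → Connected G (Del X))

Independent : {n : ℕ} → Graph n → Subset n → Set
Independent G S = ∀ u v → u ∈ S → v ∈ S → E G u v ≡ false

TwoComponentsOneTrivial : {n : ℕ} → Graph n → Subset n → Set
TwoComponentsOneTrivial {n} G S =
  Σ (Fin n) λ v → (v ∉ S)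
    × (∀ w → w ∉ S → E G v w ≡ false)
    × (Σ (Fin n) λ u → (u ∉ S) × (u ≢ v))
    × (∀ u w → u ∉ S → w ∉ S → u ≢ v → w ≢ v → Reach G (Del S) u w)

Internally4Connected : {n : ℕ} → Graph n → Set
Internally4Connected {n} G =
  KConnected 3 G × (4 < n) ×
  (∀ (S : Subset n) → ∣ S ∣ ≡ 3 → ¬ Connected G (Del S) →
     Independent G S × TwoComponentsOneTrivial G S)

IsSeparation : {n : ℕ} → Graph n → Subset n → Subset n → Set
IsSeparation G A B =
  (∀ v → v ∈ A ⊎ v ∈ B) ×
  (∀ u v → u ∈ A → u ∉ B → v ∈ B → v ∉ A → E G u v ≡ false)

order : {n : ℕ} → Subset n → Subset n → ℕ
order A B = ∣ A ∩ B ∣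

OSeps : ℕ → Set₁
OSeps n = Subset n → Subset n → Set

Covers : {n : ℕ} → Graph n → Subset n → Subset n → Subset n → Set
Covers G A₁ A₂ A₃ =
  (∀ v → v ∈ A₁ ⊎ v ∈ A₂ ⊎ v ∈ A₃) ×
  (∀ u v → E G u v ≡ true →
     (u ∈ A₁ × v ∈ A₁) ⊎ (u ∈ A₂ × v ∈ A₂) ⊎ (u ∈ A₃ × v ∈ A₃))

record Tangle {n : ℕ} (G : Graph n) (k : ℕ) (τ : OSeps n) : Set where
  field
    sound    : ∀ A B → τ A B → IsSeparation G A B × order A B < k
    complete : ∀ A B → IsSeparation G A B → order A B < k → τ A B ⊎ τ B A
    -- at most one orientation (both orientations coincide iff A ≡ B)
    exclusive : ∀ A B → τ A B → τ B A → A ≡ B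
    noCover  : ∀ A₁ B₁ A₂ B₂ A₃ B₃ → τ A₁ B₁ → τ A₂ B₂ → τ A₃ B₃ →
                 ¬ Covers G A₁ A₂ A₃

_≐_ : {n : ℕ} → OSeps n → OSeps n → Set
τ ≐ σ = ∀ A B → (τ A B → σ A B) × (σ A B → τ A B)

-- Minor-maps φ = (U , f): f u ≡ just x means u ∈ U and f u = x.
record MinorMap {n m : ℕ} (G : Graph n) (H : Graph m) : Set where
  field
    f        : Fin n → Maybe (Fin m)
    surj     : ∀ x → Σ (Fin n) λ u → f u ≡ just x
    branchConnected : ∀ x → Connected G (λ u → f u ≡ just x)
    edges    : ∀ x y → E H x y ≡ true →
                 Σ (Fin n) λ u → Σ (Fin n) λ v →
                   (f u ≡ just x) × (f v ≡ just y) × (E G u v ≡ true)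
open MinorMap public

IsImage : {n m : ℕ} {G : Graph n} {H : Graph m} → MinorMap G H →
          Subset n → Subset m → Set
IsImage {n} φ A A' =
  ∀ x → (x ∈ A' → Σ (Fin n) λ u → (u ∈ A) × (f φ u ≡ just (x)))
      × ((Σ (Fin n) λ u → (u ∈ A) × (f φ u ≡ just x)) → x ∈ A')

Lift : {n m : ℕ} {G : Graph n} {H : Graph m} → MinorMap G H → ℕ →
       OSeps m → OSeps n
Lift {n} {m} {G} φ k σ A B =
  IsSeparation G A B × order A B < k ×
  (Σ (Subset m) λ A' → Σ (Subset m) λ B' →
     IsImage φ A A' × IsImage φ B B' × σ A' B')

{-# OPTIONS --safe #-}
-- Uniqueness.  In an internally 4-connected graph G a separation of order at most 3 has a side that is either
-- contained in the other side or a claw with its leaves as separator, and every 4-tangle must regard that side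
-- as small.  Each small side induces at most three edges, so three of them account for a degree sum of at most
-- 18; but the degree sum of G exceeds 18, as all degrees are at least 3, and at least 4 when |G| ≤ 6.
--
-- Existence.  Induct on |G|.  If (A , B) ∈ τ has order at most 2 and A ∖ B is nonempty, replace A by a complete
-- graph on A ∩ B.  Otherwise G is 3-connected up to τ.  If all (A , B) ∈ τ with A ∖ B nonempty are claws with
-- independent leaves, then G is internally 4-connected.  If not, take such an (A , B) that is no claw, with A
-- maximal; then G[A] contains a triangle minor rooted at A ∩ B, so A can be replaced by a triangle.  The result
-- inherits the tangle unless A and three elements of τ containing the three pairs in A ∩ B cover G.  In that
-- case extend these elements to maximal ones.  By submodularity any two of the four sets share at most two
-- vertices, which forces them to attach along the four triples of a 4-set; contracting their interiors yields
-- a cube minor, whose tangle lifts to τ because no element of τ meets seven of its branch sets.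
module Submission where

open import Defs
open import Data.Bool using (Bool; true; false; _∨_; _∧_; not; if_then_else_)
import Data.Bool.Properties as Bool
open import Data.Empty using (⊥; ⊥-elim)
open import Data.Fin using (Fin; zero; suc; _≟_; splitAt; join)
open import Data.Fin.Properties using (any?; all?; suc-injective; splitAt-join; join-splitAt)
open import Data.Fin.Subset using (⋃; Subset; _∈_; _∉_; _∩_; _∪_; ∣_∣; ∁; _⊆_; _-_; ⊤; ⁅_⁆; inside; outside) renaming (⊥ to ∅)
open import Data.Fin.Subset.Properties
open import Data.List as List using (List; []; _∷_; length)
open import Data.List.Relation.Unary.All as All using (All; []; _∷_)
open import Data.List.Relation.Unary.AllPairs using (AllPairs; []; _∷_)
open import Data.List.Relation.Unary.Any using (Any; here; there; satisfied)
open import Data.List.Relation.Unary.Any.Properties using (map⁻)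
open import Data.Maybe using (Maybe; just; nothing; _>>=_)
open import Data.Maybe.Properties as Maybe using (just-injective)
open import Data.Nat using (ℕ; zero; suc; _+_; _*_; _≤_; _<_; z≤n; s≤s; _≤?_; _<?_) renaming (_≟_ to _≟ℕ_)
open import Data.Nat.Properties using (≤-refl; ≤-trans; ≤-pred; ≤-reflexive; <-irrefl; ≰⇒>; ≮⇒≥; m≤m+n; m≤n+m; n≤1+n; +-suc; +-comm; ≤-antisym; +-cancelˡ-≤; +-mono-≤; +-monoʳ-≤; +-monoˡ-≤; *-monoˡ-≤; ∸-monoˡ-≤; ∸-monoʳ-≤; ≤⇒≯; module ≤-Reasoning)
open import Data.Nat.Tactic.RingSolver using (solve-∀)
open import Data.Product using (Σ; ∃; _×_; _,_; proj₁; proj₂)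
open import Data.Sum as Sum using (_⊎_; inj₁; inj₂; [_,_]′)
open import Data.Sum.Properties using (inj₁-injective)
open import Data.Vec using (tabulate; lookup; []; _∷_; here; there)
open import Data.Vec.Properties using (lookup∘tabulate; []=⇒lookup; lookup⇒[]=)
open import Function using (_∘_; id; mk⇔)
open import Relation.Binary.PropositionalEquality using (_≡_; _≢_; refl; trans; cong; cong₂; subst; subst₂) renaming (sym to ≡-sym)
open import Relation.Nullary using (¬_; Dec; yes; no; does; contradiction)
open import Relation.Nullary.Decidable using (_×-dec_; _⊎-dec_; _→-dec_; ¬?; decidable-stable; dec-true; dec-false; does-⇔; from-no)

-- Making A ∩ B complete keeps separations under control: the clique lies on one side of every
-- separation of the minor, so A can be glued back to that side without raising the order, and the
-- inherited tangle can be taken to consist of the images of the elements of τ. Only the covering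
-- axiom can then fail: three images that cover the minor yield three elements of τ that cover G
-- together with A, and the axiom does not exclude four sets. If the separator has order at most
-- two, one of the three contains all of it and can absorb A. For order three the failure is real:
-- when four large pieces are attached along the four triples of a 4-set, replacing one of them by a
-- triangle leaves a graph covered by the other three. All four pieces have to be contracted at
-- once, each to a single vertex, and this gives the cube. Maximality of A is what lets
-- submodularity bound the overlaps in that case. The constant 18 cannot be lowered in the counting
-- argument: the complete bipartite graph with classes of size three has degree sum 18 and is
-- covered by three claws.

private
  variable
    n m : ℕ

-- Subsets and their sizes

∩ˡ : ∀ (p q : Subset n) {x} → x ∈ p ∩ q → x ∈ p
∩ˡ p q = proj₁ ∘ x∈p∩q⁻ p q

∩ʳ : ∀ (p q : Subset n) {x} → x ∈ p ∩ q → x ∈ q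
∩ʳ p q = proj₂ ∘ x∈p∩q⁻ p q

∈∩ : ∀ {p q : Subset n} {x} → x ∈ p → x ∈ q → x ∈ p ∩ q
∈∩ a b = x∈p∩q⁺ (a , b)

∈∪ˡ : ∀ {p q : Subset n} {x} → x ∈ p → x ∈ p ∪ q
∈∪ˡ = x∈p∪q⁺ ∘ inj₁

∈∪ʳ : ∀ {p q : Subset n} {x} → x ∈ q → x ∈ p ∪ q
∈∪ʳ = x∈p∪q⁺ ∘ inj₂

select : {P : Fin n → Set} → (∀ v → Dec (P v)) → Subset n
select P? = tabulate (does ∘ P?)

∈-select⁺ : {P : Fin n → Set} (P? : ∀ v → Dec (P v)) → ∀ {v} → P v → v ∈ select P?
∈-select⁺ P? {v} p = lookup⇒[]= v _ (trans (lookup∘tabulate (does ∘ P?) v) (dec-true (P? v) p))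

∈-select⁻ : {P : Fin n → Set} (P? : ∀ v → Dec (P v)) → ∀ {v} → v ∈ select P? → P v
∈-select⁻ P? {v} h with P? v in eq
... | yes p = p
... | no  _ with trans (≡-sym (trans (lookup∘tabulate (does ∘ P?) v) (cong does eq))) ([]=⇒lookup h)
...   | ()

∉-minus : ∀ {X : Subset n} {x} → x ∉ X - x
∉-minus {X = _ ∷ X} {zero}  ()
∉-minus {X = _ ∷ X} {suc x} (there h) = ∉-minus {X = X} h

minus⊆ : ∀ {X : Subset n} {x v} → v ∈ X - x → v ∈ X
minus⊆ {X = X} {x} = p─q⊆p X ⁅ x ⁆

minus-≢ : ∀ {X : Subset n} {x v} → v ∈ X - x → v ≢ x
minus-≢ {X = X} h refl = ∉-minus {X = X} h

∈-minus : ∀ {X : Subset n} {x v} → v ∈ X → v ≢ x → v ∈ X - x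
∈-minus = x∈p∧x≢y⇒x∈p-y

∣X∣≤1+∣X-x∣ : ∀ (X : Subset n) x → ∣ X ∣ ≤ suc ∣ X - x ∣
∣X∣≤1+∣X-x∣ (inside  ∷ X) zero    = s≤s (≤-reflexive (cong ∣_∣ (≡-sym (p─⊥≡p X))))
∣X∣≤1+∣X-x∣ (outside ∷ X) zero    = ≤-trans (≤-reflexive (cong ∣_∣ (≡-sym (p─⊥≡p X)))) (n≤1+n _)
∣X∣≤1+∣X-x∣ (inside  ∷ X) (suc x) = s≤s (∣X∣≤1+∣X-x∣ X x)
∣X∣≤1+∣X-x∣ (outside ∷ X) (suc x) = ∣X∣≤1+∣X-x∣ X x

card-inj : ∀ (X : Subset m) (Y : Subset n) (f : ∀ i → i ∈ X → Fin n) →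
           (∀ i p → f i p ∈ Y) → (∀ i j p q → f i p ≡ f j q → i ≡ j) → ∣ X ∣ ≤ ∣ Y ∣
card-inj []            Y f f∈ inj = z≤n
card-inj (outside ∷ X) Y f f∈ inj =
  card-inj X Y (λ i p → f (suc i) (there p)) (λ i p → f∈ _ _)
    (λ i j p q e → suc-injective (inj _ _ _ _ e))
card-inj (inside  ∷ X) Y f f∈ inj = ≤-trans (s≤s
  (card-inj X (Y - f zero here) (λ i p → f (suc i) (there p))
    (λ i p → ∈-minus (f∈ _ _) λ e → zero≢suc (inj _ _ _ _ (≡-sym e)))
    (λ i j p q e → suc-injective (inj _ _ _ _ e))))
  (x∈p⇒∣p-x∣<∣p∣ (f∈ zero here))
  where
  zero≢suc : ∀ {k} {i : Fin k} → ¬ (Fin.zero ≡ suc i)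
  zero≢suc ()

Distinct : List (Fin n) → Set
Distinct = AllPairs _≢_

distinct⇒≤ : ∀ (xs : List (Fin n)) (X : Subset n) → Distinct xs → All (_∈ X) xs → length xs ≤ ∣ X ∣
distinct⇒≤ []       X d        a        = z≤n
distinct⇒≤ (x ∷ xs) X (d ∷ ds) (a ∷ as) =
  ≤-trans (s≤s (distinct⇒≤ xs (X - x) ds (go d as))) (x∈p⇒∣p-x∣<∣p∣ a)
  where
  go : ∀ {ys} → All (x ≢_) ys → All (_∈ X) ys → All (_∈ X - x) ys
  go []       []       = []
  go (e ∷ es) (b ∷ bs) = ∈-minus b (e ∘ ≡-sym) ∷ go es bs

listed⇒≤ : ∀ (xs : List (Fin n)) (X : Subset n) → (∀ v → v ∈ X → Any (v ≡_) xs) → ∣ X ∣ ≤ length xs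
listed⇒≤ []       X h = ≤-trans (card-inj {n = 0} X [] (λ i p → ⊥-elim (none (h i p))) (λ i p → ⊥-elim (none (h i p))) (λ i j p q e → ⊥-elim (none (h i p)))) z≤n
  where
  none : ∀ {v : Fin n} → ¬ Any (v ≡_) []
  none ()
listed⇒≤ (x ∷ xs) X h = ≤-trans (∣X∣≤1+∣X-x∣ X x) (s≤s (listed⇒≤ xs (X - x) λ v v∈ → drop (h v (minus⊆ v∈)) (minus-≢ {X = X} v∈)))
  where
  drop : ∀ {v} → Any (v ≡_) (x ∷ xs) → v ≢ x → Any (v ≡_) xs
  drop (here e)  ne = ⊥-elim (ne e)
  drop (there a) ne = a

⊆-card : ∀ {X Y : Subset n} → (∀ v → v ∈ X → v ∈ Y) → ∣ X ∣ ≤ ∣ Y ∣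
⊆-card h = p⊆q⇒∣p∣≤∣q∣ (λ {x} → h x)

pick : ∀ (X : Subset n) → 0 < ∣ X ∣ → ∃ λ x → x ∈ X
pick X 0<X with nonempty? X
... | yes h = h
... | no ¬h = contradiction (≤-trans 0<X (listed⇒≤ [] X λ v v∈ → ⊥-elim (¬h (v , v∈)))) λ ()

fresh : ∀ (xs : List (Fin n)) (X : Subset n) → length xs < ∣ X ∣ → ∃ λ x → x ∈ X × All (x ≢_) xs
fresh []       X h = let (x , x∈) = pick X h in x , x∈ , []
fresh (y ∷ ys) X h =
  let (x , x∈ , ds) = fresh ys (X - y) (≤-pred (≤-trans h (∣X∣≤1+∣X-x∣ X y)))
  in x , minus⊆ x∈ , minus-≢ {X = X} x∈ ∷ ds

exhausted : ∀ (xs : List (Fin n)) (X : Subset n) → Distinct xs → All (_∈ X) xs → ∣ X ∣ ≤ length xs →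
            ∀ v → v ∈ X → Any (v ≡_) xs
exhausted xs X d a le v v∈ with inList xs
  where
  inList : ∀ ys → Any (v ≡_) ys ⊎ All (v ≢_) ys
  inList []       = inj₂ []
  inList (y ∷ ys) with v ≟ y | inList ys
  ... | yes e | _      = inj₁ (here e)
  ... | no  _ | inj₁ i = inj₁ (there i)
  ... | no ne | inj₂ a = inj₂ (ne ∷ a)
... | inj₁ i = i
... | inj₂ o = contradiction (≤-trans (distinct⇒≤ (v ∷ xs) X (o ∷ d) (v∈ ∷ a)) le) (<-irrefl refl)

exhausted₂ : ∀ {X : Subset n} {x y} → x ≢ y → x ∈ X → y ∈ X → ∣ X ∣ ≤ 2 → ∀ v → v ∈ X → v ≡ x ⊎ v ≡ y
exhausted₂ {X = X} {x} {y} x≢y x∈ y∈ le v v∈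
  with exhausted (x ∷ y ∷ []) X ((x≢y ∷ []) ∷ [] ∷ []) (x∈ ∷ y∈ ∷ []) le v v∈
... | here e         = inj₁ e
... | there (here e) = inj₂ e

exhausted₃ : ∀ {X : Subset n} {x y z} → x ≢ y → x ≢ z → y ≢ z → x ∈ X → y ∈ X → z ∈ X → ∣ X ∣ ≤ 3 →
             ∀ v → v ∈ X → v ≡ x ⊎ v ≡ y ⊎ v ≡ z
exhausted₃ {X = X} {x} {y} {z} x≢y x≢z y≢z x∈ y∈ z∈ le v v∈
  with exhausted (x ∷ y ∷ z ∷ []) X ((x≢y ∷ x≢z ∷ []) ∷ (y≢z ∷ []) ∷ [] ∷ []) (x∈ ∷ y∈ ∷ z∈ ∷ []) le v v∈
... | here e                 = inj₁ e
... | there (here e)         = inj₂ (inj₁ e)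
... | there (there (here e)) = inj₂ (inj₂ e)

-- Submodularity of the order of separations. It holds vertex by vertex: each vertex is counted on
-- the left at most as often as on the right, which the sixteen cases check.
∪∩-card : ∀ (A B C D : Subset n) →
  ∣ (A ∪ C) ∩ (B ∩ D) ∣ + ∣ (A ∩ C) ∩ (B ∪ D) ∣ ≤ ∣ A ∩ B ∣ + ∣ C ∩ D ∣
∪∩-card [] [] [] [] = z≤n
∪∩-card (a ∷ A) (b ∷ B) (c ∷ C) (d ∷ D) = go a b c d (∪∩-card A B C D)
  where
  up : ∀ {x y z w} → x + y ≤ z + w → x + suc y ≤ suc (z + w)
  up {x} {y} h = ≤-trans (≤-reflexive (+-suc x y)) (s≤s h)
  upʳ : ∀ {x y z w} → x + y ≤ z + w → x + suc y ≤ z + suc w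
  upʳ {x} {y} {z} {w} h = ≤-trans (up {x} {y} {z} {w} h) (≤-reflexive (≡-sym (+-suc z w)))
  wk : ∀ {x z w} → x ≤ z + w → x ≤ z + suc w
  wk {x} {z} {w} h = ≤-trans h (+-monoʳ-≤ z (n≤1+n w))
  sˡ : ∀ {x y z w} → x + y ≤ z + w → suc (x + y) ≤ z + suc w
  sˡ {z = z} {w} h = ≤-trans (s≤s h) (≤-reflexive (≡-sym (+-suc z w)))
  go : ∀ a b c d → let X = ∣ (A ∪ C) ∩ (B ∩ D) ∣; Y = ∣ (A ∩ C) ∩ (B ∪ D) ∣ in X + Y ≤ ∣ A ∩ B ∣ + ∣ C ∩ D ∣ →
    ∣ ((a ∨ c) ∧ (b ∧ d)) ∷ ((A ∪ C) ∩ (B ∩ D)) ∣ + ∣ ((a ∧ c) ∧ (b ∨ d)) ∷ ((A ∩ C) ∩ (B ∪ D)) ∣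
      ≤ ∣ (a ∧ b) ∷ (A ∩ B) ∣ + ∣ (c ∧ d) ∷ (C ∩ D) ∣
  go true  true  true  true  h = s≤s (upʳ {∣ (A ∪ C) ∩ (B ∩ D) ∣} {_} {∣ A ∩ B ∣} h)
  go true  true  true  false h = up {∣ (A ∪ C) ∩ (B ∩ D) ∣} {_} {∣ A ∩ B ∣} h
  go true  true  false true  h = s≤s h
  go true  true  false false h = ≤-trans h (n≤1+n _)
  go true  false true  true  h = upʳ {∣ (A ∪ C) ∩ (B ∩ D) ∣} {_} {∣ A ∩ B ∣} h
  go true  false true  false h = h
  go true  false false true  h = h
  go true  false false false h = h
  go false true  true  true  h = sˡ {∣ (A ∪ C) ∩ (B ∩ D) ∣} {_} {∣ A ∩ B ∣} h
  go false true  true  false h = h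
  go false true  false true  h = h
  go false true  false false h = h
  go false false true  true  h = wk {_} {∣ A ∩ B ∣} h
  go false false true  false h = h
  go false false false true  h = h
  go false false false false h = h

-- Relabelling for the minor on B, as the vertex set of a graph is always some `Fin k`.
enum : (B : Subset n) → Fin ∣ B ∣ → Fin n
enum (outside ∷ B) i       = suc (enum B i)
enum (inside  ∷ B) zero    = zero
enum (inside  ∷ B) (suc i) = suc (enum B i)

enum∈ : (B : Subset n) (i : Fin ∣ B ∣) → enum B i ∈ B
enum∈ (outside ∷ B) i       = there (enum∈ B i)
enum∈ (inside  ∷ B) zero    = here
enum∈ (inside  ∷ B) (suc i) = there (enum∈ B i)

enum-injective : (B : Subset n) {i j : Fin ∣ B ∣} → enum B i ≡ enum B j → i ≡ j
enum-injective (outside ∷ B)                     e = enum-injective B (suc-injective e)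
enum-injective (inside  ∷ B) {zero}  {zero}  e = refl
enum-injective (inside  ∷ B) {suc i} {suc j} e = cong suc (enum-injective B (suc-injective e))

enum-surjective : (B : Subset n) {v : Fin n} → v ∈ B → ∃ λ i → enum B i ≡ v
enum-surjective (outside ∷ B) (there h) = let (i , e) = enum-surjective B h in i , cong suc e
enum-surjective (inside  ∷ B) here      = zero , refl
enum-surjective (inside  ∷ B) (there h) = let (i , e) = enum-surjective B h in suc i , cong suc e

-- Reachability, components and separations

Adj : Graph n → Fin n → Fin n → Set
Adj G u v = E G u v ≡ true

adj? : (G : Graph n) → ∀ u v → Dec (Adj G u v)
adj? G u v = E G u v Bool.≟ true

module _ (G : Graph n) where

  adj-sym : ∀ {u v} → Adj G u v → Adj G v u
  adj-sym {u} {v} = trans (Graph.sym G v u)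

  adj-irrefl : ∀ {u v} → Adj G u v → u ≢ v
  adj-irrefl {u} a refl with trans (≡-sym a) (irref G u)
  ... | ()

  ¬adj⇒false : ∀ {u v} → ¬ Adj G u v → E G u v ≡ false
  ¬adj⇒false {u} {v} = Bool.¬-not

  false⇒¬adj : ∀ {u v} → E G u v ≡ false → ¬ Adj G u v
  false⇒¬adj e a with trans (≡-sym a) e
  ... | ()

  module _ {W : Fin n → Set} where

    reach-start : ∀ {u v} → Reach G W u v → W u
    reach-start (here w)     = w
    reach-start (step w _ _) = w

    reach-end : ∀ {u v} → Reach G W u v → W v
    reach-end (here w)     = w
    reach-end (step _ _ r) = reach-end r

    reach-trans : ∀ {u v w} → Reach G W u v → Reach G W v w → Reach G W u w
    reach-trans (here _)     s = s
    reach-trans (step w a r) s = step w a (reach-trans r s)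

    reach-snoc : ∀ {u v w} → Reach G W u v → Adj G v w → W w → Reach G W u w
    reach-snoc r a w = reach-trans r (step (reach-end r) a (here w))

    reach-sym : ∀ {u v} → Reach G W u v → Reach G W v u
    reach-sym (here w)     = here w
    reach-sym (step w a r) = reach-snoc (reach-sym r) (adj-sym a) w

    -- Invariants of walks: this confines a walk to a component or to one side of a separation.
    reach-closed : (Q : Fin n → Set) → (∀ u v → Q u → W v → Adj G u v → Q v) →
                   ∀ {u v} → Q u → Reach G W u v → Reach G Q u v
    reach-closed Q cl q (here _)     = here q
    reach-closed Q cl q (step _ a r) = step q a (reach-closed Q cl (cl _ _ q (reach-start r) a) r)

    connected-via : ∀ c → (∀ v → W v → Reach G W c v) → Connected G W
    connected-via c h u v wu wv = reach-trans (reach-sym (h u wu)) (h v wv)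

  reach-mono : ∀ {W W′ : Fin n → Set} → (∀ v → W v → W′ v) → ∀ {u v} → Reach G W u v → Reach G W′ u v
  reach-mono f (here w)     = here (f _ w)
  reach-mono f (step w a r) = step (f _ w) a (reach-mono f r)

  connected-resp : ∀ {W W′ : Fin n → Set} → (∀ v → W v → W′ v) → (∀ v → W′ v → W v) → Connected G W → Connected G W′
  connected-resp f g c u v wu wv = reach-mono f (c u v (g u wu) (g v wv))

  record Component (W : Fin n → Set) (a : Fin n) : Set where
    field
      K      : Subset n
      root   : a ∈ K
      reach  : ∀ v → v ∈ K → Reach G W a v
      closed : ∀ u v → u ∈ K → W v → Adj G u v → v ∈ K

    within : ∀ v → v ∈ K → W v
    within v h = reach-end (reach v h)

    connected : Connected G (_∈ K)
    connected = connected-via a λ v h → reach-closed (_∈ K) closed root (reach v h)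

  module _ {W : Fin n → Set} (W? : ∀ v → Dec (W v)) where

    component : ∀ a → W a → Component W a
    component a wa = grow n ⁅ a ⁆ (≤-trans (≤-reflexive (+-comm 1 n)) (+-monoʳ-≤ n (s≤s z≤n))) (x∈⁅x⁆ a)
        (λ v h → subst (Reach G W a) (≡-sym (x∈⁅y⁆⇒x≡y a h)) (here wa))
      where
      -- The bound says that `fuel` and the size of K add up to at least n, so without fuel K
      -- contains every vertex and cannot grow.
      grow : ∀ fuel (K : Subset n) → n < fuel + suc ∣ K ∣ → a ∈ K → (∀ v → v ∈ K → Reach G W a v) → Component W a
      grow fuel K lt ra rs with any? (λ v → any? λ u → (u ∈? K) ×-dec W? v ×-dec adj? G u v ×-dec ¬? (v ∈? K))
      ... | no stuck = record { K = K ; root = ra ; reach = rs ; closed = λ u v u∈ wv a →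
              decidable-stable (v ∈? K) λ v∉ → stuck (v , u , u∈ , wv , a , v∉) }
      grow zero K lt ra rs | yes (v , u , u∈ , wv , a , v∉) =
        contradiction (≤-trans lt (≤-trans bigger (∣p∣≤n (⁅ v ⁆ ∪ K)))) (<-irrefl refl)
        where
        bigger : suc ∣ K ∣ ≤ ∣ ⁅ v ⁆ ∪ K ∣
        bigger = p⊂q⇒∣p∣<∣q∣ (q⊆p∪q ⁅ v ⁆ K , v , ∈∪ˡ (x∈⁅x⁆ v) , v∉)
      grow (suc fuel) K lt ra rs | yes (v , u , u∈ , wv , a , v∉) =
        grow fuel (⁅ v ⁆ ∪ K) (≤-trans lt (≤-trans (≤-reflexive (≡-sym (+-suc fuel (suc ∣ K ∣)))) (+-monoʳ-≤ fuel (s≤s bigger))))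
          (∈∪ʳ ra)
          (λ w w∈ → [ (λ h → subst (Reach G W _) (≡-sym (x∈⁅y⁆⇒x≡y v h)) (reach-snoc (rs u u∈) a wv)) , rs w ]′
                      (x∈p∪q⁻ ⁅ v ⁆ K w∈))
        where
        bigger : suc ∣ K ∣ ≤ ∣ ⁅ v ⁆ ∪ K ∣
        bigger = p⊂q⇒∣p∣<∣q∣ (q⊆p∪q ⁅ v ⁆ K , v , ∈∪ˡ (x∈⁅x⁆ v) , v∉)

    reach? : ∀ u v → Dec (Reach G W u v)
    reach? u v with W? u
    ... | no ¬w = no (¬w ∘ reach-start)
    ... | yes w with v ∈? Component.K (component u w)
    ...   | yes h = yes (Component.reach (component u w) v h)
    ...   | no ¬h = no λ r → ¬h (reach-end (reach-closed _ (Component.closed (component u w)) (Component.root (component u w)) r))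

  module Separations where

    mkSep : ∀ {A B} → (∀ v → v ∈ A ⊎ v ∈ B) →
            (∀ u v → u ∈ A → u ∉ B → v ∈ B → v ∉ A → ¬ Adj G u v) → IsSeparation G A B
    mkSep c h = c , λ u v a b c d → ¬adj⇒false (h u v a b c d)

    sep-sym : ∀ {A B} → IsSeparation G A B → IsSeparation G B A
    sep-sym (c , h) = (λ v → [ inj₂ , inj₁ ]′ (c v)) , λ u v a b c d → trans (Graph.sym G u v) (h v u c d a b)

    sep-∉ʳ : ∀ {A B} → IsSeparation G A B → ∀ {v} → v ∉ B → v ∈ A
    sep-∉ʳ (c , _) {v} v∉ = [ id , ⊥-elim ∘ v∉ ]′ (c v)

    sep-nbr : ∀ {A B} → IsSeparation G A B → ∀ {u v} → u ∉ B → Adj G u v → v ∈ A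
    sep-nbr {A} s@(c , h) {u} {v} u∉ a with v ∈? A
    ... | yes v∈ = v∈
    ... | no  v∉ = ⊥-elim (false⇒¬adj (h u v (sep-∉ʳ s u∉) u∉ ([ ⊥-elim ∘ v∉ , id ]′ (c v)) v∉) a)

    sep-edge : ∀ {A B} → IsSeparation G A B → ∀ {u v} → Adj G u v → (u ∈ A × v ∈ A) ⊎ (u ∈ B × v ∈ B)
    sep-edge {A} {B} s {u} {v} a with u ∈? B | v ∈? B
    ... | yes p | yes q = inj₂ (p , q)
    ... | no  p | _     = inj₁ (sep-∉ʳ s p , sep-nbr s p a)
    ... | yes _ | no q  = inj₁ (sep-nbr s q (adj-sym a) , sep-∉ʳ s q)

    isSep? : ∀ A B → Dec (IsSeparation G A B)
    isSep? A B = all? (λ v → (v ∈? A) ⊎-dec (v ∈? B)) ×-dec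
      all? (λ u → all? λ v → (u ∈? A) →-dec (¬? (u ∈? B) →-dec ((v ∈? B) →-dec (¬? (v ∈? A) →-dec (E G u v Bool.≟ false)))))

    order-sym : ∀ (A B : Subset n) → order A B ≡ order B A
    order-sym A B = cong ∣_∣ (∩-comm A B)

    union-sep : ∀ {A B C D} → IsSeparation G A B → IsSeparation G C D → IsSeparation G (A ∪ C) (B ∩ D)
    union-sep {A} {B} {C} {D} s t = mkSep cov no-edge
      where
      cov : ∀ v → v ∈ A ∪ C ⊎ v ∈ B ∩ D
      cov v with v ∈? B | v ∈? D
      ... | no p  | _     = inj₁ (∈∪ˡ (sep-∉ʳ s p))
      ... | yes p | no q  = inj₁ (∈∪ʳ (sep-∉ʳ t q))
      ... | yes p | yes q = inj₂ (∈∩ p q)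
      no-edge : ∀ u v → u ∈ A ∪ C → u ∉ B ∩ D → v ∈ B ∩ D → v ∉ A ∪ C → ¬ Adj G u v
      no-edge u v _ u∉ _ v∉ a with u ∈? B | u ∈? D
      ... | no p  | _     = v∉ (∈∪ˡ (sep-nbr s p a))
      ... | yes p | no q  = v∉ (∈∪ʳ (sep-nbr t q a))
      ... | yes p | yes q = u∉ (∈∩ p q)

    intersection-sep : ∀ {A B C D} → IsSeparation G A B → IsSeparation G C D → IsSeparation G (A ∩ C) (B ∪ D)
    intersection-sep s t = sep-sym (union-sep (sep-sym s) (sep-sym t))

-- Elements of a 4-tangle

module _ {G : Graph n} {τ : OSeps n} (T : Tangle G 4 τ) where
  open Tangle T
  open Separations G

  τ-sep : ∀ {A B} → τ A B → IsSeparation G A B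
  τ-sep t = proj₁ (sound _ _ t)

  τ-order : ∀ {A B} → τ A B → order A B < 4
  τ-order t = proj₂ (sound _ _ t)

  no-pair : ∀ {A B C D} → τ A B → τ C D → (∀ v → v ∈ A ⊎ v ∈ C) →
            (∀ u v → Adj G u v → (u ∈ A × v ∈ A) ⊎ (u ∈ C × v ∈ C)) → ⊥
  no-pair s t c e = noCover _ _ _ _ _ _ s t t
    ((λ v → [ inj₁ , inj₂ ∘ inj₁ ]′ (c v)) , λ u v a → [ inj₁ , inj₂ ∘ inj₁ ]′ (e u v a))

  τ-asym : ∀ {A B} → τ A B → ¬ τ B A
  τ-asym s t = no-pair s t (proj₁ (τ-sep s)) (λ u v → sep-edge (τ-sep s))

  orient : ∀ {A B} → IsSeparation G A B → order A B < 4 → ¬ τ B A → τ A B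
  orient s o ¬t = [ id , ⊥-elim ∘ ¬t ]′ (complete _ _ s o)

  -- Although τ is an arbitrary predicate, `complete` reveals which orientation it contains, and the
  -- two sides of a separation cover G, which rules out the other. All later searches for elements
  -- of τ rest on this.
  τ? : ∀ A B → Dec (τ A B)
  τ? A B with isSep? A B | order A B <? 4
  ... | no ¬s | _     = no λ t → ¬s (τ-sep t)
  ... | yes _ | no ¬o = no λ t → ¬o (τ-order t)
  ... | yes s | yes o with complete A B s o
  ...   | inj₁ t = yes t
  ...   | inj₂ t = no (τ-asym t)

  not-full : ∀ {A B} → τ A B → ¬ (∀ v → v ∈ A)
  not-full t h = no-pair t t (λ v → inj₁ (h v)) λ u v _ → inj₁ (h u , h v)

  -- The opposite orientation would have the whole graph as its small side.
  few-small : ∀ A → ∣ A ∣ ≤ 3 → τ A ⊤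
  few-small A ≤3 = orient (mkSep (λ v → inj₂ ∈⊤) λ u v _ u∉ → ⊥-elim (u∉ ∈⊤))
    (s≤s (≤-trans (∣p∩q∣≤∣p∣ A ⊤) ≤3)) (λ t → not-full t λ v → ∈⊤)

  -- If `(D , C)` were in τ, the small sides A and D would cover G, because D contains B.
  τ-mono : ∀ {A B C D} → τ A B → IsSeparation G C D → order C D < 4 →
           (∀ v → v ∈ B → v ∈ D) → τ C D
  τ-mono t s o ⊆ = orient s o λ t′ → no-pair t t′
    (λ v → [ inj₁ , inj₂ ∘ ⊆ v ]′ (proj₁ (τ-sep t) v))
    (λ u v a → [ inj₁ , (λ (p , q) → inj₂ (⊆ u p , ⊆ v q)) ]′ (sep-edge (τ-sep t) a))

  -- The sets A, C and B ∩ D cover G, so the reverse orientation is impossible.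
  τ-union : ∀ {A B C D} → τ A B → τ C D → order (A ∪ C) (B ∩ D) < 4 → τ (A ∪ C) (B ∩ D)
  τ-union {A} {B} {C} {D} s t o = orient (union-sep (τ-sep s) (τ-sep t)) o λ r →
    noCover _ _ _ _ _ _ s t r (cov , edg)
    where
    cov : ∀ v → v ∈ A ⊎ v ∈ C ⊎ v ∈ B ∩ D
    cov v with v ∈? B | v ∈? D
    ... | no p  | _     = inj₁ (sep-∉ʳ (τ-sep s) p)
    ... | yes _ | no q  = inj₂ (inj₁ (sep-∉ʳ (τ-sep t) q))
    ... | yes p | yes q = inj₂ (inj₂ (∈∩ p q))
    edg : ∀ u v → Adj G u v → (u ∈ A × v ∈ A) ⊎ (u ∈ C × v ∈ C) ⊎ (u ∈ B ∩ D × v ∈ B ∩ D)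
    edg u v a with sep-edge (τ-sep s) a | sep-edge (τ-sep t) a
    ... | inj₁ p       | _            = inj₁ p
    ... | inj₂ _       | inj₁ q       = inj₂ (inj₁ q)
    ... | inj₂ (p , q) | inj₂ (r , s) = inj₂ (inj₂ (∈∩ p r , ∈∩ q s))

  -- The part of k-connectedness that τ can detect: no small side of order below k has interior
  -- vertices, that is, vertices outside B.
  TangleConnected : ℕ → Set
  TangleConnected k = ∀ A B → τ A B → order A B < k → A ⊆ B

  weaken : ∀ {k l} → k ≤ l → TangleConnected l → TangleConnected k
  weaken k≤l con A B t o = con A B t (≤-trans o k≤l)

  -- The separation of `R ∪ X` from the complement of R must have `R ∪ X` as its small side, because
  -- A contains R with all its neighbours and so A and the complement of R cover G. As its order is
  -- below k, it has no interior, and R is empty.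
  no-inner : ∀ {k} → k ≤ 4 → TangleConnected k → ∀ {A B} → τ A B →
             (R X : Subset n) → (∀ u → u ∈ R → u ∉ B) →
             (∀ u v → u ∈ R → Adj G u v → v ∈ R ⊎ v ∈ X) → (∀ u → u ∈ X → u ∉ R) →
             ∣ X ∣ < k → ∀ u → u ∉ R
  no-inner {k} k≤4 con {A} {B} t R X R∉B nbr disj <k u u∈ = x∈p⇒x∉∁p u∈ (con _ _ small o<k (∈∪ˡ u∈))
    where
    o<k : order (R ∪ X) (∁ R) < k
    o<k = ≤-trans (s≤s (⊆-card λ v h → [ (λ r → ⊥-elim (x∈p⇒x∉∁p r (∩ʳ (R ∪ X) (∁ R) h))) , id ]′
                         (x∈p∪q⁻ R X (∩ˡ (R ∪ X) (∁ R) h)))) <k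
    sep : IsSeparation G (R ∪ X) (∁ R)
    sep = mkSep cov λ v w v∈ v∉ w∈ w∉ a → w∉ ([ ∈∪ˡ , ∈∪ʳ ]′ (nbr v w (x∉∁p⇒x∈p v∉) a))
      where
      cov : ∀ v → v ∈ R ∪ X ⊎ v ∈ ∁ R
      cov v with v ∈? R
      ... | yes p = inj₁ (∈∪ˡ p)
      ... | no  p = inj₂ (x∉p⇒x∈∁p p)
    small : τ (R ∪ X) (∁ R)
    small = orient sep (≤-trans o<k k≤4) λ t′ → no-pair t t′ cov edg
      where
      cov : ∀ v → v ∈ A ⊎ v ∈ ∁ R
      cov v with v ∈? R
      ... | yes p = inj₁ (sep-∉ʳ (τ-sep t) (R∉B v p))
      ... | no  p = inj₂ (x∉p⇒x∈∁p p)
      edg : ∀ v w → Adj G v w → (v ∈ A × w ∈ A) ⊎ (v ∈ ∁ R × w ∈ ∁ R)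
      edg v w a with v ∈? R | w ∈? R
      ... | yes p | _     = inj₁ (sep-∉ʳ (τ-sep t) (R∉B v p) , sep-nbr (τ-sep t) (R∉B v p) a)
      ... | no _  | yes q = inj₁ (sep-nbr (τ-sep t) (R∉B w q) (adj-sym G a) , sep-∉ʳ (τ-sep t) (R∉B w q))
      ... | no p  | no q  = inj₂ (x∉p⇒x∈∁p p , x∉p⇒x∈∁p q)

  -- Dropping an unattached vertex from the separator would lower the order.
  attached : ∀ {A B} → τ A B → TangleConnected (order A B) → ∀ {a} (C : Component G (_∉ B) a) →
             ∀ s → s ∈ A ∩ B → ∃ λ u → u ∈ Component.K C × Adj G u s
  attached {A} {B} t con {a} C s s∈ with any? (λ u → (u ∈? Component.K C) ×-dec adj? G u s)
  ... | yes h = h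
  ... | no ¬h = ⊥-elim (no-inner (≤-trans (n≤1+n _) (τ-order t)) con t K ((A ∩ B) - s) within nbr
      (λ u h k → within u k (∩ʳ A B (minus⊆ h))) (x∈p⇒∣p-x∣<∣p∣ s∈) a root)
    where
    open Component C
    nbr : ∀ u v → u ∈ K → Adj G u v → v ∈ K ⊎ v ∈ (A ∩ B) - s
    nbr u v u∈ a with v ∈? B
    ... | no v∉  = inj₁ (closed u v u∈ v∉ a)
    ... | yes v∈ = inj₂ (∈-minus (∈∩ (sep-nbr (τ-sep t) (within u u∈) a) v∈) λ { refl → ¬h (u , u∈ , a) })

  -- If A ∪ C has order at least 4, submodularity leaves order at most 2 for A ∩ C.
  crossing : TangleConnected 3 → ∀ {A B C D} → τ A B → (∀ E F → τ E F → A ⊆ E → E ⊆ A) → τ C D →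
             C ⊆ A ⊎ ∣ A ∩ C ∣ ≤ 2
  crossing con {A} {B} {C} {D} t max s with order (A ∪ C) (B ∩ D) <? 4
  ... | yes o = inj₁ λ c → max _ _ (τ-union t s o) ∈∪ˡ (∈∪ʳ c)
  -- The corner has order at most 2, hence no interior: all of `A ∩ C` lies in its separator.
  ... | no ¬o = inj₂ (≤-trans (⊆-card λ v h → ∈∩ h (con _ _ corner (s≤s corner≤2) h)) corner≤2)
    where
    corner≤2 : order (A ∩ C) (B ∪ D) ≤ 2
    corner≤2 = +-cancelˡ-≤ 4 _ _ (≤-trans (+-monoˡ-≤ _ (≮⇒≥ ¬o))
      (≤-trans (∪∩-card A B C D) (+-mono-≤ (≤-pred (τ-order t)) (≤-pred (τ-order s)))))
    corner : τ (A ∩ C) (B ∪ D)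
    corner = τ-mono t (intersection-sep (τ-sep t) (τ-sep s)) (≤-trans (s≤s corner≤2) (n≤1+n _)) λ v → ∈∪ˡ

  Maximal : Subset n → Subset n → Set
  Maximal A B = τ A B × (∀ E F → τ E F → A ⊆ E → E ⊆ A)

  extend-max : ∀ {A B} → τ A B → ∃ λ A′ → ∃ λ B′ → Maximal A′ B′ × A ⊆ A′
  extend-max {A} t = go (suc n) (m≤m+n (suc n) _) t id
    where
    go : ∀ fuel {C D} → n < fuel + ∣ C ∣ → τ C D → A ⊆ C → ∃ λ A′ → ∃ λ B′ → Maximal A′ B′ × A ⊆ A′
    go fuel {C} {D} lt s A⊆C with anySubset? (λ E → anySubset? (λ F → τ? E F ×-dec (C ⊂? E)))
    ... | no top = C , D , (s , λ E F r C⊆E {x} x∈ → decidable-stable (x ∈? C) λ x∉ → top (E , F , r , C⊆E , x , x∈ , x∉)) , A⊆C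
    go zero {C} lt s A⊆C | yes _ = contradiction (≤-trans lt (∣p∣≤n C)) (<-irrefl refl)
    go (suc fuel) {C} lt s A⊆C | yes (E , F , r , C⊂E) =
      go fuel (≤-trans lt (≤-trans (≤-reflexive (≡-sym (+-suc fuel ∣ C ∣))) (+-monoʳ-≤ fuel (p⊂q⇒∣p∣<∣q∣ C⊂E))))
        r (λ x∈ → proj₁ C⊂E (A⊆C x∈))

-- Images and lifts along minor-maps

module _ {G : Graph n} {H : Graph m} (φ : MinorMap G H) where
  open Separations

  private
    hit? : (A : Subset n) → ∀ x → Dec (∃ λ u → u ∈ A × f φ u ≡ just x)
    hit? A x = any? λ u → (u ∈? A) ×-dec Maybe.≡-dec _≟_ (f φ u) (just x)

  image : Subset n → Subset m
  image A = select (hit? A)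

  image-isImage : ∀ A → IsImage φ A (image A)
  image-isImage A x = ∈-select⁻ (hit? A) , ∈-select⁺ (hit? A)

  image-unique : ∀ {A X Y} → IsImage φ A X → IsImage φ A Y → X ≡ Y
  image-unique i j = ⊆-antisym (λ {x} h → proj₂ (j x) (proj₁ (i x) h)) (λ {x} h → proj₂ (i x) (proj₁ (j x) h))

  meets-separator : ∀ {A B} → IsSeparation G A B → ∀ {W u v} → Reach G W u v → u ∈ A → v ∈ B →
                    ∃ λ w → w ∈ A ∩ B × W w
  meets-separator {A} {B} s {u = u} (here w) u∈ v∈ = u , ∈∩ u∈ v∈ , w
  meets-separator {A} {B} s {u = u} (step w a r) u∈ v∈ with u ∈? B
  ... | yes u∈B = u , ∈∩ u∈ u∈B , w
  ... | no  u∉B = meets-separator s r (sep-nbr G s u∉B a) v∈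

  module _ {A B A′ B′} (s : IsSeparation G A B) (iA : IsImage φ A A′) (iB : IsImage φ B B′) where

    image-sep : IsSeparation H A′ B′
    image-sep = mkSep H cov λ x y _ x∉ _ y∉ a → no-edge x y x∉ y∉ (edges φ x y a)
      where
      cov : ∀ x → x ∈ A′ ⊎ x ∈ B′
      cov x with surj φ x
      ... | u , e with proj₁ s u
      ...   | inj₁ p = inj₁ (proj₂ (iA x) (u , p , e))
      ...   | inj₂ p = inj₂ (proj₂ (iB x) (u , p , e))
      no-edge : ∀ x y → x ∉ B′ → y ∉ A′ →
                ¬ (Σ (Fin n) λ u → Σ (Fin n) λ v → f φ u ≡ just x × f φ v ≡ just y × Adj G u v)
      no-edge x y x∉ y∉ (u , v , eu , ev , a) =
        y∉ (proj₂ (iA y) (v , sep-nbr G s (λ u∈ → x∉ (proj₂ (iB x) (u , u∈ , eu))) a , ev))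

    -- A connected branch set that meets both sides contains a vertex of `A ∩ B`, and distinct
    -- branch sets are disjoint.
    image-order : order A′ B′ ≤ order A B
    image-order = card-inj (A′ ∩ B′) (A ∩ B) (λ x p → proj₁ (choice x p)) (λ x p → proj₁ (proj₂ (choice x p)))
        λ x y p q e → just-injective (trans (≡-sym (proj₂ (proj₂ (choice x p)))) (trans (cong (f φ) e) (proj₂ (proj₂ (choice y q)))))
      where
      choice : ∀ x → x ∈ A′ ∩ B′ → ∃ λ w → w ∈ A ∩ B × f φ w ≡ just x
      choice x p =
        let (u , u∈ , eu) = proj₁ (iA x) (∩ˡ A′ B′ p)
            (v , v∈ , ev) = proj₁ (iB x) (∩ʳ A′ B′ p)
        in meets-separator s (branchConnected φ x u v eu ev) u∈ v∈

  -- Both sides orient every separation exactly once, so one inclusion suffices.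
  lift-≐ : ∀ {τ σ} → Tangle G 4 τ → Tangle H 4 σ →
           (∀ C D C′ D′ → τ C D → IsImage φ C C′ → IsImage φ D D′ → σ C′ D′) → Lift φ 4 σ ≐ τ
  lift-≐ {τ} {σ} T S sub A B = to , λ t →
      proj₁ (Tangle.sound T A B t) , proj₂ (Tangle.sound T A B t) ,
      image A , image B , image-isImage A , image-isImage B , sub A B _ _ t (image-isImage A) (image-isImage B)
    where
    to : Lift φ 4 σ A B → τ A B
    to (s , o , A′ , B′ , iA , iB , h) = orient T s o λ t → τ-asym S h (sub _ _ _ _ t iB iA)

module _ (G : Graph n) where

  id-minor : MinorMap G G
  id-minor = record
    { f = just
    ; surj = λ x → x , refl
    ; branchConnected = λ { x u .u refl refl → here refl }
    ; edges = λ x y a → x , y , refl , refl , a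
    }

  id-image : ∀ {A A′} → IsImage id-minor A A′ → A ≡ A′
  id-image {A} {A′} i = ⊆-antisym (λ {x} h → proj₂ (i x) (x , h , refl))
    λ {x} h → let (u , u∈ , e) = proj₁ (i x) h in subst (_∈ A) (just-injective e) u∈

  id-lift : ∀ {τ} → Tangle G 4 τ → Lift id-minor 4 τ ≐ τ
  id-lift {τ} T = lift-≐ id-minor T T λ C D C′ D′ t iC iD → subst₂ τ (id-image iC) (id-image iD) t

bind-just : ∀ {A B : Set} (x : Maybe A) {g : A → Maybe B} {b} → (x >>= g) ≡ just b → ∃ λ a → x ≡ just a × g a ≡ just b
bind-just (just a) e = a , refl , e

module _ {k} {G : Graph n} {H : Graph m} {L : Graph k} (φ : MinorMap G H) (ψ : MinorMap H L) where

  private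
    to : Fin n → Maybe (Fin k)
    to u = f φ u >>= f ψ

    to-just : ∀ {u h x} → f φ u ≡ just h → f ψ h ≡ just x → to u ≡ just x
    to-just e e′ rewrite e = e′

    lift-reach : ∀ {x h h′} → Reach H (λ h → f ψ h ≡ just x) h h′ →
                 ∀ u v → f φ u ≡ just h → f φ v ≡ just h′ → Reach G (λ u → to u ≡ just x) u v
    lift-reach (here w) u v eu ev = reach-mono G (λ _ e → to-just e w) (branchConnected φ _ u v eu ev)
    lift-reach (step w a r) u v eu ev =
      let (p , q , ep , eq , b) = edges φ _ _ a
      in reach-trans G (reach-mono G (λ _ e → to-just e w) (branchConnected φ _ u p eu ep))
           (step (to-just ep w) b (lift-reach r q v eq ev))

  _∘-minor_ : MinorMap G L
  _∘-minor_ = record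
    { f = to
    ; surj = λ x → let (h , eh) = surj ψ x ; (u , eu) = surj φ h in u , to-just eu eh
    ; branchConnected = λ x u v eu ev →
        let (h , e₁ , e₂) = bind-just (f φ u) eu
            (h′ , e₃ , e₄) = bind-just (f φ v) ev
        in lift-reach (branchConnected ψ x h h′ e₂ e₄) u v e₁ e₃
    ; edges = λ x y a →
        let (h , h′ , eh , eh′ , b) = edges ψ x y a
            (u , v , eu , ev , c) = edges φ h h′ b
        in u , v , to-just eu eh , to-just ev eh′ , c
    }

  image-∘ : ∀ {A A′ A″} → IsImage φ A A′ → IsImage ψ A′ A″ → IsImage _∘-minor_ A A″
  image-∘ {A} i j x =
    (λ x∈ → let (h , h∈ , eh) = proj₁ (j x) x∈ ; (u , u∈ , eu) = proj₁ (i h) h∈ in u , u∈ , to-just eu eh) ,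
    λ { (u , u∈ , e) → let (h , eu , eh) = bind-just (f φ u) e in proj₂ (j x) (h , proj₂ (i h) (u , u∈ , eu) , eh) }

  lift-∘ : ∀ {τ ρ σ} → Tangle G 4 τ → Tangle L 4 σ → Lift φ 4 ρ ≐ τ → Lift ψ 4 σ ≐ ρ → Lift _∘-minor_ 4 σ ≐ τ
  lift-∘ {σ = σ} T S p q = lift-≐ _∘-minor_ T S λ C D C″ D″ t iC iD →
    let (_ , _ , C′ , D′ , jC , jD , r) = proj₂ (p C D) t
        (_ , _ , C‴ , D‴ , kC , kD , s) = proj₂ (q C′ D′) r
    in subst₂ σ (image-unique _∘-minor_ (image-∘ jC kC) iC) (image-unique _∘-minor_ (image-∘ jD kD) iD) s

-- Torsos

relGraph : {R : Fin n → Fin n → Set} → (∀ i j → Dec (R i j)) →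
           (∀ {i j} → R i j → R j i) → (∀ {i} → ¬ R i i) → Graph n
relGraph R? s i = record
  { E     = λ u v → does (R? u v)
  ; sym   = λ u v → does-⇔ (mk⇔ s s) (R? u v) (R? v u)
  ; irref = λ u → dec-false (R? u u) i
  }

relGraph-adj⁻ : {R : Fin n → Fin n → Set} (R? : ∀ i j → Dec (R i j)) → ∀ {i j} → does (R? i j) ≡ true → R i j
relGraph-adj⁻ R? {i} {j} e with R? i j
... | yes r = r
relGraph-adj⁻ R? {i} {j} () | no _

-- The data of a minor-map from G onto the graph G[B] with A ∩ B made complete.
record Retraction (G : Graph n) (A B : Subset n) : Set where
  field
    p       : Fin n → Maybe (Fin n)
    fixes   : ∀ b → b ∈ B → p b ≡ just b
    into-B  : ∀ u s → p u ≡ just s → s ∈ B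
    into-A  : ∀ u s → u ∉ B → p u ≡ just s → s ∈ A
    fibres  : ∀ s → s ∈ B → Connected G (λ u → p u ≡ just s)
    clique  : ∀ s t → s ∈ A ∩ B → t ∈ A ∩ B → s ≢ t →
              ∃ λ u → ∃ λ v → p u ≡ just s × p v ≡ just t × Adj G u v

-- A and the three sets cover G with A ∩ B made complete; this is the only obstruction to inheriting
-- the tangle in that minor.
FourCover : (G : Graph n) (A B P Q R : Subset n) → Set
FourCover G A B P Q R =
  (∀ v → v ∈ A ⊎ v ∈ P ⊎ v ∈ Q ⊎ v ∈ R) ×
  (∀ u v → Adj G u v → (u ∈ A × v ∈ A) ⊎ (u ∈ P × v ∈ P) ⊎ (u ∈ Q × v ∈ Q) ⊎ (u ∈ R × v ∈ R)) ×
  (∀ s t → s ∈ A ∩ B → t ∈ A ∩ B → (s ∈ P × t ∈ P) ⊎ (s ∈ Q × t ∈ Q) ⊎ (s ∈ R × t ∈ R))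

HasFourCover : (G : Graph n) (τ : OSeps n) (A B : Subset n) → Set
HasFourCover {n} G τ A B = Σ (Subset n) λ P → Σ (Subset n) λ P′ → Σ (Subset n) λ Q → Σ (Subset n) λ Q′ →
  Σ (Subset n) λ R → Σ (Subset n) λ R′ → τ P P′ × τ Q Q′ × τ R R′ × FourCover G A B P Q R

module TorsoReduction {G : Graph n} {τ : OSeps n} (T : Tangle G 4 τ) {A B : Subset n} (t : τ A B)
             (ρ : Retraction G A B) where
  open Retraction ρ
  open Separations

  private
    e : Fin ∣ B ∣ → Fin n
    e = enum B

    S : IsSeparation G A B
    S = τ-sep T t

  Edge : Fin ∣ B ∣ → Fin ∣ B ∣ → Set
  Edge i j = Adj G (e i) (e j) ⊎ (i ≢ j × e i ∈ A × e j ∈ A)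

  edge? : ∀ i j → Dec (Edge i j)
  edge? i j = adj? G (e i) (e j) ⊎-dec (¬? (i ≟ j) ×-dec ((e i ∈? A) ×-dec (e j ∈? A)))

  H : Graph ∣ B ∣
  H = relGraph edge?
    (λ { (inj₁ a) → inj₁ (adj-sym G a) ; (inj₂ (ne , p , q)) → inj₂ (ne ∘ ≡-sym , q , p) })
    (λ { (inj₁ a) → adj-irrefl G a refl ; (inj₂ (ne , _)) → ne refl })

  index : Fin n → Maybe (Fin ∣ B ∣)
  index v with v ∈? B
  ... | yes v∈ = just (proj₁ (enum-surjective B v∈))
  ... | no  _  = nothing

  index-e : ∀ i → index (e i) ≡ just i
  index-e i with e i ∈? B
  ... | yes h = cong just (enum-injective B (proj₂ (enum-surjective B h)))
  ... | no ¬h = ⊥-elim (¬h (enum∈ B i))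

  index-just : ∀ {v i} → index v ≡ just i → v ≡ e i
  index-just {v} q with v ∈? B
  index-just refl | yes h = ≡-sym (proj₂ (enum-surjective B h))
  index-just ()   | no _

  to : Fin n → Maybe (Fin ∣ B ∣)
  to u = p u >>= index

  to⁺ : ∀ {u i} → p u ≡ just (e i) → to u ≡ just i
  to⁺ {u} {i} q rewrite q = index-e i

  to⁻ : ∀ {u i} → to u ≡ just i → p u ≡ just (e i)
  to⁻ {u} q = let (v , a , b) = bind-just (p u) q in trans a (cong just (index-just b))

  to-e : ∀ i → to (e i) ≡ just i
  to-e i = to⁺ (fixes (e i) (enum∈ B i))

  φ : MinorMap G H
  φ = record
    { f = to
    ; surj = λ i → e i , to-e i
    ; branchConnected = λ i → connected-resp G (λ v → to⁺) (λ v → to⁻) (fibres (e i) (enum∈ B i))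
    ; edges = λ i j a → edg i j (relGraph-adj⁻ edge? a)
    }
    where
    edg : ∀ i j → Edge i j → Σ (Fin n) λ u → Σ (Fin n) λ v → to u ≡ just i × to v ≡ just j × Adj G u v
    edg i j (inj₁ a) = e i , e j , to-e i , to-e j , a
    edg i j (inj₂ (ne , p , q)) =
      let (u , v , a , b , c) = clique (e i) (e j) (∈∩ p (enum∈ B i)) (∈∩ q (enum∈ B j)) (ne ∘ enum-injective B)
      in u , v , to⁺ a , to⁺ b , c

  edgeH : ∀ {i j} → Edge i j → Adj H i j
  edgeH {i} {j} = dec-true (edge? i j)

  private
    in? : (X : Subset ∣ B ∣) → ∀ v → Dec (∃ λ i → e i ≡ v × i ∈ X)
    in? X v = any? λ i → (e i ≟ v) ×-dec (i ∈? X)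

  up : Subset ∣ B ∣ → Subset n
  up X = select (in? X)

  ∈up : ∀ {X i} → i ∈ X → e i ∈ up X
  ∈up {X} h = ∈-select⁺ (in? X) (_ , refl , h)

  up∈ : ∀ {X v} → v ∈ up X → ∃ λ i → e i ≡ v × i ∈ X
  up∈ {X} = ∈-select⁻ (in? X)

  up-e : ∀ {X i} → e i ∈ up X → i ∈ X
  up-e {X} h = let (j , q , j∈) = up∈ h in subst (_∈ X) (enum-injective B q) j∈

  module _ {X Y : Subset ∣ B ∣} (s : IsSeparation H X Y) (ABX : ∀ i → e i ∈ A → i ∈ X) where

    -- A is glued to the side X that contains the clique. Its vertices in B already belong to X and
    -- those outside B are contracted into the clique, so neither the order nor the images change.
    pull-sep : IsSeparation G (up X ∪ A) (up Y)
    pull-sep = mkSep G cov λ u v _ u∉ v∈ v∉ a → no-edge u v u∉ v∈ v∉ a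
      where
      cov : ∀ v → v ∈ up X ∪ A ⊎ v ∈ up Y
      cov v with v ∈? B
      ... | no  h = inj₁ (∈∪ʳ (sep-∉ʳ G S h))
      ... | yes h with enum-surjective B h
      ...   | i , refl with proj₁ s i
      ...     | inj₁ p = inj₁ (∈∪ˡ (∈up p))
      ...     | inj₂ q = inj₂ (∈up q)
      no-edge : ∀ u v → u ∉ up Y → v ∈ up Y → v ∉ up X ∪ A → ¬ Adj G u v
      no-edge u v u∉ v∈ v∉ a with u ∈? B
      ... | no  h = v∉ (∈∪ʳ (sep-nbr G S h a))
      ... | yes h with enum-surjective B h | up∈ v∈
      ...   | i , refl | j , refl , j∈ = v∉ (∈∪ˡ (∈up (sep-nbr H s (u∉ ∘ ∈up) (edgeH (inj₁ a)))))

    pull-order : order (up X ∪ A) (up Y) ≤ order X Y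
    pull-order = card-inj _ (X ∩ Y) (λ v h → proj₁ (choice v h)) (λ v h → proj₂ (proj₂ (choice v h)))
        λ v w h k q → trans (≡-sym (proj₁ (proj₂ (choice v h)))) (trans (cong e q) (proj₁ (proj₂ (choice w k))))
      where
      choice : ∀ v → v ∈ (up X ∪ A) ∩ up Y → ∃ λ i → e i ≡ v × i ∈ X ∩ Y
      choice v h with up∈ (∩ʳ (up X ∪ A) (up Y) h)
      ... | i , refl , i∈ with x∈p∪q⁻ (up X) A (∩ˡ (up X ∪ A) (up Y) h)
      ...   | inj₁ p = i , refl , ∈∩ (up-e p) i∈
      ...   | inj₂ q = i , refl , ∈∩ (ABX i q) i∈

    pull-imageˡ : IsImage φ (up X ∪ A) X
    pull-imageˡ x = (λ h → e x , ∈∪ˡ (∈up h) , to-e x) , back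
      where
      back : (Σ (Fin n) λ u → u ∈ up X ∪ A × to u ≡ just x) → x ∈ X
      back (u , u∈ , q) with u ∈? B
      ... | no  h = ABX x (into-A u (e x) h (to⁻ q))
      ... | yes h with enum-surjective B h
      ...   | i , refl with trans (≡-sym (to-e i)) q | x∈p∪q⁻ (up X) A u∈
      ...     | refl | inj₁ k = up-e k
      ...     | refl | inj₂ k = ABX x k

    pull-imageʳ : IsImage φ (up Y) Y
    pull-imageʳ x = (λ h → e x , ∈up h , to-e x) , back
      where
      back : (Σ (Fin n) λ u → u ∈ up Y × to u ≡ just x) → x ∈ Y
      back (u , u∈ , q) with up∈ u∈
      ... | i , refl , i∈ with trans (≡-sym (to-e i)) q
      ...   | refl = i∈

  -- A ∩ B is complete in H, so it lies on one side.
  clique-side : ∀ {X Y} → IsSeparation H X Y → (∀ i → e i ∈ A → i ∈ X) ⊎ (∀ i → e i ∈ A → i ∈ Y)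
  clique-side {X} {Y} s with any? (λ i → (e i ∈? A) ×-dec ¬? (i ∈? X))
  ... | no ¬h = inj₁ λ i i∈ → decidable-stable (i ∈? X) λ i∉ → ¬h (i , i∈ , i∉)
  ... | yes (i , i∈ , i∉) = inj₂ λ j j∈ → side j j∈ (i ≟ j)
    where
    s′ : IsSeparation H Y X
    s′ = sep-sym H s
    side : ∀ j → e j ∈ A → Dec (i ≡ j) → j ∈ Y
    side j j∈ (yes refl) = sep-∉ʳ H s′ i∉
    side j j∈ (no ne)    = sep-nbr H s′ i∉ (edgeH (inj₂ (ne , i∈ , j∈)))

  -- Collecting all images of elements of τ makes the statement about the lift immediate; the
  -- difficulty moves to showing that no three images cover H.
  σ : OSeps ∣ B ∣
  σ X Y = ∃ λ C → ∃ λ D → τ C D × IsImage φ C X × IsImage φ D Y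

  module _ {C D : Subset n} {Y : Subset ∣ B ∣} (c : τ C D) (iD : IsImage φ D Y) where

    private
      ∉D : ∀ {i} → i ∉ Y → e i ∉ D
      ∉D {i} h k = h (proj₂ (iD i) (e i , k , to-e i))

    -- This orients the separation pulled back from the image of `(C , D)`. If it pointed the wrong
    -- way, its small side, `up Y` with or without A, would help C and A to cover G.
    three-cover : ∀ v → v ∈ C ⊎ v ∈ A ⊎ v ∈ up Y
    three-cover v with v ∈? B
    ... | no  h = inj₂ (inj₁ (sep-∉ʳ G S h))
    ... | yes h with enum-surjective B h
    ...   | i , refl with i ∈? Y
    ...     | yes k = inj₂ (inj₂ (∈up k))
    ...     | no  k = inj₁ (sep-∉ʳ G (τ-sep T c) (∉D k))

    three-cover-edge : ∀ u v → Adj G u v → (u ∈ C × v ∈ C) ⊎ (u ∈ A × v ∈ A) ⊎ (u ∈ up Y × v ∈ up Y)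
    three-cover-edge u v a with sep-edge G S a
    ... | inj₁ h = inj₂ (inj₁ h)
    ... | inj₂ (u∈ , v∈) with enum-surjective B u∈ | enum-surjective B v∈
    ...   | i , refl | j , refl with i ∈? Y | j ∈? Y
    ...     | yes k | yes l = inj₂ (inj₂ (∈up k , ∈up l))
    ...     | no  k | _     = inj₁ (sep-∉ʳ G (τ-sep T c) (∉D k) , sep-nbr G (τ-sep T c) (∉D k) a)
    ...     | yes _ | no l  = inj₁ (sep-nbr G (τ-sep T c) (∉D l) (adj-sym G a) , sep-∉ʳ G (τ-sep T c) (∉D l))

  -- Every element of σ is the image of an element of τ nested with (A , B).
  nested : ∀ {X Y} → σ X Y → ∃ λ P → ∃ λ P′ → τ P P′ × (∀ i → i ∈ X → e i ∈ P)
  nested {X} {Y} (C , D , c , iC , iD) = [ A-inside , A-outside ]′ (clique-side s)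
    where
    s : IsSeparation H X Y
    s = image-sep φ (τ-sep T c) iC iD
    o : order X Y < 4
    o = ≤-trans (s≤s (image-order φ (τ-sep T c) iC iD)) (τ-order T c)
    A-inside : (∀ i → e i ∈ A → i ∈ X) → ∃ λ P → ∃ λ P′ → τ P P′ × (∀ i → i ∈ X → e i ∈ P)
    A-inside inX = up X ∪ A , up Y ,
      orient T (pull-sep s inX) (≤-trans (s≤s (pull-order s inX)) o)
        (λ r → Tangle.noCover T _ _ _ _ _ _ c t r (three-cover c iD , three-cover-edge c iD)) ,
      λ i h → ∈∪ˡ (∈up h)
    A-outside : (∀ i → e i ∈ A → i ∈ Y) → ∃ λ P → ∃ λ P′ → τ P P′ × (∀ i → i ∈ X → e i ∈ P)
    A-outside inY = up X , up Y ∪ A ,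
      orient T (sep-sym G (pull-sep s′ inY))
        (≤-trans (s≤s (≤-trans (≤-reflexive (order-sym G (up X) (up Y ∪ A))) (pull-order s′ inY)))
          (subst (_< 4) (order-sym H X Y) o))
        (λ r → no-pair T c r (λ v → Sum.map₂ [ ∈∪ʳ , ∈∪ˡ ]′ (three-cover c iD v))
          λ u v a → Sum.map₂ [ (λ (h , k) → ∈∪ʳ h , ∈∪ʳ k) , (λ (h , k) → ∈∪ˡ h , ∈∪ˡ k) ]′ (three-cover-edge c iD u v a)) ,
      λ i → ∈up
      where
      s′ : IsSeparation H Y X
      s′ = sep-sym H s

  module _ (no4 : ¬ HasFourCover G τ A B) where

    σ-noCover : ∀ X₁ Y₁ X₂ Y₂ X₃ Y₃ → σ X₁ Y₁ → σ X₂ Y₂ → σ X₃ Y₃ → ¬ Covers H X₁ X₂ X₃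
    σ-noCover X₁ Y₁ X₂ Y₂ X₃ Y₃ s₁ s₂ s₃ (cv , ce) with nested s₁ | nested s₂ | nested s₃
    ... | P , P′ , τP , inP | Q , Q′ , τQ , inQ | R , R′ , τR , inR =
      no4 (P , P′ , Q , Q′ , R , R′ , τP , τQ , τR , cov , edg , clq)
      where
      cov′ : ∀ i → e i ∈ P ⊎ e i ∈ Q ⊎ e i ∈ R
      cov′ i = Sum.map (inP i) (Sum.map (inQ i) (inR i)) (cv i)
      edg′ : ∀ i j → Edge i j → (e i ∈ P × e j ∈ P) ⊎ (e i ∈ Q × e j ∈ Q) ⊎ (e i ∈ R × e j ∈ R)
      edg′ i j a = Sum.map (λ (p , q) → inP i p , inP j q)
        (Sum.map (λ (p , q) → inQ i p , inQ j q) (λ (p , q) → inR i p , inR j q)) (ce i j (edgeH a))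
      cov : ∀ v → v ∈ A ⊎ v ∈ P ⊎ v ∈ Q ⊎ v ∈ R
      cov v with v ∈? B
      ... | no  h = inj₁ (sep-∉ʳ G S h)
      ... | yes h with enum-surjective B h
      ...   | i , refl = inj₂ (cov′ i)
      edg : ∀ u v → Adj G u v → (u ∈ A × v ∈ A) ⊎ (u ∈ P × v ∈ P) ⊎ (u ∈ Q × v ∈ Q) ⊎ (u ∈ R × v ∈ R)
      edg u v a with sep-edge G S a
      ... | inj₁ h = inj₁ h
      ... | inj₂ (u∈ , v∈) with enum-surjective B u∈ | enum-surjective B v∈
      ...   | i , refl | j , refl = inj₂ (edg′ i j (inj₁ a))
      clq : ∀ s t → s ∈ A ∩ B → t ∈ A ∩ B → (s ∈ P × t ∈ P) ⊎ (s ∈ Q × t ∈ Q) ⊎ (s ∈ R × t ∈ R)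
      clq s t s∈ t∈ with enum-surjective B (∩ʳ A B s∈) | enum-surjective B (∩ʳ A B t∈)
      ... | i , refl | j , refl with i ≟ j
      ...   | yes refl = Sum.map (λ p → p , p) (Sum.map (λ p → p , p) (λ p → p , p)) (cov′ i)
      ...   | no  ne   = edg′ i j (inj₂ (ne , ∩ˡ A B s∈ , ∩ˡ A B t∈))

    σ-tangle : Tangle H 4 σ
    σ-tangle = record
      { sound = λ X Y (C , D , c , iC , iD) → image-sep φ (τ-sep T c) iC iD ,
          ≤-trans (s≤s (image-order φ (τ-sep T c) iC iD)) (τ-order T c)
      ; complete = comp
      ; exclusive = λ X Y s t → ⊥-elim (excl X Y s t)
      ; noCover = σ-noCover
      }
      where
      excl : ∀ X Y → σ X Y → σ Y X → ⊥
      excl X Y s@(C , D , c , iC , iD) t = σ-noCover _ _ _ _ _ _ s t t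
        ((λ v → [ inj₁ , inj₂ ∘ inj₁ ]′ (proj₁ sp v)) , λ u v a → [ inj₁ , inj₂ ∘ inj₁ ]′ (sep-edge H sp a))
        where
        sp : IsSeparation H X Y
        sp = image-sep φ (τ-sep T c) iC iD
      one-side : ∀ X Y → IsSeparation H X Y → order X Y < 4 → (∀ i → e i ∈ A → i ∈ X) → σ X Y ⊎ σ Y X
      one-side X Y s o inX = Sum.map
        (λ c → _ , _ , c , pull-imageˡ s inX , pull-imageʳ s inX)
        (λ c → _ , _ , c , pull-imageʳ s inX , pull-imageˡ s inX)
        (Tangle.complete T _ _ (pull-sep s inX) (≤-trans (s≤s (pull-order s inX)) o))
      comp : ∀ X Y → IsSeparation H X Y → order X Y < 4 → σ X Y ⊎ σ Y X
      comp X Y s o with clique-side s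
      ... | inj₁ inX = one-side X Y s o inX
      ... | inj₂ inY = Sum.swap (one-side Y X (sep-sym H s) (≤-trans (s≤s (≤-reflexive (order-sym H Y X))) o) inY)

    σ-lift : Lift φ 4 σ ≐ τ
    σ-lift = lift-≐ φ T σ-tangle λ C D X Y c iC iD → C , D , c , iC , iD

-- Triangle minors rooted at a separator of order three

-- A rooted branch set is kept as its root x in the separator and a part X outside B, because only X
-- changes while the triangle is being built.
Hat : Fin n → Subset n → Fin n → Set
Hat x X v = v ≡ x ⊎ v ∈ X

hat? : ∀ (x : Fin n) X v → Dec (Hat x X v)
hat? x X v = (v ≟ x) ⊎-dec (v ∈? X)

Disjoint : Subset n → Subset n → Set
Disjoint X Y = ∀ v → v ∈ X → v ∉ Y

disjoint-sym : ∀ {X Y : Subset n} → Disjoint X Y → Disjoint Y X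
disjoint-sym d v p q = d v q p

module _ (G : Graph n) where

  Touch : Fin n → Subset n → Fin n → Subset n → Set
  Touch x X y Y = ∃ λ u → ∃ λ v → Hat x X u × Hat y Y v × Adj G u v

  touch-sym : ∀ {x X y Y} → Touch x X y Y → Touch y Y x X
  touch-sym (u , v , hu , hv , a) = v , u , hv , hu , adj-sym G a

  touch? : ∀ x X y Y → Dec (Touch x X y Y)
  touch? x X y Y = any? λ u → any? λ v → hat? x X u ×-dec (hat? y Y v ×-dec adj? G u v)

  record Branch (B : Subset n) (x : Fin n) (X : Subset n) : Set where
    field
      outside-B : ∀ u → u ∈ X → u ∉ B
      spans     : ∀ u → u ∈ X → Reach G (Hat x X) x u

  empty-branch : ∀ {B x} → Branch B x ∅
  empty-branch = record { outside-B = λ u h → ⊥-elim (∉⊥ h) ; spans = λ u h → ⊥-elim (∉⊥ h) }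

  branch-∪ : ∀ {B x X Y} → Branch B x X → (∀ v → v ∈ Y → v ∉ B) → Connected G (_∈ Y) →
             (∃ λ u → ∃ λ v → Hat x X u × v ∈ Y × Adj G u v) → Branch B x (X ∪ Y)
  branch-∪ {B} {x} {X} {Y} b out con (u , v , hu , v∈ , a) = record
    { outside-B = λ w h → [ Branch.outside-B b w , out w ]′ (x∈p∪q⁻ X Y h)
    ; spans = λ w h → [ (λ k → reach-mono G emb (Branch.spans b w k)) , beyond w ]′ (x∈p∪q⁻ X Y h)
    }
    where
    emb : ∀ w → Hat x X w → Hat x (X ∪ Y) w
    emb w = Sum.map₂ ∈∪ˡ
    base : ∀ w → Hat x X w → Reach G (Hat x (X ∪ Y)) x w
    base w (inj₁ refl) = here (inj₁ refl)
    base w (inj₂ k)    = reach-mono G emb (Branch.spans b w k)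
    beyond : ∀ w → w ∈ Y → Reach G (Hat x (X ∪ Y)) x w
    beyond w w∈ = reach-trans G (base u hu)
      (step (emb u hu) a (reach-mono G (λ _ → inj₂ ∘ ∈∪ʳ) (con v w v∈ w∈)))

  component-branch : ∀ {B a x} (C : Component G (_∉ B) a) → (∃ λ u → u ∈ Component.K C × Adj G u x) →
                     Branch B x (Component.K C)
  component-branch C (k , k∈ , e) = record
    { outside-B = Component.within C
    ; spans = λ u h → step (inj₁ refl) (adj-sym G e) (reach-mono G (λ _ → inj₂) (Component.connected C k u k∈ h)) }

  -- The roots y and z may coincide. In that form the record also serves separators of order two,
  -- for which one edge has to be produced.
  record RootedTriangle (B : Subset n) (x y z : Fin n) : Set where
    field
      X Y Z : Subset n
      bX    : Branch B x X
      bY    : Branch B y Y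
      bZ    : Branch B z Z
      X#Y   : Disjoint X Y
      X#Z   : Disjoint X Z
      Y#Z   : Disjoint Y Z
      X~Y   : Touch x X y Y
      X~Z   : Touch x X z Z
      Y~Z   : y ≢ z → Touch y Y z Z

  module _ {A B : Subset n} {x y z : Fin n} (S⊆ : ∀ s → s ∈ A ∩ B → s ≡ x ⊎ s ≡ y ⊎ s ≡ z)
           (x∈ : x ∈ A ∩ B) (y∈ : y ∈ A ∩ B) (z∈ : z ∈ A ∩ B) (Δ : RootedTriangle B x y z) where
    open RootedTriangle Δ

    private
      q : Fin n → Maybe (Fin n)
      q u with u ∈? B | u ∈? X | u ∈? Y | u ∈? Z
      ... | yes _ | _     | _     | _     = just u
      ... | no _  | yes _ | _     | _     = just x
      ... | no _  | no _  | yes _ | _     = just y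
      ... | no _  | no _  | no _  | yes _ = just z
      ... | no _  | no _  | no _  | no _  = nothing

      q-B : ∀ u → u ∈ B → q u ≡ just u
      q-B u h with u ∈? B | u ∈? X | u ∈? Y | u ∈? Z
      ... | yes _ | _ | _ | _ = refl
      ... | no ¬h | _ | _ | _ = ⊥-elim (¬h h)

      q-X : ∀ u → u ∈ X → q u ≡ just x
      q-X u h with u ∈? B | u ∈? X | u ∈? Y | u ∈? Z
      ... | yes b | _     | _ | _ = ⊥-elim (Branch.outside-B bX u h b)
      ... | no _  | yes _ | _ | _ = refl
      ... | no _  | no ¬h | _ | _ = ⊥-elim (¬h h)

      q-Y : ∀ u → u ∈ Y → q u ≡ just y
      q-Y u h with u ∈? B | u ∈? X | u ∈? Y | u ∈? Z
      ... | yes b | _     | _     | _ = ⊥-elim (Branch.outside-B bY u h b)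
      ... | no _  | yes k | _     | _ = ⊥-elim (X#Y u k h)
      ... | no _  | no _  | yes _ | _ = refl
      ... | no _  | no _  | no ¬h | _ = ⊥-elim (¬h h)

      q-Z : ∀ u → u ∈ Z → q u ≡ just z
      q-Z u h with u ∈? B | u ∈? X | u ∈? Y | u ∈? Z
      ... | yes b | _     | _     | _ = ⊥-elim (Branch.outside-B bZ u h b)
      ... | no _  | yes k | _     | _ = ⊥-elim (X#Z u k h)
      ... | no _  | no _  | yes k | _ = ⊥-elim (Y#Z u k h)
      ... | no _  | no _  | no _  | yes _ = refl
      ... | no _  | no _  | no _  | no ¬h = ⊥-elim (¬h h)

      data Val (u s : Fin n) : Set where
        inB : u ∈ B → u ≡ s → Val u s
        inX : u ∈ X → x ≡ s → Val u s
        inY : u ∈ Y → y ≡ s → Val u s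
        inZ : u ∈ Z → z ≡ s → Val u s

      val : ∀ u s → q u ≡ just s → Val u s
      val u s e with u ∈? B | u ∈? X | u ∈? Y | u ∈? Z
      ... | yes h | _     | _     | _     = inB h (just-injective e)
      ... | no _  | yes h | _     | _     = inX h (just-injective e)
      ... | no _  | no _  | yes h | _     = inY h (just-injective e)
      ... | no _  | no _  | no _  | yes h = inZ h (just-injective e)
      val u s () | no _ | no _ | no _ | no _

      hX : ∀ u → Hat x X u → q u ≡ just x
      hX u (inj₁ refl) = q-B u (∩ʳ A B x∈)
      hX u (inj₂ h)    = q-X u h
      hY : ∀ u → Hat y Y u → q u ≡ just y
      hY u (inj₁ refl) = q-B u (∩ʳ A B y∈)
      hY u (inj₂ h)    = q-Y u h
      hZ : ∀ u → Hat z Z u → q u ≡ just z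
      hZ u (inj₁ refl) = q-B u (∩ʳ A B z∈)
      hZ u (inj₂ h)    = q-Z u h

      spanned : ∀ s → s ∈ B → ∀ u → q u ≡ just s → Reach G (λ v → q v ≡ just s) s u
      spanned s s∈ u e with val u s e
      ... | inB _ refl = here e
      ... | inX h refl = reach-mono G hX (Branch.spans bX u h)
      ... | inY h refl = reach-mono G hY (Branch.spans bY u h)
      ... | inZ h refl = reach-mono G hZ (Branch.spans bZ u h)

      Realised : Fin n → Fin n → Set
      Realised s t = ∃ λ u → ∃ λ v → q u ≡ just s × q v ≡ just t × Adj G u v

      flip-r : ∀ {s t} → Realised s t → Realised t s
      flip-r (u , v , e , e′ , a) = v , u , e′ , e , adj-sym G a

      real : ∀ s t → s ≡ x ⊎ s ≡ y ⊎ s ≡ z → t ≡ x ⊎ t ≡ y ⊎ t ≡ z → s ≢ t → Realised s t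
      xy : Realised x y
      xy = let (u , v , hu , hv , a) = X~Y in u , v , hX u hu , hY v hv , a
      xz : Realised x z
      xz = let (u , v , hu , hv , a) = X~Z in u , v , hX u hu , hZ v hv , a
      yz : y ≢ z → Realised y z
      yz ne = let (u , v , hu , hv , a) = Y~Z ne in u , v , hY u hu , hZ v hv , a
      real s t (inj₁ refl)        (inj₁ refl)        ne = ⊥-elim (ne refl)
      real s t (inj₁ refl)        (inj₂ (inj₁ refl)) ne = xy
      real s t (inj₁ refl)        (inj₂ (inj₂ refl)) ne = xz
      real s t (inj₂ (inj₁ refl)) (inj₁ refl)        ne = flip-r xy
      real s t (inj₂ (inj₁ refl)) (inj₂ (inj₁ refl)) ne = ⊥-elim (ne refl)
      real s t (inj₂ (inj₁ refl)) (inj₂ (inj₂ refl)) ne = yz ne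
      real s t (inj₂ (inj₂ refl)) (inj₁ refl)        ne = flip-r xz
      real s t (inj₂ (inj₂ refl)) (inj₂ (inj₁ refl)) ne = flip-r (yz (ne ∘ ≡-sym))
      real s t (inj₂ (inj₂ refl)) (inj₂ (inj₂ refl)) ne = ⊥-elim (ne refl)

    triangle-retraction : Retraction G A B
    triangle-retraction = record
      { p = q
      ; fixes = q-B
      ; into-B = λ u s e → inb u s (val u s e)
      ; into-A = λ u s h e → ina u s h (val u s e)
      ; fibres = λ s s∈ → connected-via G s (spanned s s∈)
      ; clique = λ s t s∈ t∈ → real s t (S⊆ s s∈) (S⊆ t t∈)
      }
      where
      inb : ∀ u s → Val u s → s ∈ B
      inb u s (inB h refl) = h
      inb u s (inX h refl) = ∩ʳ A B x∈
      inb u s (inY h refl) = ∩ʳ A B y∈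
      inb u s (inZ h refl) = ∩ʳ A B z∈
      ina : ∀ u s → u ∉ B → Val u s → s ∈ A
      ina u s h (inB k refl) = ⊥-elim (h k)
      ina u s h (inX _ refl) = ∩ˡ A B x∈
      ina u s h (inY _ refl) = ∩ˡ A B y∈
      ina u s h (inZ _ refl) = ∩ˡ A B z∈

  trivial-retraction : ∀ {A B : Subset n} → ∣ A ∩ B ∣ ≤ 1 → Retraction G A B
  trivial-retraction {A} {B} ≤1 = record
    { p = q
    ; fixes = q-B
    ; into-B = λ u s e → let (h , k) = val u s e in subst (_∈ B) k h
    ; into-A = λ u s h e → ⊥-elim (h (proj₁ (val u s e)))
    ; fibres = λ s s∈ → connected-via G s λ v e → subst (Reach G _ s) (≡-sym (proj₂ (val v s e))) (here (q-B s s∈))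
    ; clique = λ s t s∈ t∈ ne → contradiction
        (≤-trans (distinct⇒≤ (s ∷ t ∷ []) (A ∩ B) ((ne ∷ []) ∷ [] ∷ []) (s∈ ∷ t∈ ∷ [])) ≤1) λ { (s≤s ()) }
    }
    where
    q : Fin n → Maybe (Fin n)
    q u with u ∈? B
    ... | yes _ = just u
    ... | no  _ = nothing
    q-B : ∀ u → u ∈ B → q u ≡ just u
    q-B u h with u ∈? B
    ... | yes _ = refl
    ... | no ¬h = ⊥-elim (¬h h)
    val : ∀ u s → q u ≡ just s → u ∈ B × u ≡ s
    val u s e with u ∈? B
    ... | yes h = h , just-injective e
    val u s () | no _

module Peeling {G : Graph n} {τ : OSeps n} (T : Tangle G 4 τ) (con : TangleConnected T 3)
               {A B : Subset n} (t : τ A B) where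

  -- Only contact between Y and Z is missing for a rooted triangle; moving parts of X to Y or Z shrinks X
  -- until it appears.
  record Partial (x y z : Fin n) (X Y Z : Subset n) : Set where
    field
      S⊆    : ∀ s → s ∈ A ∩ B → s ≡ x ⊎ s ≡ y ⊎ s ≡ z
      x∈    : x ∈ A ∩ B
      y∈    : y ∈ A ∩ B
      z∈    : z ∈ A ∩ B
      x≁y   : ¬ Adj G x y
      x≁z   : ¬ Adj G x z
      y≁z   : ¬ Adj G y z
      cover : ∀ u → u ∉ B → u ∈ X ⊎ u ∈ Y ⊎ u ∈ Z
      bX    : Branch G B x X
      bY    : Branch G B y Y
      bZ    : Branch G B z Z
      X#Y   : Disjoint X Y
      X#Z   : Disjoint X Z
      Y#Z   : Disjoint Y Z
      X~Y   : Touch G x X y Y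
      X~Z   : Touch G x X z Z

  partial-swap : ∀ {x y z X Y Z} → Partial x y z X Y Z → Partial x z y X Z Y
  partial-swap P = record
    { S⊆ = λ s h → Sum.map₂ Sum.swap (S⊆ s h) ; x∈ = x∈ ; y∈ = z∈ ; z∈ = y∈
    ; x≁y = x≁z ; x≁z = x≁y ; y≁z = y≁z ∘ adj-sym G
    ; cover = λ u h → Sum.map₂ Sum.swap (cover u h)
    ; bX = bX ; bY = bZ ; bZ = bY ; X#Y = X#Z ; X#Z = X#Y ; Y#Z = disjoint-sym Y#Z ; X~Y = X~Z ; X~Z = X~Y }
    where open Partial P

  triangle-swap : ∀ {x y z} → RootedTriangle G B x y z → RootedTriangle G B x z y
  triangle-swap Δ = record
    { X = X ; Y = Z ; Z = Y ; bX = bX ; bY = bZ ; bZ = bY ; X#Y = X#Z ; X#Z = X#Y ; Y#Z = disjoint-sym Y#Z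
    ; X~Y = X~Z ; X~Z = X~Y ; Y~Z = λ ne → touch-sym G (Y~Z (ne ∘ ≡-sym)) }
    where open RootedTriangle Δ

  no-inner₂ : ∀ R p q → (∀ v → v ∈ R → v ∉ B) → (∀ v w → v ∈ R → Adj G v w → w ∈ R ⊎ w ≡ p ⊎ w ≡ q) →
              p ∉ R → q ∉ R → ∀ v → v ∉ R
  no-inner₂ R p q R∉B nbr p∉ q∉ = no-inner T (s≤s (s≤s (s≤s z≤n))) con t R (⁅ p ⁆ ∪ ⁅ q ⁆) R∉B
    (λ v w v∈ a → Sum.map₂ [ (λ { refl → ∈∪ˡ (x∈⁅x⁆ w) }) , (λ { refl → ∈∪ʳ (x∈⁅x⁆ w) }) ]′ (nbr v w v∈ a))
    (λ v h v∈ → [ (λ { refl → p∉ v∈ }) , (λ { refl → q∉ v∈ }) ]′ (among v h))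
    (s≤s (listed⇒≤ (p ∷ q ∷ []) _ λ v h → [ here , (λ e → there (here e)) ]′ (among v h)))
    where
    among : ∀ v → v ∈ ⁅ p ⁆ ∪ ⁅ q ⁆ → v ≡ p ⊎ v ≡ q
    among v h = Sum.map (x∈⁅y⁆⇒x≡y p) (x∈⁅y⁆⇒x≡y q) (x∈p∪q⁻ ⁅ p ⁆ ⁅ q ⁆ h)

  -- `stuck` is the case in which u is the only contact of x with X and x touches neither of the
  -- other two branch sets, so that cutting at u leaves x alone.
  data Outcome (x y z : Fin n) (X Y Z : Subset n) (u : Fin n) : Set where
    done    : RootedTriangle G B x y z → Outcome x y z X Y Z u
    smaller : ∀ {X′ Y′ Z′} → ∣ X′ ∣ < ∣ X ∣ → Partial x y z X′ Y′ Z′ → Outcome x y z X Y Z u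
    stuck   : (∀ v → v ∈ X → Adj G x v → v ≡ u) → (∀ v → Hat y Y v → ¬ Adj G x v) →
              (∀ v → Hat z Z v → ¬ Adj G x v) → Outcome x y z X Y Z u

  outcome-swap : ∀ {x y z X Y Z u} → Outcome x z y X Z Y u → Outcome x y z X Y Z u
  outcome-swap (done Δ)      = done (triangle-swap Δ)
  outcome-swap (smaller l P) = smaller l (partial-swap P)
  outcome-swap (stuck a b c) = stuck a c b

  -- Deleting u splits X into the part X₀ still joined to x and the rest X₁, which is connected
  -- through u and can be given to Y or to Z. If X₁ does not touch Z, giving it to Y preserves all
  -- contacts. If it does, a contact of X₀ or x with Z completes the triangle with X₁ in Y, and a
  -- contact with Y completes it with X₁ in Z. If both are absent, X₀ has no neighbours except x and
  -- u, hence is empty.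
  peel : ∀ {x y z X Y Z} → Partial x y z X Y Z → ∀ u → u ∈ X → (∃ λ v → Hat y Y v × Adj G v u) → Outcome x y z X Y Z u
  peel {x} {y} {z} {X} {Y} {Z} P u u∈X (v , hv , a) = result
    where
    open Partial P
    W : Fin n → Set
    W w = Hat x X w × w ≢ u
    W? : ∀ w → Dec (W w)
    W? w = hat? x X w ×-dec ¬? (w ≟ u)
    x∉X : x ∉ X
    x∉X h = Branch.outside-B bX x h (∩ʳ A B x∈)
    x≢u : x ≢ u
    x≢u refl = x∉X u∈X
    C : Component G W x
    C = component G W? x (inj₁ refl , x≢u)
    open Component C
    X₀ X₁ : Subset n
    X₀ = K - x
    X₁ = X ∩ ∁ K
    u∉K : u ∉ K
    u∉K h = proj₂ (within u h) refl
    X₁⊆ : ∀ {w} → w ∈ X₁ → w ∈ X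
    X₁⊆ = ∩ˡ X (∁ K)
    X₁∉K : ∀ {w} → w ∈ X₁ → w ∉ K
    X₁∉K h = x∈∁p⇒x∉p (∩ʳ X (∁ K) h)
    u∈X₁ : u ∈ X₁
    u∈X₁ = ∈∩ u∈X (x∉p⇒x∈∁p u∉K)
    X₀⊆ : ∀ {w} → w ∈ X₀ → w ∈ X
    X₀⊆ {w} h with within w (minus⊆ h)
    ... | inj₁ e , _ = ⊥-elim (minus-≢ {X = K} h e)
    ... | inj₂ k , _ = k
    K⇒hat : ∀ w → w ∈ K → Hat x X₀ w
    K⇒hat w h with w ≟ x
    ... | yes e = inj₁ e
    ... | no ne = inj₂ (∈-minus h ne)
    split : ∀ w → Hat x X w → Hat x X₀ w ⊎ w ∈ X₁
    split w h with w ∈? K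
    ... | yes k = inj₁ (K⇒hat w k)
    ... | no ¬k with h
    ...   | inj₁ e = inj₁ (inj₁ e)
    ...   | inj₂ k = inj₂ (∈∩ k (x∉p⇒x∈∁p ¬k))
    toward-u : ∀ {w} → w ∉ K → Reach G (Hat x X) w x → Reach G (_∈ X₁) w u
    toward-u w∉ (here _) = ⊥-elim (w∉ root)
    toward-u {w} w∉ (step {w = w′} h b r) with w ≟ u
    ... | yes refl = here u∈X₁
    ... | no ne = step in₁ b (toward-u w′∉ r)
      where
      in₁ : w ∈ X₁
      in₁ with split w h
      ... | inj₂ k        = k
      ... | inj₁ (inj₁ e) = ⊥-elim (w∉ (subst (_∈ K) (≡-sym e) root))
      ... | inj₁ (inj₂ k) = ⊥-elim (w∉ (minus⊆ k))
      w′∉ : w′ ∉ K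
      w′∉ k = w∉ (closed w′ w k (h , ne) (adj-sym G b))
    X₁-connected : Connected G (_∈ X₁)
    X₁-connected = connected-via G u λ w h →
      reach-sym G (toward-u (X₁∉K h) (reach-sym G (Branch.spans bX w (X₁⊆ h))))
    X₁-out : ∀ w → w ∈ X₁ → w ∉ B
    X₁-out w h = Branch.outside-B bX w (X₁⊆ h)
    bX₀ : Branch G B x X₀
    bX₀ = record { outside-B = λ w h → Branch.outside-B bX w (X₀⊆ h)
                 ; spans = λ w h → reach-mono G K⇒hat (connected x w root (minus⊆ h)) }
    exit : ∀ {w} → w ∈ K → Reach G (Hat x X) w u → ∃ λ k → k ∈ K × Adj G k u
    exit w∈ (here _) = ⊥-elim (u∉K w∈)
    exit {w} w∈ (step {w = w′} h b r) with w′ ≟ u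
    ... | yes refl = w , w∈ , b
    ... | no ne    = exit (closed w w′ w∈ (reach-start G r , ne) b) r
    K~u : ∃ λ k → k ∈ K × Adj G k u
    K~u = exit root (Branch.spans bX u u∈X)
    X₀#X₁ : Disjoint X₀ X₁
    X₀#X₁ w h k = X₁∉K k (minus⊆ h)
    YX₁ ZX₁ : Subset n
    YX₁ = Y ∪ X₁
    ZX₁ = Z ∪ X₁
    bYX₁ : Branch G B y YX₁
    bYX₁ = branch-∪ G bY X₁-out X₁-connected (v , u , hv , u∈X₁ , a)
    X₀#YX₁ : Disjoint X₀ YX₁
    X₀#YX₁ w h k = [ X#Y w (X₀⊆ h) , X₀#X₁ w h ]′ (x∈p∪q⁻ Y X₁ k)
    X₀#ZX₁ : Disjoint X₀ ZX₁
    X₀#ZX₁ w h k = [ X#Z w (X₀⊆ h) , X₀#X₁ w h ]′ (x∈p∪q⁻ Z X₁ k)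
    X₀~YX₁ : Touch G x X₀ y YX₁
    X₀~YX₁ = let (k , k∈ , b) = K~u in k , u , K⇒hat k k∈ , inj₂ (∈∪ʳ u∈X₁) , b
    result : Outcome x y z X Y Z u
    result with any? (λ p → any? λ q → (p ∈? X₁) ×-dec (hat? z Z q ×-dec adj? G p q))
    ... | no X₁≁Z = smaller (p⊂q⇒∣p∣<∣q∣ (X₀⊆ , u , u∈X , λ h → u∉K (minus⊆ h))) (record
      { S⊆ = S⊆ ; x∈ = x∈ ; y∈ = y∈ ; z∈ = z∈ ; x≁y = x≁y ; x≁z = x≁z ; y≁z = y≁z
      ; cover = λ w w∉ → cov w (cover w w∉)
      ; bX = bX₀ ; bY = bYX₁ ; bZ = bZ ; X#Y = X₀#YX₁
      ; X#Z = λ w h → X#Z w (X₀⊆ h)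
      ; Y#Z = λ w h k → [ (λ l → Y#Z w l k) , (λ l → X#Z w (X₁⊆ l) k) ]′ (x∈p∪q⁻ Y X₁ h)
      ; X~Y = X₀~YX₁
      ; X~Z = let (p , q , hp , hq , b) = X~Z in p , q , [ id , (λ h → ⊥-elim (X₁≁Z (p , q , h , hq , b))) ]′ (split p hp) , hq , b
      })
      where
      cov : ∀ w → w ∈ X ⊎ w ∈ Y ⊎ w ∈ Z → w ∈ X₀ ⊎ w ∈ YX₁ ⊎ w ∈ Z
      cov w (inj₂ (inj₁ h)) = inj₂ (inj₁ (∈∪ˡ h))
      cov w (inj₂ (inj₂ h)) = inj₂ (inj₂ h)
      cov w (inj₁ h) with split w (inj₂ h)
      ... | inj₂ k           = inj₂ (inj₁ (∈∪ʳ k))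
      ... | inj₁ (inj₂ k)    = inj₁ k
      ... | inj₁ (inj₁ refl) = ⊥-elim (x∉X h)
    ... | yes (p , q , p∈ , hq , b) with touch? G x X₀ z Z
    ...   | yes X₀~Z = done (record { X = X₀ ; Y = YX₁ ; Z = Z ; bX = bX₀ ; bY = bYX₁ ; bZ = bZ ; X#Y = X₀#YX₁
              ; X#Z = λ w h → X#Z w (X₀⊆ h)
              ; Y#Z = λ w h k → [ (λ l → Y#Z w l k) , (λ l → X#Z w (X₁⊆ l) k) ]′ (x∈p∪q⁻ Y X₁ h)
              ; X~Y = X₀~YX₁ ; X~Z = X₀~Z ; Y~Z = λ _ → p , q , inj₂ (∈∪ʳ p∈) , hq , b })
    ...   | no X₀≁Z with touch? G x X₀ y Y
    ...     | yes X₀~Y = done (record { X = X₀ ; Y = Y ; Z = ZX₁ ; bX = bX₀ ; bY = bY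
                ; bZ = branch-∪ G bZ X₁-out X₁-connected (q , p , hq , p∈ , adj-sym G b)
                ; X#Y = λ w h → X#Y w (X₀⊆ h) ; X#Z = X₀#ZX₁
                ; Y#Z = λ w h k → [ Y#Z w h , (λ l → X#Y w (X₁⊆ l) h) ]′ (x∈p∪q⁻ Z X₁ k)
                ; X~Y = X₀~Y ; X~Z = let (k , k∈ , c) = K~u in k , u , K⇒hat k k∈ , inj₂ (∈∪ʳ u∈X₁) , c
                ; Y~Z = λ _ → v , u , hv , inj₂ (∈∪ʳ u∈X₁) , a })
    ...     | no X₀≁Y = stuck only (λ w h c → X₀≁Y (x , w , inj₁ refl , h , c)) (λ w h c → X₀≁Z (x , w , inj₁ refl , h , c))
      where
      X₀-nbr : ∀ w w′ → w ∈ X₀ → Adj G w w′ → w′ ∈ X₀ ⊎ w′ ≡ x ⊎ w′ ≡ u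
      X₀-nbr w w′ h c with w′ ≟ u
      ... | yes refl = inj₂ (inj₂ refl)
      ... | no ne = go (w′ ∈? B)
        where
        inX : Hat x X w′ → w′ ∈ X₀ ⊎ w′ ≡ x ⊎ w′ ≡ u
        inX k with K⇒hat w′ (closed w w′ (minus⊆ h) (k , ne) c)
        ... | inj₁ refl = inj₂ (inj₁ refl)
        ... | inj₂ l    = inj₁ l
        inY : Hat y Y w′ → w′ ∈ X₀ ⊎ w′ ≡ x ⊎ w′ ≡ u
        inY k = ⊥-elim (X₀≁Y (w , w′ , inj₂ h , k , c))
        inZ : Hat z Z w′ → w′ ∈ X₀ ⊎ w′ ≡ x ⊎ w′ ≡ u
        inZ k = ⊥-elim (X₀≁Z (w , w′ , inj₂ h , k , c))
        go : Dec (w′ ∈ B) → w′ ∈ X₀ ⊎ w′ ≡ x ⊎ w′ ≡ u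
        go (no w′∉) = [ inX ∘ inj₂ , [ inY ∘ inj₂ , inZ ∘ inj₂ ]′ ]′ (cover w′ w′∉)
        go (yes w′∈) = [ inX ∘ inj₁ , [ inY ∘ inj₁ , inZ ∘ inj₁ ]′ ]′
          (S⊆ w′ (∈∩ (Separations.sep-nbr G (τ-sep T t) (Branch.outside-B bX₀ w h) c) w′∈))
      X₀-empty : ∀ w → w ∉ X₀
      X₀-empty = no-inner₂ X₀ x u (Branch.outside-B bX₀) X₀-nbr (λ k → minus-≢ {X = K} k refl) (u∉K ∘ minus⊆)
      only : ∀ w → w ∈ X → Adj G x w → w ≡ u
      only w h c with w ≟ u
      ... | yes e = e
      ... | no ne with K⇒hat w (closed x w root (inj₂ h , ne) c)
      ...   | inj₁ refl = ⊥-elim (x∉X h)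
      ...   | inj₂ k    = ⊥-elim (X₀-empty w k)

  -- Y has at most the two neighbours y and c, hence is empty.
  isolated-branch : ∀ {x y z X Y Z} → Partial x y z X Y Z → ∀ c → c ∉ Y →
    (∀ v w → v ∈ Y → Adj G v w → Hat x X w → w ≡ c) → (∀ v w → v ∈ Y → Adj G v w → ¬ Hat z Z w) → ∀ v → v ∉ Y
  isolated-branch {x} {y} {z} {X} {Y} {Z} P c c∉ toX toZ =
    no-inner₂ Y y c (Branch.outside-B bY) nbr (λ k → Branch.outside-B bY y k (∩ʳ A B y∈)) c∉
    where
    open Partial P
    nbr : ∀ v w → v ∈ Y → Adj G v w → w ∈ Y ⊎ w ≡ y ⊎ w ≡ c
    nbr v w v∈ a = go (w ∈? B)
      where
      inX : Hat x X w → w ∈ Y ⊎ w ≡ y ⊎ w ≡ c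
      inX k = inj₂ (inj₂ (toX v w v∈ a k))
      inZ : Hat z Z w → w ∈ Y ⊎ w ≡ y ⊎ w ≡ c
      inZ k = ⊥-elim (toZ v w v∈ a k)
      go : Dec (w ∈ B) → w ∈ Y ⊎ w ≡ y ⊎ w ≡ c
      go (no w∉) = [ inX ∘ inj₂ , [ inj₁ , inZ ∘ inj₂ ]′ ]′ (cover w w∉)
      go (yes w∈) = [ inX ∘ inj₁ , [ inj₂ ∘ inj₁ , inZ ∘ inj₁ ]′ ]′
        (S⊆ w (∈∩ (Separations.sep-nbr G (τ-sep T t) (Branch.outside-B bY v v∈) a) w∈))

  module _ (two : ∀ c → ∃ λ a → a ∉ B × a ≢ c) where

    -- When peeling at u gets stuck, u is the only neighbour of x in X. Peeling at another vertex of
    -- X that touches Y or Z cannot get stuck as well, since that vertex would have to equal u. If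
    -- there is no other such vertex, then Y, Z and the rest of X each have at most two outer
    -- neighbours and are empty. The interior of A is then u alone, contrary to `two`; this is the
    -- excluded claw.
    peel-all : ∀ fuel {x y z X Y Z} → ∣ X ∣ < fuel → Partial x y z X Y Z → RootedTriangle G B x y z
    peel-all zero ()
    peel-all (suc fuel) {x} {y} {z} {X} {Y} {Z} lt P with touch? G y Y z Z
      where open Partial P
    ... | yes Y~Z = record { X = X ; Y = Y ; Z = Z ; bX = bX ; bY = bY ; bZ = bZ ; X#Y = X#Y ; X#Z = X#Z ; Y#Z = Y#Z
                           ; X~Y = X~Y ; X~Z = X~Z ; Y~Z = λ _ → Y~Z }
      where open Partial P
    ... | no Y≁Z = byStart start
      where
      open Partial P
      conclude : ∀ {u} → Outcome x y z X Y Z u →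
        ((∀ v → v ∈ X → Adj G x v → v ≡ u) → (∀ v → Hat y Y v → ¬ Adj G x v) → (∀ v → Hat z Z v → ¬ Adj G x v) →
         RootedTriangle G B x y z) → RootedTriangle G B x y z
      conclude (done Δ)      k = Δ
      conclude (smaller l Q) k = peel-all fuel (≤-trans l (≤-pred lt)) Q
      conclude (stuck a b c) k = k a b c
      touches : ∀ u → Dec ((∃ λ v → Hat y Y v × Adj G v u) ⊎ (∃ λ v → Hat z Z v × Adj G v u))
      touches u = any? (λ v → hat? y Y v ×-dec adj? G v u) ⊎-dec any? (λ v → hat? z Z v ×-dec adj? G v u)
      peelᵗ : ∀ u → u ∈ X → (∃ λ v → Hat y Y v × Adj G v u) ⊎ (∃ λ v → Hat z Z v × Adj G v u) → Outcome x y z X Y Z u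
      peelᵗ u u∈ (inj₁ h) = peel P u u∈ h
      peelᵗ u u∈ (inj₂ h) = outcome-swap (peel (partial-swap P) u u∈ h)
      start : ∃ λ u → u ∈ X × (∃ λ v → Hat y Y v × Adj G v u)
      start with any? (λ u → (u ∈? X) ×-dec any? (λ v → hat? y Y v ×-dec adj? G v u))
      ... | yes h = h
      -- Without such a vertex Y would be enclosed by x and y, hence empty, and the contact of X
      -- with Y could only be the missing edge xy.
      ... | no ¬h = ⊥-elim (absurd X~Y)
        where
        Y-empty : ∀ v → v ∉ Y
        Y-empty = isolated-branch P x (λ h → Branch.outside-B bY x h (∩ʳ A B x∈))
          (λ v w v∈ a → [ id , (λ k → ⊥-elim (¬h (w , k , v , inj₂ v∈ , a))) ]′)
          (λ v w v∈ a k → Y≁Z (v , w , inj₂ v∈ , k , a))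
        absurd : ¬ Touch G x X y Y
        absurd (p , q , hp , inj₂ k , a) = Y-empty q k
        absurd (p , q , inj₂ h , inj₁ e , a) = ¬h (p , h , q , inj₁ e , adj-sym G a)
        absurd (p , q , inj₁ refl , inj₁ refl , a) = x≁y a
      first : ∀ {u} → u ∈ X → Reach G (Hat x X) x u → ∃ λ v → v ∈ X × Adj G x v
      first u∈ (here _) = ⊥-elim (Branch.outside-B bX _ u∈ (∩ʳ A B x∈))
      first u∈ (step _ a r) with reach-start G r
      ... | inj₁ refl = ⊥-elim (adj-irrefl G a refl)
      ... | inj₂ k    = _ , k , a
      byStart : (∃ λ u → u ∈ X × (∃ λ v → Hat y Y v × Adj G v u)) → RootedTriangle G B x y z
      byStart (u , u∈ , touchY) = conclude (peel P u u∈ touchY) unique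
        where
        unique : (∀ v → v ∈ X → Adj G x v → v ≡ u) → (∀ v → Hat y Y v → ¬ Adj G x v) →
                 (∀ v → Hat z Z v → ¬ Adj G x v) → RootedTriangle G B x y z
        unique only x≁Y x≁Z with first u∈ (Branch.spans bX u u∈)
        ... | u₀ , u₀∈ , x~u₀ with only u₀ u₀∈ x~u₀
        ...   | refl with any? (λ w → (w ∈? X) ×-dec (touches w ×-dec ¬? (w ≟ u)))
        ...     | yes (w , w∈ , th , w≢u) = conclude (peelᵗ w w∈ th) λ only′ _ _ → ⊥-elim (w≢u (≡-sym (only′ u u∈ x~u₀)))
        ...     | no ¬w = ⊥-elim (absurd (two u))
          where
          toU : ∀ w → w ∈ X → (∃ λ v → Hat y Y v × Adj G v w) ⊎ (∃ λ v → Hat z Z v × Adj G v w) → w ≡ u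
          toU w w∈ th = decidable-stable (w ≟ u) λ ne → ¬w (w , w∈ , th , ne)
          Y-empty : ∀ v → v ∉ Y
          Y-empty = isolated-branch P u (X#Y u u∈)
            (λ v w v∈ a → [ (λ { refl → ⊥-elim (x≁Y v (inj₂ v∈) (adj-sym G a)) }) , (λ k → toU w k (inj₁ (v , inj₂ v∈ , a))) ]′)
            (λ v w v∈ a k → Y≁Z (v , w , inj₂ v∈ , k , a))
          Z-empty : ∀ v → v ∉ Z
          Z-empty = isolated-branch (partial-swap P) u (X#Z u u∈)
            (λ v w v∈ a → [ (λ { refl → ⊥-elim (x≁Z v (inj₂ v∈) (adj-sym G a)) }) , (λ k → toU w k (inj₂ (v , inj₂ v∈ , a))) ]′)
            (λ v w v∈ a k → Y≁Z (w , v , k , inj₂ v∈ , adj-sym G a))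
          R : Subset n
          R = X - u
          R-empty : ∀ v → v ∉ R
          R-empty = no-inner₂ R x u (λ v h → Branch.outside-B bX v (minus⊆ h)) nbr
            (λ k → Branch.outside-B bX x (minus⊆ k) (∩ʳ A B x∈)) (λ k → minus-≢ {X = X} k refl)
            where
            nbr : ∀ v w → v ∈ R → Adj G v w → w ∈ R ⊎ w ≡ x ⊎ w ≡ u
            nbr v w v∈ a = go (w ∈? B)
              where
              v≢u : v ≢ u
              v≢u = minus-≢ {X = X} v∈
              inY : Hat y Y w → w ∈ R ⊎ w ≡ x ⊎ w ≡ u
              inY h = ⊥-elim (v≢u (toU v (minus⊆ v∈) (inj₁ (w , h , adj-sym G a))))
              inZ : Hat z Z w → w ∈ R ⊎ w ≡ x ⊎ w ≡ u
              inZ h = ⊥-elim (v≢u (toU v (minus⊆ v∈) (inj₂ (w , h , adj-sym G a))))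
              inX : w ∈ X → w ∈ R ⊎ w ≡ x ⊎ w ≡ u
              inX h with w ≟ u
              ... | yes refl = inj₂ (inj₂ refl)
              ... | no ne    = inj₁ (∈-minus h ne)
              go : Dec (w ∈ B) → w ∈ R ⊎ w ≡ x ⊎ w ≡ u
              go (no w∉) = [ inX , [ inY ∘ inj₂ , inZ ∘ inj₂ ]′ ]′ (cover w w∉)
              go (yes w∈) = [ inj₂ ∘ inj₁ , [ inY ∘ inj₁ , inZ ∘ inj₁ ]′ ]′
                (S⊆ w (∈∩ (Separations.sep-nbr G (τ-sep T t) (Branch.outside-B bX v (minus⊆ v∈)) a) w∈))
          absurd : ¬ (∃ λ a → a ∉ B × a ≢ u)
          absurd (a , a∉ , ne) = [ (λ h → R-empty a (∈-minus h ne)) , [ Y-empty a , Z-empty a ]′ ]′ (cover a a∉)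

  -- Each component of the interior is attached to all three roots. Two components, contracted onto
  -- x and y, already give the triangle. A single component goes entirely into X and is peeled; its
  -- two vertices a and b ensure that the peeling ends with a triangle.
  rooted-triangle : ∀ x y z → (∀ s → s ∈ A ∩ B → s ≡ x ⊎ s ≡ y ⊎ s ≡ z) → x ∈ A ∩ B → y ∈ A ∩ B → z ∈ A ∩ B →
    ¬ Adj G x y → ¬ Adj G x z → ¬ Adj G y z → ∀ a b → a ∉ B → b ∉ B → a ≢ b → RootedTriangle G B x y z
  rooted-triangle x y z S⊆ x∈ y∈ z∈ x≁y x≁z y≁z a b a∉ b∉ a≢b with component G (λ v → ¬? (v ∈? B)) a a∉
  ... | C with any? (λ c → ¬? (c ∈? B) ×-dec ¬? (c ∈? Component.K C))
  ...   | no ¬c = peel-all two (suc ∣ K ∣) ≤-refl (record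
            { S⊆ = S⊆ ; x∈ = x∈ ; y∈ = y∈ ; z∈ = z∈ ; x≁y = x≁y ; x≁z = x≁z ; y≁z = y≁z
            ; cover = λ u u∉ → inj₁ (decidable-stable (u ∈? K) λ u∉K → ¬c (u , u∉ , u∉K))
            ; bX = component-branch G C (att x x∈) ; bY = empty-branch G ; bZ = empty-branch G
            ; X#Y = λ v _ → ∉⊥ ; X#Z = λ v _ → ∉⊥ ; Y#Z = λ v _ → ∉⊥
            ; X~Y = let (u , u∈ , e) = att y y∈ in u , y , inj₂ u∈ , inj₁ refl , e
            ; X~Z = let (u , u∈ , e) = att z z∈ in u , z , inj₂ u∈ , inj₁ refl , e })
    where
    open Component C
    att = attached T t (weaken T (≤-pred (τ-order T t)) con) C
    two : ∀ c → ∃ λ d → d ∉ B × d ≢ c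
    two c with c ≟ a
    ... | yes refl = b , b∉ , a≢b ∘ ≡-sym
    ... | no ne    = a , a∉ , ne ∘ ≡-sym
  ...   | yes (c , c∉ , c∉K) = record
            { X = K ; Y = K′ ; Z = ∅ ; bX = component-branch G C (att x x∈) ; bY = component-branch G C′ (att′ y y∈) ; bZ = empty-branch G
            ; X#Y = K#K′ ; X#Z = λ v _ → ∉⊥ ; Y#Z = λ v _ → ∉⊥
            ; X~Y = let (u , u∈ , e) = att y y∈ in u , y , inj₂ u∈ , inj₁ refl , e
            ; X~Z = let (u , u∈ , e) = att z z∈ in u , z , inj₂ u∈ , inj₁ refl , e
            ; Y~Z = λ _ → let (u , u∈ , e) = att′ z z∈ in u , z , inj₂ u∈ , inj₁ refl , e }
    where
    open Component C
    C′ : Component G (_∉ B) c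
    C′ = component G (λ v → ¬? (v ∈? B)) c c∉
    open Component C′ using () renaming (K to K′)
    att = attached T t (weaken T (≤-pred (τ-order T t)) con) C
    att′ = attached T t (weaken T (≤-pred (τ-order T t)) con) C′
    K#K′ : Disjoint K K′
    K#K′ v v∈ v∈′ = c∉K (reach-end G (reach-closed G (_∈ K) closed v∈ (reach-sym G (Component.reach C′ v v∈′))))

-- Four elements of a tangle covering the graph

module Absorb {G : Graph n} {τ : OSeps n} (T : Tangle G 4 τ) {A B : Subset n} (t : τ A B) where
  open Separations G

  -- Since P contains `A ∩ B`, every vertex of the new separator lies in `P ∩ P′`, so adding A does
  -- not raise the order.
  absorb : ∀ {P P′} → τ P P′ → (∀ s → s ∈ A ∩ B → s ∈ P) → τ (A ∪ P) (B ∩ P′)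
  absorb {P} {P′} s S⊆P = τ-union T t s (≤-trans (s≤s (⊆-card sub)) (τ-order T s))
    where
    sub : ∀ v → v ∈ (A ∪ P) ∩ (B ∩ P′) → v ∈ P ∩ P′
    sub v h with x∈p∪q⁻ A P (∩ˡ (A ∪ P) (B ∩ P′) h) | ∩ʳ (A ∪ P) (B ∩ P′) h
    ... | inj₁ p | k = ∈∩ (S⊆P v (∈∩ p (∩ˡ B P′ k))) (∩ʳ B P′ k)
    ... | inj₂ p | k = ∈∩ p (∩ʳ B P′ k)

  record FourFamily : Set where
    field
      P P′ : Fin 3 → Subset n
      small : ∀ i → τ (P i) (P′ i)
      cov   : ∀ v → v ∈ A ⊎ (∃ λ i → v ∈ P i)
      edg   : ∀ u v → Adj G u v → (u ∈ A × v ∈ A) ⊎ (∃ λ i → u ∈ P i × v ∈ P i)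
      clq   : ∀ s t → s ∈ A ∩ B → t ∈ A ∩ B → ∃ λ i → s ∈ P i × t ∈ P i

  family : HasFourCover G τ A B → FourFamily
  family (P , P′ , Q , Q′ , R , R′ , p , q , r , c , e , k) = record
    { P = pick₃ P Q R ; P′ = pick₃ P′ Q′ R′
    ; small = λ { zero → p ; (suc zero) → q ; (suc (suc zero)) → r }
    ; cov = λ v → Sum.map₂ which (c v)
    ; edg = λ u v a → Sum.map₂ which₂ (e u v a)
    ; clq = λ s t s∈ t∈ → which₂ (k s t s∈ t∈) }
    where
    pick₃ : Subset n → Subset n → Subset n → Fin 3 → Subset n
    pick₃ X Y Z zero             = X
    pick₃ X Y Z (suc zero)       = Y
    pick₃ X Y Z (suc (suc zero)) = Z
    which : ∀ {v X Y Z} → v ∈ X ⊎ v ∈ Y ⊎ v ∈ Z → ∃ λ i → v ∈ pick₃ X Y Z i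
    which (inj₁ h)        = zero , h
    which (inj₂ (inj₁ h)) = suc zero , h
    which (inj₂ (inj₂ h)) = suc (suc zero) , h
    which₂ : ∀ {u v X Y Z} → (u ∈ X × v ∈ X) ⊎ (u ∈ Y × v ∈ Y) ⊎ (u ∈ Z × v ∈ Z) →
             ∃ λ i → u ∈ pick₃ X Y Z i × v ∈ pick₃ X Y Z i
    which₂ (inj₁ h)        = zero , h
    which₂ (inj₂ (inj₁ h)) = suc zero , h
    which₂ (inj₂ (inj₂ h)) = suc (suc zero) , h

  others₃ : (i : Fin 3) → ∃ λ j → ∃ λ k → ∀ l → l ≡ i ⊎ l ≡ j ⊎ l ≡ k
  others₃ zero             = suc zero , suc (suc zero) , λ { zero → inj₁ refl ; (suc zero) → inj₂ (inj₁ refl) ; (suc (suc zero)) → inj₂ (inj₂ refl) }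
  others₃ (suc zero)       = zero , suc (suc zero) , λ { zero → inj₂ (inj₁ refl) ; (suc zero) → inj₁ refl ; (suc (suc zero)) → inj₂ (inj₂ refl) }
  others₃ (suc (suc zero)) = zero , suc zero , λ { zero → inj₂ (inj₁ refl) ; (suc zero) → inj₂ (inj₂ refl) ; (suc (suc zero)) → inj₁ refl }

  module _ (F : FourFamily) where
    open FourFamily F

    -- Otherwise A merges with `P i` into one element of τ, and three elements cover G.
    no-absorb : ∀ i → ¬ (∀ s → s ∈ A ∩ B → s ∈ P i)
    no-absorb i S⊆P with others₃ i
    ... | j , k , all = Tangle.noCover T _ _ _ _ _ _ (absorb (small i) S⊆P) (small j) (small k) (c , e)
      where
      c : ∀ v → v ∈ A ∪ P i ⊎ v ∈ P j ⊎ v ∈ P k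
      c v with cov v
      ... | inj₁ h = inj₁ (∈∪ˡ h)
      ... | inj₂ (l , h) with all l
      ...   | inj₁ refl        = inj₁ (∈∪ʳ h)
      ...   | inj₂ (inj₁ refl) = inj₂ (inj₁ h)
      ...   | inj₂ (inj₂ refl) = inj₂ (inj₂ h)
      e : ∀ u v → Adj G u v → (u ∈ A ∪ P i × v ∈ A ∪ P i) ⊎ (u ∈ P j × v ∈ P j) ⊎ (u ∈ P k × v ∈ P k)
      e u v a with edg u v a
      ... | inj₁ (p , q) = inj₁ (∈∪ˡ p , ∈∪ˡ q)
      ... | inj₂ (l , p , q) with all l
      ...   | inj₁ refl        = inj₁ (∈∪ʳ p , ∈∪ʳ q)
      ...   | inj₂ (inj₁ refl) = inj₂ (inj₁ (p , q))
      ...   | inj₂ (inj₂ refl) = inj₂ (inj₂ (p , q))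

  -- At most two vertices form a single pair, and the set that contains this pair contains the whole
  -- separator.
  no-four-cover : ∣ A ∩ B ∣ ≤ 2 → ¬ HasFourCover G τ A B
  no-four-cover ≤2 h with nonempty? (A ∩ B)
  ... | no empty = no-absorb (family h) zero λ s s∈ → ⊥-elim (empty (s , s∈))
  ... | yes (x , x∈) with any? (λ y → (y ∈? A ∩ B) ×-dec ¬? (x ≟ y))
  ...   | no ¬y = let (i , p , _) = FourFamily.clq (family h) x x x∈ x∈ in
          no-absorb (family h) i λ s s∈ →
            subst (_∈ FourFamily.P (family h) i) (decidable-stable (x ≟ s) λ ne → ¬y (s , s∈ , ne)) p
  ...   | yes (y , y∈ , x≢y) = let (i , p , q) = FourFamily.clq (family h) x y x∈ y∈ in
          no-absorb (family h) i λ s s∈ →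
            [ (λ e → subst (_∈ FourFamily.P (family h) i) (≡-sym e) p)
            , (λ e → subst (_∈ FourFamily.P (family h) i) (≡-sym e) q) ]′ (exhausted₂ {X = A ∩ B} x≢y x∈ y∈ ≤2 s s∈)

-- Four-covers with small pairwise overlaps

module Quads {G : Graph n} {τ : OSeps n} (T : Tangle G 4 τ) (con : TangleConnected T 3) where
  open Separations G

  -- Four elements of τ that cover G and pairwise share few vertices.  A₀ has separator {x , y , z},
  -- and A₁ , A₂ , A₃ each contain one of the pairs xy , yz , zx.
  record Quad (A₀ B₀ A₁ B₁ A₂ B₂ A₃ B₃ : Subset n) (x y z : Fin n) : Set where
    field
      t₀ : τ A₀ B₀
      t₁ : τ A₁ B₁
      t₂ : τ A₂ B₂
      t₃ : τ A₃ B₃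
      i₀₁ : ∣ A₀ ∩ A₁ ∣ ≤ 2
      i₀₂ : ∣ A₀ ∩ A₂ ∣ ≤ 2
      i₀₃ : ∣ A₀ ∩ A₃ ∣ ≤ 2
      i₁₂ : ∣ A₁ ∩ A₂ ∣ ≤ 2
      i₂₃ : ∣ A₂ ∩ A₃ ∣ ≤ 2
      i₃₁ : ∣ A₃ ∩ A₁ ∣ ≤ 2
      cov : ∀ v → v ∈ A₀ ⊎ v ∈ A₁ ⊎ v ∈ A₂ ⊎ v ∈ A₃
      edg : ∀ u v → Adj G u v → (u ∈ A₀ × v ∈ A₀) ⊎ (u ∈ A₁ × v ∈ A₁) ⊎ (u ∈ A₂ × v ∈ A₂) ⊎ (u ∈ A₃ × v ∈ A₃)
      x≢y : x ≢ y
      y≢z : y ≢ z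
      z≢x : z ≢ x
      x∈₀ : x ∈ A₀ ∩ B₀
      y∈₀ : y ∈ A₀ ∩ B₀
      z∈₀ : z ∈ A₀ ∩ B₀
      x∈₁ : x ∈ A₁
      y∈₁ : y ∈ A₁
      y∈₂ : y ∈ A₂
      z∈₂ : z ∈ A₂
      z∈₃ : z ∈ A₃
      x∈₃ : x ∈ A₃
      a₀  : Fin n
      a₀∉ : a₀ ∉ B₀

  private
    variable
      A₀ B₀ A₁ B₁ A₂ B₂ A₃ B₃ : Subset n
      x y z : Fin n

    ∩-swap : ∀ (A B : Subset n) {k} → ∣ A ∩ B ∣ ≤ k → ∣ B ∩ A ∣ ≤ k
    ∩-swap A B {k} = subst (λ X → ∣ X ∣ ≤ k) (∩-comm A B)

  rotate : Quad A₀ B₀ A₁ B₁ A₂ B₂ A₃ B₃ x y z → Quad A₀ B₀ A₂ B₂ A₃ B₃ A₁ B₁ y z x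
  rotate q = record
    { t₀ = t₀ ; t₁ = t₂ ; t₂ = t₃ ; t₃ = t₁ ; i₀₁ = i₀₂ ; i₀₂ = i₀₃ ; i₀₃ = i₀₁ ; i₁₂ = i₂₃ ; i₂₃ = i₃₁ ; i₃₁ = i₁₂
    ; cov = λ v → Sum.map₂ rot (cov v) ; edg = λ u v a → Sum.map₂ rot (edg u v a)
    ; x≢y = y≢z ; y≢z = z≢x ; z≢x = x≢y ; x∈₀ = y∈₀ ; y∈₀ = z∈₀ ; z∈₀ = x∈₀
    ; x∈₁ = y∈₂ ; y∈₁ = z∈₂ ; y∈₂ = z∈₃ ; z∈₂ = x∈₃ ; z∈₃ = x∈₁ ; x∈₃ = y∈₁ ; a₀ = a₀ ; a₀∉ = a₀∉ }
    where
    open Quad q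
    rot : ∀ {P Q R : Set} → P ⊎ Q ⊎ R → Q ⊎ R ⊎ P
    rot (inj₁ h)        = inj₂ (inj₂ h)
    rot (inj₂ (inj₁ h)) = inj₁ h
    rot (inj₂ (inj₂ h)) = inj₂ (inj₁ h)

  reflect : Quad A₀ B₀ A₁ B₁ A₂ B₂ A₃ B₃ x y z → Quad A₀ B₀ A₁ B₁ A₃ B₃ A₂ B₂ y x z
  reflect {A₁ = A₁} {A₂ = A₂} {A₃ = A₃} q = record
    { t₀ = t₀ ; t₁ = t₁ ; t₂ = t₃ ; t₃ = t₂ ; i₀₁ = i₀₁ ; i₀₂ = i₀₃ ; i₀₃ = i₀₂
    ; i₁₂ = ∩-swap A₃ A₁ i₃₁ ; i₂₃ = ∩-swap A₂ A₃ i₂₃ ; i₃₁ = ∩-swap A₁ A₂ i₁₂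
    ; cov = λ v → Sum.map₂ (Sum.map₂ Sum.swap) (cov v) ; edg = λ u v a → Sum.map₂ (Sum.map₂ Sum.swap) (edg u v a)
    ; x≢y = x≢y ∘ ≡-sym ; y≢z = z≢x ∘ ≡-sym ; z≢x = y≢z ∘ ≡-sym ; x∈₀ = y∈₀ ; y∈₀ = x∈₀ ; z∈₀ = z∈₀
    ; x∈₁ = y∈₁ ; y∈₁ = x∈₁ ; y∈₂ = x∈₃ ; z∈₂ = z∈₃ ; z∈₃ = z∈₂ ; x∈₃ = y∈₂ ; a₀ = a₀ ; a₀∉ = a₀∉ }
    where open Quad q

  module _ (q : Quad A₀ B₀ A₁ B₁ A₂ B₂ A₃ B₃ x y z) where
    open Quad q

    -- Three elements of τ never cover G, so A₁ must own a vertex or an edge. By `rotate` and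
    -- `reflect` the same holds for A₂ and A₃.
    irredundant : (∀ v → v ∈ A₁ → v ∈ A₀ ⊎ v ∈ A₂ ⊎ v ∈ A₃) →
      (∀ u v → u ∈ A₁ → v ∈ A₁ → Adj G u v → (u ∈ A₀ × v ∈ A₀) ⊎ (u ∈ A₂ × v ∈ A₂) ⊎ (u ∈ A₃ × v ∈ A₃)) → ⊥
    irredundant c e = Tangle.noCover T _ _ _ _ _ _ t₀ t₂ t₃ ((λ v → go v (cov v)) , λ u v a → go₂ u v a (edg u v a))
      where
      go : ∀ v → v ∈ A₀ ⊎ v ∈ A₁ ⊎ v ∈ A₂ ⊎ v ∈ A₃ → v ∈ A₀ ⊎ v ∈ A₂ ⊎ v ∈ A₃
      go v (inj₁ h)        = inj₁ h
      go v (inj₂ (inj₁ h)) = c v h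
      go v (inj₂ (inj₂ h)) = inj₂ h
      go₂ : ∀ u v → Adj G u v → (u ∈ A₀ × v ∈ A₀) ⊎ (u ∈ A₁ × v ∈ A₁) ⊎ (u ∈ A₂ × v ∈ A₂) ⊎ (u ∈ A₃ × v ∈ A₃) →
            (u ∈ A₀ × v ∈ A₀) ⊎ (u ∈ A₂ × v ∈ A₂) ⊎ (u ∈ A₃ × v ∈ A₃)
      go₂ u v a (inj₁ h)              = inj₁ h
      go₂ u v a (inj₂ (inj₁ (h , k))) = e u v h k a
      go₂ u v a (inj₂ (inj₂ h))       = inj₂ h

    A₀∩A₁ : ∀ v → v ∈ A₀ → v ∈ A₁ → v ≡ x ⊎ v ≡ y
    A₀∩A₁ v p r = exhausted₂ {X = A₀ ∩ A₁} x≢y (∈∩ (∩ˡ A₀ B₀ x∈₀) x∈₁) (∈∩ (∩ˡ A₀ B₀ y∈₀) y∈₁) i₀₁ v (∈∩ p r)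

    z∉A₁ : z ∉ A₁
    z∉A₁ h = [ z≢x , y≢z ∘ ≡-sym ]′ (A₀∩A₁ z (∩ˡ A₀ B₀ z∈₀) h)

    -- Some neighbour of x is interior to A₀. If x were outside B₁, this neighbour would lie in A₁
    -- too, but A₀ and A₁ share only x and y, which are in B₀.
    x∈B₁ : x ∈ B₁
    x∈B₁ = decidable-stable (x ∈? B₁) λ x∉ →
      let C = component G (λ v → ¬? (v ∈? B₀)) a₀ a₀∉
          (k , k∈ , a) = attached T t₀ (weaken T (≤-pred (τ-order T t₀)) con) C x x∈₀
          k∉ = Component.within C k k∈
      in [ (λ e → k∉ (subst (_∈ B₀) (≡-sym e) (∩ʳ A₀ B₀ x∈₀))) , (λ e → k∉ (subst (_∈ B₀) (≡-sym e) (∩ʳ A₀ B₀ y∈₀))) ]′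
           (A₀∩A₁ k (sep-∉ʳ (τ-sep T t₀) k∉) (sep-nbr (τ-sep T t₁) x∉ (adj-sym G a)))

  -- The separator of A₁ consists of x, y and one further vertex w. `far` links w to the separator
  -- of another set, from which the common apex of the tetrahedron is found.
  record Third (A₀ A₁ B₁ A₂ B₂ A₃ B₃ : Subset n) (x y : Fin n) : Set where
    field
      w   : Fin n
      w∈  : w ∈ A₁
      w∈B : w ∈ B₁
      w≢x : w ≢ x
      w≢y : w ≢ y
      w∉₀ : w ∉ A₀
      ∂⊆  : ∀ v → v ∈ A₁ → v ∈ B₁ → v ≡ x ⊎ v ≡ y ⊎ v ≡ w
      far : (w ∈ A₂ × w ∈ B₂) ⊎ (w ∈ A₃ × w ∈ B₃)

  -- If w were outside B₂, all its neighbours would lie in A₂, and those in A₁ reduce to y because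
  -- A₁ ∩ A₂ = {y , w}. Removing w from A₁ then leaves a separation of order below 3, whose lack of
  -- interior gives A₁ = {x , y , w}. Here w and x are nonadjacent, the edge xy lies in A₀ and yw in
  -- A₂, so A₁ is redundant.
  in-separator : Quad A₀ B₀ A₁ B₁ A₂ B₂ A₃ B₃ x y z → ∀ w → w ∈ A₁ → w ∈ B₁ → w ≢ x → w ≢ y →
    (∀ v → v ∈ A₁ → v ∈ B₁ → v ≡ x ⊎ v ≡ y ⊎ v ≡ w) → w ∈ A₂ → w ∈ B₂
  in-separator {A₀} {B₀} {A₁} {B₁} {A₂} {B₂} {A₃} {B₃} {x} {y} {z} q w w∈ w∈B w≢x w≢y ∂⊆ w∈₂ =
    decidable-stable (w ∈? B₂) λ w∉ → irredundant q
      (λ v v∈ → redundant-vertex (∂⊆ v v∈ (A₁⊆B₁ w∉ v v∈)))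
      λ u v u∈ v∈ a → redundant-edge w∉ u v a (∂⊆ u u∈ (A₁⊆B₁ w∉ u u∈)) (∂⊆ v v∈ (A₁⊆B₁ w∉ v v∈))
    where
    open Quad q
    A₁∩A₂ : ∀ v → v ∈ A₁ → v ∈ A₂ → v ≡ y ⊎ v ≡ w
    A₁∩A₂ v p r = exhausted₂ {X = A₁ ∩ A₂} (w≢y ∘ ≡-sym) (∈∩ y∈₁ y∈₂) (∈∩ w∈ w∈₂) i₁₂ v (∈∩ p r)
    y∈B₁ : y ∈ B₁
    y∈B₁ = x∈B₁ (reflect q)
    A₁⊆B₁ : w ∉ B₂ → ∀ v → v ∈ A₁ → v ∈ B₁
    A₁⊆B₁ w∉ v v∈ with v ≟ w
    ... | yes refl = w∈B
    ... | no ne = con (A₁ - w) B₁ small o<3 (∈-minus v∈ ne)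
      where
      o<3 : order (A₁ - w) B₁ < 3
      o<3 = ≤-trans (s≤s (⊆-card λ u h → ∈-minus (∈∩ (minus⊆ (∩ˡ (A₁ - w) B₁ h)) (∩ʳ (A₁ - w) B₁ h)) (minus-≢ {X = A₁} (∩ˡ (A₁ - w) B₁ h))))
              (≤-trans (x∈p⇒∣p-x∣<∣p∣ (∈∩ w∈ w∈B)) (≤-pred (τ-order T t₁)))
      sep : IsSeparation G (A₁ - w) B₁
      sep = mkSep c λ u u′ u∈ u∉ u′∈ u′∉ a → none u u′ u∈ u∉ u′∉ a
        where
        c : ∀ u → u ∈ A₁ - w ⊎ u ∈ B₁
        c u with u ≟ w | proj₁ (τ-sep T t₁) u
        ... | yes refl | _      = inj₂ w∈B
        ... | no k     | inj₁ h = inj₁ (∈-minus h k)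
        ... | no k     | inj₂ h = inj₂ h
        none : ∀ u u′ → u ∈ A₁ - w → u ∉ B₁ → u′ ∉ A₁ - w → ¬ Adj G u u′
        none u u′ u∈ u∉ u′∉ a with u′ ≟ w
        ... | no k     = u′∉ (∈-minus (sep-nbr (τ-sep T t₁) u∉ a) k)
        ... | yes refl with A₁∩A₂ u (minus⊆ u∈) (sep-nbr (τ-sep T t₂) w∉ (adj-sym G a))
        ...   | inj₁ refl = u∉ y∈B₁
        ...   | inj₂ e    = minus-≢ {X = A₁} u∈ e
      small : τ (A₁ - w) B₁
      small = τ-mono T t₁ sep (≤-trans o<3 (n≤1+n _)) λ _ → id
    redundant-vertex : ∀ {v} → v ≡ x ⊎ v ≡ y ⊎ v ≡ w → v ∈ A₀ ⊎ v ∈ A₂ ⊎ v ∈ A₃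
    redundant-vertex (inj₁ refl)        = inj₁ (∩ˡ A₀ B₀ x∈₀)
    redundant-vertex (inj₂ (inj₁ refl)) = inj₁ (∩ˡ A₀ B₀ y∈₀)
    redundant-vertex (inj₂ (inj₂ refl)) = inj₂ (inj₁ w∈₂)
    x≁w : w ∉ B₂ → ¬ Adj G w x
    x≁w w∉ a = [ x≢y , z≢x ∘ ≡-sym ]′ (A₀∩A₁ (rotate q) x (∩ˡ A₀ B₀ x∈₀) (sep-nbr (τ-sep T t₂) w∉ a))
    redundant-edge : w ∉ B₂ → ∀ u v → Adj G u v → u ≡ x ⊎ u ≡ y ⊎ u ≡ w → v ≡ x ⊎ v ≡ y ⊎ v ≡ w →
      (u ∈ A₀ × v ∈ A₀) ⊎ (u ∈ A₂ × v ∈ A₂) ⊎ (u ∈ A₃ × v ∈ A₃)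
    redundant-edge w∉ u v a (inj₁ refl) (inj₁ refl) = ⊥-elim (adj-irrefl G a refl)
    redundant-edge w∉ u v a (inj₁ refl) (inj₂ (inj₁ refl)) = inj₁ (∩ˡ A₀ B₀ x∈₀ , ∩ˡ A₀ B₀ y∈₀)
    redundant-edge w∉ u v a (inj₁ refl) (inj₂ (inj₂ refl)) = ⊥-elim (x≁w w∉ (adj-sym G a))
    redundant-edge w∉ u v a (inj₂ (inj₁ refl)) (inj₁ refl) = inj₁ (∩ˡ A₀ B₀ y∈₀ , ∩ˡ A₀ B₀ x∈₀)
    redundant-edge w∉ u v a (inj₂ (inj₁ refl)) (inj₂ (inj₁ refl)) = ⊥-elim (adj-irrefl G a refl)
    redundant-edge w∉ u v a (inj₂ (inj₁ refl)) (inj₂ (inj₂ refl)) = inj₂ (inj₁ (y∈₂ , w∈₂))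
    redundant-edge w∉ u v a (inj₂ (inj₂ refl)) (inj₁ refl) = ⊥-elim (x≁w w∉ a)
    redundant-edge w∉ u v a (inj₂ (inj₂ refl)) (inj₂ (inj₁ refl)) = inj₂ (inj₁ (w∈₂ , y∈₂))
    redundant-edge w∉ u v a (inj₂ (inj₂ refl)) (inj₂ (inj₂ refl)) = ⊥-elim (adj-irrefl G a refl)

  -- Order below 3 would leave A₁ = {x , y}, which A₀ contains. For `far`, w has a neighbour outside
  -- A₁; the edge to it lies in A₂ or A₃, since w is not in A₀.
  third : Quad A₀ B₀ A₁ B₁ A₂ B₂ A₃ B₃ x y z → Third A₀ A₁ B₁ A₂ B₂ A₃ B₃ x y
  third {A₀} {B₀} {A₁} {B₁} {A₂} {B₂} {A₃} {B₃} {x} {y} {z} q with order A₁ B₁ <? 3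
    where open Quad q
  ... | yes o<3 = ⊥-elim (irredundant q (λ v v∈ → inj₁ (inA₀ v v∈)) λ u v u∈ v∈ _ → inj₁ (inA₀ u u∈ , inA₀ v v∈))
    where
    open Quad q
    inA₀ : ∀ v → v ∈ A₁ → v ∈ A₀
    inA₀ v v∈ = [ (λ e → subst (_∈ A₀) (≡-sym e) (∩ˡ A₀ B₀ x∈₀)) , (λ e → subst (_∈ A₀) (≡-sym e) (∩ˡ A₀ B₀ y∈₀)) ]′
      (exhausted₂ {X = A₁} x≢y x∈₁ y∈₁ (≤-trans (⊆-card λ u h → ∈∩ h (con A₁ B₁ t₁ o<3 h)) (≤-pred o<3)) v v∈)
  ... | no o≥3 with fresh (x ∷ y ∷ []) (A₁ ∩ B₁) (≮⇒≥ o≥3)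
  ...   | w , w∈∂ , w≢x ∷ w≢y ∷ [] = record
    { w = w ; w∈ = w∈ ; w∈B = w∈B ; w≢x = w≢x ; w≢y = w≢y ; w∉₀ = w∉₀ ; ∂⊆ = ∂⊆ ; far = far }
    where
    open Quad q
    w∈ : w ∈ A₁
    w∈ = ∩ˡ A₁ B₁ w∈∂
    w∈B : w ∈ B₁
    w∈B = ∩ʳ A₁ B₁ w∈∂
    w∉₀ : w ∉ A₀
    w∉₀ h = [ w≢x , w≢y ]′ (A₀∩A₁ q w h w∈)
    ∂⊆ : ∀ v → v ∈ A₁ → v ∈ B₁ → v ≡ x ⊎ v ≡ y ⊎ v ≡ w
    ∂⊆ v p r = exhausted₃ {X = A₁ ∩ B₁} x≢y (w≢x ∘ ≡-sym) (w≢y ∘ ≡-sym)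
      (∈∩ x∈₁ (x∈B₁ q)) (∈∩ y∈₁ (x∈B₁ (reflect q))) w∈∂ (≤-pred (τ-order T t₁)) v (∈∩ p r)
    -- Otherwise w could be dropped from the separator of A₁.
    leaves : ∃ λ u → u ∉ A₁ × Adj G w u
    leaves with any? (λ u → ¬? (u ∈? A₁) ×-dec adj? G w u)
    ... | yes h = h
    ... | no ¬h = ⊥-elim (minus-≢ {X = B₁} (con A₁ (B₁ - w) small o<3 w∈) refl)
      where
      o<3 : order A₁ (B₁ - w) < 3
      o<3 = ≤-trans (s≤s (⊆-card λ u h → ∈-minus (∈∩ (∩ˡ A₁ (B₁ - w) h) (minus⊆ (∩ʳ A₁ (B₁ - w) h))) (minus-≢ {X = B₁} (∩ʳ A₁ (B₁ - w) h))))
              (≤-trans (x∈p⇒∣p-x∣<∣p∣ w∈∂) (≤-pred (τ-order T t₁)))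
      sep : IsSeparation G A₁ (B₁ - w)
      sep = mkSep c λ u u′ u∈ u∉ _ u′∉ a → none u u′ u∉ u′∉ a
        where
        c : ∀ u → u ∈ A₁ ⊎ u ∈ B₁ - w
        c u with u ≟ w | proj₁ (τ-sep T t₁) u
        ... | yes refl | _      = inj₁ w∈
        ... | no k     | inj₁ h = inj₁ h
        ... | no k     | inj₂ h = inj₂ (∈-minus h k)
        none : ∀ u u′ → u ∉ B₁ - w → u′ ∉ A₁ → ¬ Adj G u u′
        none u u′ u∉ u′∉ a with u ≟ w
        ... | yes refl = ¬h (u′ , u′∉ , a)
        ... | no k     = u′∉ (sep-nbr (τ-sep T t₁) (λ l → u∉ (∈-minus l k)) a)
      small : τ A₁ (B₁ - w)
      small = orient T sep (≤-trans o<3 (n≤1+n _)) λ t′ → no-pair T t₁ t′ (proj₁ sep) λ u v → sep-edge sep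
    far : (w ∈ A₂ × w ∈ B₂) ⊎ (w ∈ A₃ × w ∈ B₃)
    far with leaves
    ... | u , u∉ , a with edg w u a
    ...   | inj₁ (h , _)               = ⊥-elim (w∉₀ h)
    ...   | inj₂ (inj₁ (_ , h))        = ⊥-elim (u∉ h)
    ...   | inj₂ (inj₂ (inj₁ (h , _))) = inj₁ (h , in-separator q w w∈ w∈B w≢x w≢y ∂⊆ h)
    ...   | inj₂ (inj₂ (inj₂ (h , _))) = inj₂ (h , in-separator (reflect q) w w∈ w∈B w≢y w≢x
              (λ v p r → swap₁₂ (∂⊆ v p r)) h)
      where
      swap₁₂ : ∀ {P Q R : Set} → P ⊎ Q ⊎ R → Q ⊎ P ⊎ R
      swap₁₂ (inj₁ h)        = inj₂ (inj₁ h)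
      swap₁₂ (inj₂ (inj₁ h)) = inj₁ h
      swap₁₂ (inj₂ (inj₂ h)) = inj₂ (inj₂ h)

module Corners {G : Graph n} {τ : OSeps n} (T : Tangle G 4 τ) (con : TangleConnected T 3) where
  open Separations G
  open Quads T con

  -- Four maximal elements of τ arranged like the faces of a tetrahedron: v j lies in the separator of A i
  -- for all i ≢ j.
  record Tetrahedron : Set where
    field
      A B     : Fin 4 → Subset n
      v       : Fin 4 → Fin n
      max     : ∀ i → Maximal T (A i) (B i)
      meet    : ∀ i j → i ≢ j → ∣ A i ∩ A j ∣ ≤ 2
      corner∈ : ∀ i j → i ≢ j → v j ∈ A i ∩ B i
      corner∉ : ∀ i → v i ∉ A i
      inner   : ∀ i → ∃ λ a → a ∉ B i

  private
    variable
      A₀ B₀ A₁ B₁ A₂ B₂ A₃ B₃ : Subset n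
      x y z : Fin n

  -- If A₁ had no interior, it would be {x , y , w}, and its possible edges xy, yw and wx lie in A₀,
  -- A₂ and A₃.
  interior : (q : Quad A₀ B₀ A₁ B₁ A₂ B₂ A₃ B₃ x y z) (h : Third A₀ A₁ B₁ A₂ B₂ A₃ B₃ x y) →
             Third.w h ∈ A₂ → Third.w h ∈ A₃ → ∃ λ a → a ∉ B₁
  interior {A₀} {B₀} {A₁} {B₁} {A₂} {B₂} {A₃} {B₃} {x} {y} q h w∈₂ w∈₃ with any? (λ a → ¬? (a ∈? B₁))
  ... | yes i = i
  ... | no ¬i = ⊥-elim (irredundant q (λ v v∈ → vert (∂⊆ v v∈ (all v)))
                  λ u v u∈ v∈ a → edge u v a (∂⊆ u u∈ (all u)) (∂⊆ v v∈ (all v)))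
    where
    open Quad q
    open Third h
    all : ∀ v → v ∈ B₁
    all v = decidable-stable (v ∈? B₁) λ v∉ → ¬i (v , v∉)
    x∈A₀ : x ∈ A₀
    x∈A₀ = ∩ˡ A₀ B₀ x∈₀
    y∈A₀ : y ∈ A₀
    y∈A₀ = ∩ˡ A₀ B₀ y∈₀
    vert : ∀ {v} → v ≡ x ⊎ v ≡ y ⊎ v ≡ w → v ∈ A₀ ⊎ v ∈ A₂ ⊎ v ∈ A₃
    vert (inj₁ refl)        = inj₁ x∈A₀
    vert (inj₂ (inj₁ refl)) = inj₁ y∈A₀
    vert (inj₂ (inj₂ refl)) = inj₂ (inj₁ w∈₂)
    edge : ∀ u v → Adj G u v → u ≡ x ⊎ u ≡ y ⊎ u ≡ w → v ≡ x ⊎ v ≡ y ⊎ v ≡ w →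
      (u ∈ A₀ × v ∈ A₀) ⊎ (u ∈ A₂ × v ∈ A₂) ⊎ (u ∈ A₃ × v ∈ A₃)
    edge u v a (inj₁ refl) (inj₁ refl) = inj₁ (x∈A₀ , x∈A₀)
    edge u v a (inj₁ refl) (inj₂ (inj₁ refl)) = inj₁ (x∈A₀ , y∈A₀)
    edge u v a (inj₁ refl) (inj₂ (inj₂ refl)) = inj₂ (inj₂ (x∈₃ , w∈₃))
    edge u v a (inj₂ (inj₁ refl)) (inj₁ refl) = inj₁ (y∈A₀ , x∈A₀)
    edge u v a (inj₂ (inj₁ refl)) (inj₂ (inj₁ refl)) = inj₁ (y∈A₀ , y∈A₀)
    edge u v a (inj₂ (inj₁ refl)) (inj₂ (inj₂ refl)) = inj₂ (inj₁ (y∈₂ , w∈₂))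
    edge u v a (inj₂ (inj₂ refl)) (inj₁ refl) = inj₂ (inj₂ (w∈₃ , x∈₃))
    edge u v a (inj₂ (inj₂ refl)) (inj₂ (inj₁ refl)) = inj₂ (inj₁ (w∈₂ , y∈₂))
    edge u v a (inj₂ (inj₂ refl)) (inj₂ (inj₂ refl)) = inj₂ (inj₁ (w∈₂ , w∈₂))

  -- Each of the three further vertices lies in the separator of another set, whose only vertex
  -- outside A₀ is its own further vertex. So each equals one of the other two, and all three
  -- coincide.
  tetrahedron : Quad A₀ B₀ A₁ B₁ A₂ B₂ A₃ B₃ x y z → Maximal T A₀ B₀ → Maximal T A₁ B₁ →
                Maximal T A₂ B₂ → Maximal T A₃ B₃ → Third A₀ A₁ B₁ A₂ B₂ A₃ B₃ x y →
                Third A₀ A₂ B₂ A₃ B₃ A₁ B₁ y z → Third A₀ A₃ B₃ A₁ B₁ A₂ B₂ z x → Tetrahedron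
  tetrahedron {A₀} {B₀} {A₁} {B₁} {A₂} {B₂} {A₃} {B₃} {x} {y} {z} q m₀ m₁ m₂ m₃ h₁ h₂ h₃ = record
    { A = A ; B = B ; v = v ; max = max ; meet = meet ; corner∈ = corner∈ ; corner∉ = corner∉ ; inner = inner }
    where
    open Quad q
    q′ = rotate q
    q″ = rotate q′
    w₁ = Third.w h₁
    w₂ = Third.w h₂
    w₃ = Third.w h₃
    ∩-swap : ∀ (A B : Subset n) {k} → ∣ A ∩ B ∣ ≤ k → ∣ B ∩ A ∣ ≤ k
    ∩-swap A B {k} = subst (λ X → ∣ X ∣ ≤ k) (∩-comm A B)
    same : ∀ {w a b w′} → w ∉ A₀ → a ∈ A₀ ∩ B₀ → b ∈ A₀ ∩ B₀ → w ≡ a ⊎ w ≡ b ⊎ w ≡ w′ → w ≡ w′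
    same w∉ a∈ b∈ (inj₁ refl)        = ⊥-elim (w∉ (∩ˡ A₀ B₀ a∈))
    same w∉ a∈ b∈ (inj₂ (inj₁ refl)) = ⊥-elim (w∉ (∩ˡ A₀ B₀ b∈))
    same w∉ a∈ b∈ (inj₂ (inj₂ e))    = e
    e₁ : w₁ ≡ w₂ ⊎ w₁ ≡ w₃
    e₁ = Sum.map (λ (p , r) → same (Third.w∉₀ h₁) y∈₀ z∈₀ (Third.∂⊆ h₂ w₁ p r))
                 (λ (p , r) → same (Third.w∉₀ h₁) z∈₀ x∈₀ (Third.∂⊆ h₃ w₁ p r)) (Third.far h₁)
    e₂ : w₂ ≡ w₃ ⊎ w₂ ≡ w₁
    e₂ = Sum.map (λ (p , r) → same (Third.w∉₀ h₂) z∈₀ x∈₀ (Third.∂⊆ h₃ w₂ p r))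
                 (λ (p , r) → same (Third.w∉₀ h₂) x∈₀ y∈₀ (Third.∂⊆ h₁ w₂ p r)) (Third.far h₂)
    e₃ : w₃ ≡ w₁ ⊎ w₃ ≡ w₂
    e₃ = Sum.map (λ (p , r) → same (Third.w∉₀ h₃) x∈₀ y∈₀ (Third.∂⊆ h₁ w₃ p r))
                 (λ (p , r) → same (Third.w∉₀ h₃) y∈₀ z∈₀ (Third.∂⊆ h₂ w₃ p r)) (Third.far h₃)
    all-same : ∀ {a b c : Fin n} → a ≡ b ⊎ a ≡ c → b ≡ c ⊎ b ≡ a → c ≡ a ⊎ c ≡ b → a ≡ b × a ≡ c
    all-same (inj₁ refl) _           (inj₁ refl) = refl , refl
    all-same (inj₁ refl) _           (inj₂ refl) = refl , refl
    all-same (inj₂ refl) (inj₁ refl) _           = refl , refl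
    all-same (inj₂ refl) (inj₂ refl) _           = refl , refl
    w₁≡w₂ : w₁ ≡ w₂
    w₁≡w₂ = proj₁ (all-same e₁ e₂ e₃)
    w₁≡w₃ : w₁ ≡ w₃
    w₁≡w₃ = proj₂ (all-same e₁ e₂ e₃)
    w∈₂ : w₁ ∈ A₂ ∩ B₂
    w∈₂ = subst (_∈ A₂ ∩ B₂) (≡-sym w₁≡w₂) (∈∩ (Third.w∈ h₂) (Third.w∈B h₂))
    w∈₃ : w₁ ∈ A₃ ∩ B₃
    w∈₃ = subst (_∈ A₃ ∩ B₃) (≡-sym w₁≡w₃) (∈∩ (Third.w∈ h₃) (Third.w∈B h₃))
    A B : Fin 4 → Subset n
    A zero                   = A₀
    A (suc zero)             = A₁
    A (suc (suc zero))       = A₂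
    A (suc (suc (suc zero))) = A₃
    B zero                   = B₀
    B (suc zero)             = B₁
    B (suc (suc zero))       = B₂
    B (suc (suc (suc zero))) = B₃
    v : Fin 4 → Fin n
    v zero                   = w₁
    v (suc zero)             = z
    v (suc (suc zero))       = x
    v (suc (suc (suc zero))) = y
    max : ∀ i → Maximal T (A i) (B i)
    max zero                   = m₀
    max (suc zero)             = m₁
    max (suc (suc zero))       = m₂
    max (suc (suc (suc zero))) = m₃
    meet : ∀ i j → i ≢ j → ∣ A i ∩ A j ∣ ≤ 2
    meet zero zero ne = ⊥-elim (ne refl)
    meet zero (suc zero) _ = i₀₁
    meet zero (suc (suc zero)) _ = i₀₂
    meet zero (suc (suc (suc zero))) _ = i₀₃
    meet (suc zero) zero _ = ∩-swap A₀ A₁ i₀₁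
    meet (suc zero) (suc zero) ne = ⊥-elim (ne refl)
    meet (suc zero) (suc (suc zero)) _ = i₁₂
    meet (suc zero) (suc (suc (suc zero))) _ = ∩-swap A₃ A₁ i₃₁
    meet (suc (suc zero)) zero _ = ∩-swap A₀ A₂ i₀₂
    meet (suc (suc zero)) (suc zero) _ = ∩-swap A₁ A₂ i₁₂
    meet (suc (suc zero)) (suc (suc zero)) ne = ⊥-elim (ne refl)
    meet (suc (suc zero)) (suc (suc (suc zero))) _ = i₂₃
    meet (suc (suc (suc zero))) zero _ = ∩-swap A₀ A₃ i₀₃
    meet (suc (suc (suc zero))) (suc zero) _ = i₃₁
    meet (suc (suc (suc zero))) (suc (suc zero)) _ = ∩-swap A₂ A₃ i₂₃
    meet (suc (suc (suc zero))) (suc (suc (suc zero))) ne = ⊥-elim (ne refl)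
    corner∈ : ∀ i j → i ≢ j → v j ∈ A i ∩ B i
    corner∈ zero zero ne = ⊥-elim (ne refl)
    corner∈ zero (suc zero) _ = z∈₀
    corner∈ zero (suc (suc zero)) _ = x∈₀
    corner∈ zero (suc (suc (suc zero))) _ = y∈₀
    corner∈ (suc zero) zero _ = ∈∩ (Third.w∈ h₁) (Third.w∈B h₁)
    corner∈ (suc zero) (suc zero) ne = ⊥-elim (ne refl)
    corner∈ (suc zero) (suc (suc zero)) _ = ∈∩ x∈₁ (x∈B₁ q)
    corner∈ (suc zero) (suc (suc (suc zero))) _ = ∈∩ y∈₁ (x∈B₁ (reflect q))
    corner∈ (suc (suc zero)) zero _ = w∈₂
    corner∈ (suc (suc zero)) (suc zero) _ = ∈∩ z∈₂ (x∈B₁ (reflect q′))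
    corner∈ (suc (suc zero)) (suc (suc zero)) ne = ⊥-elim (ne refl)
    corner∈ (suc (suc zero)) (suc (suc (suc zero))) _ = ∈∩ y∈₂ (x∈B₁ q′)
    corner∈ (suc (suc (suc zero))) zero _ = w∈₃
    corner∈ (suc (suc (suc zero))) (suc zero) _ = ∈∩ z∈₃ (x∈B₁ q″)
    corner∈ (suc (suc (suc zero))) (suc (suc zero)) _ = ∈∩ x∈₃ (x∈B₁ (reflect q″))
    corner∈ (suc (suc (suc zero))) (suc (suc (suc zero))) ne = ⊥-elim (ne refl)
    corner∉ : ∀ i → v i ∉ A i
    corner∉ zero                   = Third.w∉₀ h₁
    corner∉ (suc zero)             = z∉A₁ q
    corner∉ (suc (suc zero))       = z∉A₁ q′
    corner∉ (suc (suc (suc zero))) = z∉A₁ q″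
    inner : ∀ i → ∃ λ a → a ∉ B i
    inner zero                   = a₀ , a₀∉
    inner (suc zero)             = interior q h₁ (∩ˡ A₂ B₂ w∈₂) (∩ˡ A₃ B₃ w∈₃)
    inner (suc (suc zero))       = interior q′ h₂ (subst (_∈ A₃) w₁≡w₂ (∩ˡ A₃ B₃ w∈₃)) (subst (_∈ A₁) w₁≡w₂ (Third.w∈ h₁))
    inner (suc (suc (suc zero))) = interior q″ h₃ (subst (_∈ A₁) w₁≡w₃ (Third.w∈ h₁)) (subst (_∈ A₂) w₁≡w₃ (∩ˡ A₂ B₂ w∈₂))

  module _ {A B : Subset n} (m : Maximal T A B) (F : Absorb.FourFamily T (proj₁ m))
           {x y z a₀ : Fin n} (x∈ : x ∈ A ∩ B) (y∈ : y ∈ A ∩ B) (z∈ : z ∈ A ∩ B)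
           (x≢y : x ≢ y) (y≢z : y ≢ z) (z≢x : z ≢ x) (a₀∉ : a₀ ∉ B) where
    open Absorb.FourFamily F
    open Absorb T (proj₁ m)

    private
      S⊆ : ∀ s → s ∈ A ∩ B → ∀ {X : Subset n} → x ∈ X → y ∈ X → z ∈ X → s ∈ X
      S⊆ s s∈ {X} p q r = [ (λ e → at e p) , [ (λ e → at e q) , (λ e → at e r) ]′ ]′
        (exhausted₃ {X = A ∩ B} x≢y (z≢x ∘ ≡-sym) y≢z x∈ y∈ z∈ (≤-pred (τ-order T (proj₁ m))) s s∈)
        where
        at : ∀ {v} → s ≡ v → v ∈ X → s ∈ X
        at e = subst (_∈ X) (≡-sym e)

      cxy = clq x y x∈ y∈
      cyz = clq y z y∈ z∈
      czx = clq z x z∈ x∈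
      i = proj₁ cxy
      j = proj₁ cyz
      k = proj₁ czx

      -- A set that contains two of the three pairs contains the whole separator and would absorb A.
      i≢j : i ≢ j
      i≢j e = no-absorb F i λ s s∈ → S⊆ s s∈ (proj₁ (proj₂ cxy)) (proj₂ (proj₂ cxy)) (subst (λ l → z ∈ P l) (≡-sym e) (proj₂ (proj₂ cyz)))
      j≢k : j ≢ k
      j≢k e = no-absorb F j λ s s∈ → S⊆ s s∈ (subst (λ l → x ∈ P l) (≡-sym e) (proj₂ (proj₂ czx))) (proj₁ (proj₂ cyz)) (proj₂ (proj₂ cyz))
      k≢i : k ≢ i
      k≢i e = no-absorb F k λ s s∈ → S⊆ s s∈ (proj₂ (proj₂ czx)) (subst (λ l → y ∈ P l) (≡-sym e) (proj₂ (proj₂ cxy))) (proj₁ (proj₂ czx))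

      perm : Fin 3 → Fin 3
      perm zero             = i
      perm (suc zero)       = j
      perm (suc (suc zero)) = k

      perm-surjective : ∀ l → ∃ λ p → l ≡ perm p
      perm-surjective l = [ (λ e → zero , e) , [ (λ e → suc zero , e) , (λ e → suc (suc zero) , e) ]′ ]′
        (exhausted₃ {X = ⊤} i≢j (k≢i ∘ ≡-sym) j≢k ∈⊤ ∈⊤ ∈⊤ ≤-refl l ∈⊤)

      Q Q′ : Fin 4 → Subset n
      Q zero    = A
      Q (suc l) = proj₁ (extend-max T (small (perm l)))
      Q′ zero    = B
      Q′ (suc l) = proj₁ (proj₂ (extend-max T (small (perm l))))

      maxQ : ∀ l → Maximal T (Q l) (Q′ l)
      maxQ zero    = m
      maxQ (suc l) = proj₁ (proj₂ (proj₂ (extend-max T (small (perm l)))))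

      P⊆Q : ∀ l {v} → v ∈ P (perm l) → v ∈ Q (suc l)
      P⊆Q l = proj₂ (proj₂ (proj₂ (extend-max T (small (perm l)))))

      covQ : ∀ v → ∃ λ l → v ∈ Q l
      covQ v with cov v
      ... | inj₁ h = zero , h
      ... | inj₂ (l , h) with perm-surjective l
      ...   | p , refl = suc p , P⊆Q p h

      edgQ : ∀ u v → Adj G u v → ∃ λ l → u ∈ Q l × v ∈ Q l
      edgQ u v a with edg u v a
      ... | inj₁ h = zero , h
      ... | inj₂ (l , h , h′) with perm-surjective l
      ...   | p , refl = suc p , P⊆Q p h , P⊆Q p h′

      -- An inclusion would let three of the four elements cover G. This rules out the first
      -- alternative of `crossing`.
      antichain : ∀ {p q} → p ≢ q → ¬ (Q p ⊆ Q q)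
      antichain {p} {q} p≢q sub with fresh (p ∷ q ∷ []) (⊤ {4}) (s≤s (s≤s (s≤s z≤n)))
      ... | r , _ , r≢p ∷ r≢q ∷ [] with fresh (p ∷ q ∷ r ∷ []) (⊤ {4}) (s≤s (s≤s (s≤s (s≤s z≤n))))
      ...   | s , _ , s≢p ∷ s≢q ∷ s≢r ∷ [] =
        Tangle.noCover T _ _ _ _ _ _ (proj₁ (maxQ q)) (proj₁ (maxQ r)) (proj₁ (maxQ s))
          ((λ v → let (l , h) = covQ v in which l (list l) h) , λ u v a → let (l , h , h′) = edgQ u v a in which₂ l (list l) h h′)
        where
        list : ∀ l → Any (l ≡_) (p ∷ q ∷ r ∷ s ∷ [])
        list l = exhausted (p ∷ q ∷ r ∷ s ∷ []) ⊤
          ((p≢q ∷ r≢p ∘ ≡-sym ∷ s≢p ∘ ≡-sym ∷ []) ∷ (r≢q ∘ ≡-sym ∷ s≢q ∘ ≡-sym ∷ []) ∷ (s≢r ∘ ≡-sym ∷ []) ∷ [] ∷ [])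
          (∈⊤ ∷ ∈⊤ ∷ ∈⊤ ∷ ∈⊤ ∷ []) ≤-refl l ∈⊤
        which : ∀ l → Any (l ≡_) (p ∷ q ∷ r ∷ s ∷ []) → ∀ {v} → v ∈ Q l → v ∈ Q q ⊎ v ∈ Q r ⊎ v ∈ Q s
        which l (here refl)                         h = inj₁ (sub h)
        which l (there (here refl))                 h = inj₁ h
        which l (there (there (here refl)))         h = inj₂ (inj₁ h)
        which l (there (there (there (here refl)))) h = inj₂ (inj₂ h)
        which₂ : ∀ l → Any (l ≡_) (p ∷ q ∷ r ∷ s ∷ []) → ∀ {u v} → u ∈ Q l → v ∈ Q l →
                 (u ∈ Q q × v ∈ Q q) ⊎ (u ∈ Q r × v ∈ Q r) ⊎ (u ∈ Q s × v ∈ Q s)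
        which₂ l (here refl)                         h h′ = inj₁ (sub h , sub h′)
        which₂ l (there (here refl))                 h h′ = inj₁ (h , h′)
        which₂ l (there (there (here refl)))         h h′ = inj₂ (inj₁ (h , h′))
        which₂ l (there (there (there (here refl)))) h h′ = inj₂ (inj₂ (h , h′))

      meetQ : ∀ p q → p ≢ q → ∣ Q p ∩ Q q ∣ ≤ 2
      meetQ p q p≢q with crossing T con (proj₁ (maxQ p)) (proj₂ (maxQ p)) (proj₁ (maxQ q))
      ... | inj₁ q⊆p = ⊥-elim (antichain (p≢q ∘ ≡-sym) q⊆p)
      ... | inj₂ ≤2  = ≤2

      split₄ : ∀ {X : Fin 4 → Set} → ∃ X → X zero ⊎ X (suc zero) ⊎ X (suc (suc zero)) ⊎ X (suc (suc (suc zero)))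
      split₄ (zero , h)                   = inj₁ h
      split₄ (suc zero , h)               = inj₂ (inj₁ h)
      split₄ (suc (suc zero) , h)         = inj₂ (inj₂ (inj₁ h))
      split₄ (suc (suc (suc zero)) , h)   = inj₂ (inj₂ (inj₂ h))

      quad : Quad A B (Q (suc zero)) (Q′ (suc zero)) (Q (suc (suc zero))) (Q′ (suc (suc zero)))
                  (Q (suc (suc (suc zero)))) (Q′ (suc (suc (suc zero)))) x y z
      quad = record
        { t₀ = proj₁ m ; t₁ = proj₁ (maxQ (suc zero)) ; t₂ = proj₁ (maxQ (suc (suc zero)))
        ; t₃ = proj₁ (maxQ (suc (suc (suc zero))))
        ; i₀₁ = meetQ zero (suc zero) λ () ; i₀₂ = meetQ zero (suc (suc zero)) λ ()
        ; i₀₃ = meetQ zero (suc (suc (suc zero))) λ () ; i₁₂ = meetQ (suc zero) (suc (suc zero)) λ ()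
        ; i₂₃ = meetQ (suc (suc zero)) (suc (suc (suc zero))) λ ()
        ; i₃₁ = meetQ (suc (suc (suc zero))) (suc zero) λ ()
        ; cov = λ v → split₄ (covQ v) ; edg = λ u v a → split₄ (edgQ u v a)
        ; x≢y = x≢y ; y≢z = y≢z ; z≢x = z≢x ; x∈₀ = x∈ ; y∈₀ = y∈ ; z∈₀ = z∈
        ; x∈₁ = P⊆Q zero (proj₁ (proj₂ cxy)) ; y∈₁ = P⊆Q zero (proj₂ (proj₂ cxy))
        ; y∈₂ = P⊆Q (suc zero) (proj₁ (proj₂ cyz)) ; z∈₂ = P⊆Q (suc zero) (proj₂ (proj₂ cyz))
        ; z∈₃ = P⊆Q (suc (suc zero)) (proj₁ (proj₂ czx)) ; x∈₃ = P⊆Q (suc (suc zero)) (proj₂ (proj₂ czx))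
        ; a₀ = _ ; a₀∉ = a₀∉ }

    four-cover⇒tetrahedron : Tetrahedron
    four-cover⇒tetrahedron = tetrahedron quad m (maxQ (suc zero)) (maxQ (suc (suc zero))) (maxQ (suc (suc (suc zero))))
      (third quad) (third (rotate quad)) (third (rotate (rotate quad)))

-- Internally 4-connected graphs

∑ : (Fin n → ℕ) → ℕ
∑ {zero}  f = 0
∑ {suc n} f = f zero + ∑ (f ∘ suc)

∑-mono : {f g : Fin n → ℕ} → (∀ v → f v ≤ g v) → ∑ f ≤ ∑ g
∑-mono {zero}  h = z≤n
∑-mono {suc n} h = +-mono-≤ (h zero) (∑-mono (h ∘ suc))

∑-+ : (f g : Fin n → ℕ) → ∑ (λ v → f v + g v) ≡ ∑ f + ∑ g
∑-+ {zero}  f g = refl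
∑-+ {suc n} f g = trans (cong (f zero + g zero +_) (∑-+ (f ∘ suc) (g ∘ suc)))
  (interchange (f zero) (g zero) (∑ (f ∘ suc)) (∑ (g ∘ suc)))
  where
  interchange : ∀ a b c d → (a + b) + (c + d) ≡ (a + c) + (b + d)
  interchange = solve-∀

∑-const : ∀ n k → ∑ {n} (λ _ → k) ≡ n * k
∑-const zero    k = refl
∑-const (suc n) k = cong (k +_) (∑-const n k)

ind : Subset n → Fin n → ℕ
ind X v = if lookup X v then 1 else 0

ind∈ : ∀ {X : Subset n} {v} → v ∈ X → ind X v ≡ 1
ind∈ h = cong (if_then 1 else 0) ([]=⇒lookup h)

∑-ind : (X : Subset n) → ∑ (ind X) ≡ ∣ X ∣
∑-ind []            = refl
∑-ind (inside  ∷ X) = cong suc (∑-ind X)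
∑-ind (outside ∷ X) = ∑-ind X

∣∪∣≤ : (X Y : Subset n) → ∣ X ∪ Y ∣ ≤ ∣ X ∣ + ∣ Y ∣
∣∪∣≤ [] [] = z≤n
∣∪∣≤ (inside  ∷ X) (inside  ∷ Y) = s≤s (≤-trans (∣∪∣≤ X Y) (+-monoʳ-≤ ∣ X ∣ (n≤1+n _)))
∣∪∣≤ (inside  ∷ X) (outside ∷ Y) = s≤s (∣∪∣≤ X Y)
∣∪∣≤ (outside ∷ X) (inside  ∷ Y) = ≤-trans (s≤s (∣∪∣≤ X Y)) (≤-reflexive (≡-sym (+-suc ∣ X ∣ ∣ Y ∣)))
∣∪∣≤ (outside ∷ X) (outside ∷ Y) = ∣∪∣≤ X Y

outsider : (X : Subset n) → ∣ X ∣ < n → ∃ λ v → v ∉ X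
outsider {n} X lt with any? (λ v → ¬? (v ∈? X))
... | yes h = h
... | no ¬h = contradiction (≤-trans lt (≤-trans (≤-reflexive (≡-sym (∣⊤∣≡n n)))
                (⊆-card {X = ⊤} λ v _ → decidable-stable (v ∈? X) λ v∉ → ¬h (v , v∉)))) (<-irrefl refl)

⊆∧∣∣≥⇒⊇ : ∀ {X Y : Subset n} → X ⊆ Y → ∣ Y ∣ ≤ ∣ X ∣ → Y ⊆ X
⊆∧∣∣≥⇒⊇ {X = X} X⊆Y le {v} v∈ = decidable-stable (v ∈? X) λ v∉ →
  contradiction (≤-trans (p⊂q⇒∣p∣<∣q∣ (X⊆Y , v , v∈ , v∉)) le) (<-irrefl refl)

module _ (G : Graph n) where
  open Separations G

  N : Fin n → Subset n
  N v = select (adj? G v)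

  ∈N : ∀ {v w} → Adj G v w → w ∈ N v
  ∈N {v} = ∈-select⁺ (adj? G v)

  N∈ : ∀ {v w} → w ∈ N v → Adj G v w
  N∈ {v} = ∈-select⁻ (adj? G v)

  stays : ∀ {A B} → IsSeparation G A B → ∀ {X u v} → (∀ w → w ∈ A → w ∈ B → w ∈ X) →
          u ∉ B → Reach G (Del X) u v → v ∉ B
  stays {A} {B} s {X} S⊆X u∉ r = reach-end G (reach-closed G (_∉ B)
    (λ u v u∉ v∈ a v∈B → x∈∁p⇒x∉p v∈ (S⊆X v (sep-nbr s u∉ a) v∈B)) u∉ r)

  separates : ∀ {A B} → IsSeparation G A B → ∀ {a b} → a ∉ B → b ∉ A → ¬ Connected G (Del (A ∩ B))
  separates {A} {B} s {a} {b} a∉ b∉ con = stays s (λ _ → ∈∩) a∉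
    (con a b (x∉p⇒x∈∁p (a∉ ∘ ∩ʳ A B)) (x∉p⇒x∈∁p (b∉ ∘ ∩ˡ A B))) (sep-∉ʳ (sep-sym s) b∉)

  cut-off : ∀ {v u} → u ≢ v → u ∉ N v → ¬ Connected G (Del (N v))
  cut-off {v} {u} ne u∉ con with con v u (x∉p⇒x∈∁p λ h → adj-irrefl G (N∈ h) refl) (x∉p⇒x∈∁p u∉)
  ... | here _     = ne refl
  ... | step _ a r = x∈∁p⇒x∉p (reach-start G r) (∈N a)

module UniqueTangle {G : Graph n} (I : Internally4Connected G) where
  open Separations G

  private
    4<n : 4 < n
    4<n = proj₁ (proj₂ I)

    beyond-nbhd : ∀ v → ∣ N G v ∣ ≤ 3 → ∃ λ u → u ≢ v × u ∉ N G v
    beyond-nbhd v le with outsider (⁅ v ⁆ ∪ N G v) (≤-trans (s≤s (≤-trans (∣∪∣≤ ⁅ v ⁆ (N G v))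
      (+-mono-≤ (≤-reflexive (∣⁅x⁆∣≡1 v)) le))) 4<n)
    ... | u , u∉ = u , (λ { refl → u∉ (∈∪ˡ (x∈⁅x⁆ u)) }) , u∉ ∘ ∈∪ʳ

    degree≥3 : ∀ v → 3 ≤ ∣ N G v ∣
    degree≥3 v with ∣ N G v ∣ <? 3
    ... | no ≥3  = ≮⇒≥ ≥3
    ... | yes <3 = let (u , ne , u∉) = beyond-nbhd v (≤-trans (n≤1+n _) (≤-trans <3 ≤-refl)) in
      ⊥-elim (cut-off G ne u∉ (proj₂ (proj₁ I) (N G v) <3))

    cubic : ∀ v → ∣ N G v ∣ ≤ 3 → Independent G (N G v) × TwoComponentsOneTrivial G (N G v)
    cubic v le = let (u , ne , u∉) = beyond-nbhd v le in
      proj₂ (proj₂ I) (N G v) (≤-antisym le (degree≥3 v)) (cut-off G ne u∉)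

    -- If n ≤ 6, a cubic vertex v would make G bipartite with classes N v and its complement,
    -- which leaves no edge for the nontrivial component of G − N v.
    degree≥4 : n ≤ 6 → ∀ v → 4 ≤ ∣ N G v ∣
    degree≥4 n≤6 v with ∣ N G v ∣ ≤? 3
    ... | no >3  = ≰⇒> >3
    ... | yes ≤3 = ⊥-elim impossible
      where
      S : Subset n
      S = N G v
      ∣∁S∣≤3 : ∣ ∁ S ∣ ≤ 3
      ∣∁S∣≤3 = ≤-trans (≤-reflexive (∣∁p∣≡n∸∣p∣ S)) (≤-trans (∸-monoˡ-≤ ∣ S ∣ n≤6) (∸-monoʳ-≤ 6 (degree≥3 v)))
      s : Fin n
      s = proj₁ (pick S (≤-trans (s≤s z≤n) (degree≥3 v)))
      s∈ : s ∈ S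
      s∈ = proj₂ (pick S (≤-trans (s≤s z≤n) (degree≥3 v)))
      Ns⊆ : N G s ⊆ ∁ S
      Ns⊆ {w} h = x∉p⇒x∈∁p λ w∈ → false⇒¬adj G (proj₁ (cubic v ≤3) s w s∈ w∈) (N∈ G h)
      ⊆Ns : ∁ S ⊆ N G s
      ⊆Ns = ⊆∧∣∣≥⇒⊇ Ns⊆ (≤-trans ∣∁S∣≤3 (degree≥3 s))
      complement-independent : ∀ p q → p ∉ S → q ∉ S → ¬ Adj G p q
      complement-independent p q p∉ q∉ = false⇒¬adj G
        (proj₁ (cubic s (≤-trans (⊆-card λ _ → Ns⊆) ∣∁S∣≤3)) p q (⊆Ns (x∉p⇒x∈∁p p∉)) (⊆Ns (x∉p⇒x∈∁p q∉)))
      impossible : ⊥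
      impossible with proj₂ (cubic v ≤3)
      ... | c , c∉ , _ , (u , u∉ , u≢c) , conn with fresh (c ∷ u ∷ []) (∁ S) (≤-trans (degree≥3 s) (⊆-card λ _ → Ns⊆))
      ...   | w , w∈ , w≢c ∷ w≢u ∷ [] with conn u w u∉ (x∈∁p⇒x∉p w∈) u≢c w≢c
      ...     | here _     = w≢u refl
      ...     | step _ a r = complement-independent _ _ u∉ (x∈∁p⇒x∉p (reach-start G r)) a

    -- Five or six vertices give at least 5 · 4 = 20, and seven or more give at least 7 · 3 = 21.
    18<∑degrees : 18 < ∑ (λ v → ∣ N G v ∣)
    18<∑degrees with n ≤? 6
    ... | yes n≤6 = ≤-trans (≤-trans (n≤1+n 19) (*-monoˡ-≤ 4 4<n)) (≤-trans (≤-reflexive (≡-sym (∑-const n 4))) (∑-mono (degree≥4 n≤6)))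
    ... | no n>6  = ≤-trans (≤-trans (m≤n+m 19 2) (*-monoˡ-≤ 3 (≰⇒> n>6))) (≤-trans (≤-reflexive (≡-sym (∑-const n 3))) (∑-mono degree≥3))

  -- The side with at most one interior vertex is small. The count treats sides without interior and
  -- claws uniformly.
  σ : OSeps n
  σ A B = IsSeparation G A B × order A B < 4 × ∣ A ∩ ∁ B ∣ ≤ 1

  private
    data Shape (A B : Subset n) : Set where
      flat : A ⊆ B → Shape A B
      claw : ∀ c → c ∈ A → c ∉ B → (∀ v → v ∈ A → v ≢ c → v ∈ B) → ∣ A ∩ B ∣ ≡ 3 → Independent G (A ∩ B) → Shape A B

    separator≡3 : ∀ {A B} → IsSeparation G A B → order A B < 4 → ∀ {a b} → a ∉ B → b ∉ A →
      ∣ A ∩ B ∣ ≡ 3 × Independent G (A ∩ B) × TwoComponentsOneTrivial G (A ∩ B)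
    separator≡3 {A} {B} s o a∉ b∉ with ∣ A ∩ B ∣ <? 3
    ... | yes <3 = ⊥-elim (separates G s a∉ b∉ (proj₂ (proj₁ I) (A ∩ B) <3))
    ... | no ≥3  = let e = ≤-antisym (≤-pred o) (≮⇒≥ ≥3) in e , proj₂ (proj₂ I) (A ∩ B) e (separates G s a∉ b∉)

    ∣A∣≤4 : ∀ {A B : Subset n} c → (∀ v → v ∈ A → v ≢ c → v ∈ B) → ∣ A ∩ B ∣ ≤ 3 → ∣ A ∣ ≤ 4
    ∣A∣≤4 {A} {B} c only le = ≤-trans (∣X∣≤1+∣X-x∣ A c) (s≤s (≤-trans
      (⊆-card λ v h → ∈∩ (minus⊆ h) (only v (minus⊆ h) (minus-≢ {X = A} h))) le))

    shape : ∀ {A B} → σ A B → Shape A B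
    shape {A} {B} (s , o , le) with any? (λ c → (c ∈? A) ×-dec ¬? (c ∈? B))
    ... | no ¬c = flat λ {v} v∈ → decidable-stable (v ∈? B) λ v∉ → ¬c (v , v∈ , v∉)
    ... | yes (c , c∈ , c∉) = claw c c∈ c∉ only (proj₁ three) (proj₁ (proj₂ three))
      where
      only : ∀ v → v ∈ A → v ≢ c → v ∈ B
      only v v∈ ne = decidable-stable (v ∈? B) λ v∉ → contradiction
        (≤-trans (distinct⇒≤ (v ∷ c ∷ []) (A ∩ ∁ B) ((ne ∷ []) ∷ [] ∷ []) (∈∩ v∈ (x∉p⇒x∈∁p v∉) ∷ ∈∩ c∈ (x∉p⇒x∈∁p c∉) ∷ [])) le)
        λ { (s≤s ()) }
      three = separator≡3 s o c∉ (proj₂ (outsider A (≤-trans (s≤s (∣A∣≤4 c only (≤-pred o))) 4<n)))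

    inner : Subset n → Fin n → Subset n
    inner A v = select λ w → (v ∈? A) ×-dec ((w ∈? A) ×-dec adj? G v w)

    inner∈ : ∀ A v {w} → w ∈ inner A v → v ∈ A × w ∈ A × Adj G v w
    inner∈ A v = ∈-select⁻ λ w → (v ∈? A) ×-dec ((w ∈? A) ×-dec adj? G v w)

    -- The subgraph induced by A has at most three edges.
    weights : ∀ {A B} → σ A B → ∃ λ (W : Fin n → ℕ) → (∀ v → ∣ inner A v ∣ ≤ W v) × ∑ W ≤ 6
    weights {A} {B} t@(s , o , _) with shape t
    -- At most three vertices, each of degree at most 2 inside A.
    ... | flat A⊆B = (λ v → ind A v + ind A v) , bound ,
          ≤-trans (≤-reflexive (trans (∑-+ (ind A) (ind A)) (cong (λ k → k + k) (∑-ind A)))) (+-mono-≤ ∣A∣≤3 ∣A∣≤3)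
      where
      ∣A∣≤3 : ∣ A ∣ ≤ 3
      ∣A∣≤3 = ≤-trans (⊆-card λ v h → ∈∩ h (A⊆B h)) (≤-pred o)
      bound : ∀ v → ∣ inner A v ∣ ≤ ind A v + ind A v
      bound v = go (v ∈? A)
        where
        go : Dec (v ∈ A) → ∣ inner A v ∣ ≤ ind A v + ind A v
        go (no v∉) = ≤-trans (listed⇒≤ [] _ λ w h → ⊥-elim (v∉ (proj₁ (inner∈ A v h)))) z≤n
        go (yes v∈) = ≤-trans (⊆-card λ w h → ∈-minus (proj₁ (proj₂ (inner∈ A v h))) λ e → adj-irrefl G (proj₂ (proj₂ (inner∈ A v h))) (≡-sym e))
            (≤-trans (≤-pred (≤-trans (x∈p⇒∣p-x∣<∣p∣ v∈) ∣A∣≤3)) (≤-reflexive (≡-sym (cong (λ k → k + k) (ind∈ v∈)))))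
    -- Degree 3 at the centre, counted as 1 + 2, and 1 at each of the three leaves.
    ... | claw c c∈ c∉ only ≡3 indep = (λ v → ind A v + (ind ⁅ c ⁆ v + ind ⁅ c ⁆ v)) , bound ,
          ≤-trans (≤-reflexive (trans (∑-+ (ind A) _) (cong₂ _+_ (∑-ind A)
            (trans (∑-+ (ind ⁅ c ⁆) (ind ⁅ c ⁆)) (cong (λ k → k + k) (trans (∑-ind ⁅ c ⁆) (∣⁅x⁆∣≡1 c)))))))
            (+-monoˡ-≤ 2 (∣A∣≤4 c only (≤-reflexive ≡3)))
      where
      bound : ∀ v → ∣ inner A v ∣ ≤ ind A v + (ind ⁅ c ⁆ v + ind ⁅ c ⁆ v)
      bound v = go (v ∈? A)
        where
        go : Dec (v ∈ A) → ∣ inner A v ∣ ≤ ind A v + (ind ⁅ c ⁆ v + ind ⁅ c ⁆ v)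
        go (no v∉) = ≤-trans (listed⇒≤ [] _ λ w h → ⊥-elim (v∉ (proj₁ (inner∈ A v h)))) z≤n
        go (yes v∈) with v ≟ c
        ... | yes refl = ≤-trans (⊆-card λ w h → ∈∩ (proj₁ (proj₂ (inner∈ A v h)))
                (only w (proj₁ (proj₂ (inner∈ A v h))) λ e → adj-irrefl G (proj₂ (proj₂ (inner∈ A v h))) (≡-sym e)))
              (≤-reflexive (trans ≡3 (≡-sym (cong₂ (λ k l → k + (l + l)) (ind∈ v∈) (ind∈ (x∈⁅x⁆ c))))))
        ... | no ne = ≤-trans (listed⇒≤ (c ∷ []) _ λ w h → here (decidable-stable (w ≟ c) λ w≢c →
                false⇒¬adj G (indep v w (∈∩ v∈ (only v v∈ ne)) (∈∩ (proj₁ (proj₂ (inner∈ A v h))) (only w (proj₁ (proj₂ (inner∈ A v h))) w≢c)))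
                  (proj₂ (proj₂ (inner∈ A v h)))))
              (≤-trans (≤-reflexive (≡-sym (ind∈ v∈))) (m≤m+n _ _))

    σ-noCover : ∀ A₁ B₁ A₂ B₂ A₃ B₃ → σ A₁ B₁ → σ A₂ B₂ → σ A₃ B₃ → ¬ Covers G A₁ A₂ A₃
    σ-noCover A₁ B₁ A₂ B₂ A₃ B₃ s₁ s₂ s₃ (_ , e) with weights s₁ | weights s₂ | weights s₃
    ... | W₁ , b₁ , l₁ | W₂ , b₂ , l₂ | W₃ , b₃ , l₃ = contradiction 18<∑degrees (≤⇒≯ (begin
      ∑ (λ v → ∣ N G v ∣)                ≤⟨ ∑-mono per-vertex ⟩
      ∑ (λ v → W₁ v + (W₂ v + W₃ v))     ≡⟨ trans (∑-+ W₁ _) (cong (∑ W₁ +_) (∑-+ W₂ W₃)) ⟩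
      ∑ W₁ + (∑ W₂ + ∑ W₃)               ≤⟨ +-mono-≤ l₁ (+-mono-≤ l₂ l₃) ⟩
      18                                 ∎))
      where
      open ≤-Reasoning
      mem : ∀ A v {w} → v ∈ A × w ∈ A → Adj G v w → w ∈ inner A v
      mem A v (p , q) a = ∈-select⁺ (λ w → (v ∈? A) ×-dec ((w ∈? A) ×-dec adj? G v w)) (p , q , a)
      per-vertex : ∀ v → ∣ N G v ∣ ≤ W₁ v + (W₂ v + W₃ v)
      per-vertex v = ≤-trans (⊆-card {Y = inner A₁ v ∪ (inner A₂ v ∪ inner A₃ v)} λ w h →
          [ (λ p → ∈∪ˡ (mem A₁ v p (N∈ G h))) , [ (λ p → ∈∪ʳ (∈∪ˡ (mem A₂ v p (N∈ G h)))) , (λ p → ∈∪ʳ (∈∪ʳ (mem A₃ v p (N∈ G h)))) ]′ ]′ (e v w (N∈ G h)))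
        (≤-trans (∣∪∣≤ (inner A₁ v) _) (+-mono-≤ (b₁ v) (≤-trans (∣∪∣≤ (inner A₂ v) (inner A₃ v)) (+-mono-≤ (b₂ v) (b₃ v)))))

    -- All vertices outside X except c lie in the component of b, and b is on the other side, so
    -- only c can be interior to A.
    few : ∀ {A B} → IsSeparation G A B → ∀ {X} → (∀ w → w ∈ A → w ∈ B → w ∈ X) → (∀ w → w ∈ X → w ∈ A × w ∈ B) →
          ∀ b → b ∉ A → ∀ c → c ∉ B → (∀ u w → u ∉ X → w ∉ X → u ≢ c → w ≢ c → Reach G (Del X) u w) → ∣ A ∩ ∁ B ∣ ≤ 1
    few {A} {B} s {X} S⊆X X⊆S b b∉ c c∉ conn = listed⇒≤ (c ∷ []) (A ∩ ∁ B) λ v h → here (decidable-stable (v ≟ c) λ v≢c →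
      let v∉ = x∈∁p⇒x∉p (∩ʳ A (∁ B) h) in
      stays G s S⊆X v∉ (conn v b (v∉ ∘ proj₂ ∘ X⊆S v) (b∉ ∘ proj₁ ∘ X⊆S b) v≢c λ { refl → b∉ (sep-∉ʳ s c∉) }) (sep-∉ʳ (sep-sym s) b∉))

    nothing-left : ∀ (A : Subset n) {B} → ¬ (∃ λ a → a ∉ B) → ∣ A ∩ ∁ B ∣ ≤ 1
    nothing-left A {B} ¬a = ≤-trans (listed⇒≤ [] _ λ v h → ⊥-elim (¬a (v , x∈∁p⇒x∉p (∩ʳ A (∁ B) h)))) z≤n

    σ-complete : ∀ A B → IsSeparation G A B → order A B < 4 → σ A B ⊎ σ B A
    σ-complete A B s o with any? (λ a → ¬? (a ∈? B)) | any? (λ b → ¬? (b ∈? A))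
    ... | no ¬a | _ = inj₁ (s , o , nothing-left A ¬a)
    ... | _ | no ¬b = inj₂ (sep-sym s , subst (_< 4) (order-sym A B) o , nothing-left B ¬b)
    ... | yes (a , a∉) | yes (b , b∉) with separator≡3 s o a∉ b∉
    ...   | _ , _ , c , c∉ , _ , _ , conn with c ∈? B
    ...     | no c∉B = inj₁ (s , o , few s (λ _ → ∈∩) (λ w → x∈p∩q⁻ A B) b b∉ c c∉B conn)
    ...     | yes c∈B = inj₂ (sep-sym s , subst (_< 4) (order-sym A B) o ,
                few (sep-sym s) (λ _ p q → ∈∩ q p) (λ w h → ∩ʳ A B h , ∩ˡ A B h) a a∉ c (λ c∈A → c∉ (∈∩ c∈A c∈B)) conn)

  σ-tangle : Tangle G 4 σ
  σ-tangle = record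
    { sound = λ A B (s , o , _) → s , o
    ; complete = σ-complete
    ; exclusive = λ A B p q → ⊥-elim (σ-noCover _ _ _ _ _ _ p q q
        ((λ v → Sum.map₂ inj₁ (proj₁ (proj₁ p) v)) , λ u v a → Sum.map₂ inj₁ (sep-edge (proj₁ p) a)))
    ; noCover = σ-noCover
    }

  private
    -- If A has no interior, B is everything. If A is a claw with centre c, choose a leaf s: the
    -- sets `A - s` and {c , s} have at most three vertices, so they are small in ρ, and together
    -- with B they cover G.
    small-not-big : ∀ {ρ} → Tangle G 4 ρ → ∀ {A B} → σ A B → ¬ ρ B A
    small-not-big R {A} {B} t r with shape t
    ... | flat A⊆B = not-full R r λ v → [ A⊆B , id ]′ (proj₁ (proj₁ t) v)
    ... | claw c c∈ c∉ only ≡3 _ = Tangle.noCover R _ _ _ _ _ _ r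
            (few-small R (A - s) (≤-pred (≤-trans (x∈p⇒∣p-x∣<∣p∣ s∈A) (∣A∣≤4 c only (≤-reflexive ≡3)))))
            (few-small R (⁅ c ⁆ ∪ ⁅ s ⁆) (≤-trans (∣∪∣≤ ⁅ c ⁆ ⁅ s ⁆) (≤-trans (≤-reflexive (cong₂ _+_ (∣⁅x⁆∣≡1 c) (∣⁅x⁆∣≡1 s))) (n≤1+n _))))
            (cov , edg)
      where
      s∈∂ = pick (A ∩ B) (≤-trans (s≤s z≤n) (≤-reflexive (≡-sym ≡3)))
      s : Fin n
      s = proj₁ s∈∂
      s∈A : s ∈ A
      s∈A = ∩ˡ A B (proj₂ s∈∂)
      s∈B : s ∈ B
      s∈B = ∩ʳ A B (proj₂ s∈∂)
      c∈₂ : c ∈ ⁅ c ⁆ ∪ ⁅ s ⁆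
      c∈₂ = ∈∪ˡ (x∈⁅x⁆ c)
      s∈₂ : s ∈ ⁅ c ⁆ ∪ ⁅ s ⁆
      s∈₂ = ∈∪ʳ (x∈⁅x⁆ s)
      cov : ∀ v → v ∈ B ⊎ v ∈ A - s ⊎ v ∈ ⁅ c ⁆ ∪ ⁅ s ⁆
      cov v with v ≟ c | proj₁ (proj₁ t) v
      ... | yes refl | _      = inj₂ (inj₂ c∈₂)
      ... | no _     | inj₂ h = inj₁ h
      ... | no ne    | inj₁ h = inj₁ (only v h ne)
      edg : ∀ u v → Adj G u v → (u ∈ B × v ∈ B) ⊎ (u ∈ A - s × v ∈ A - s) ⊎ (u ∈ ⁅ c ⁆ ∪ ⁅ s ⁆ × v ∈ ⁅ c ⁆ ∪ ⁅ s ⁆)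
      edg u v a with sep-edge (proj₁ t) a
      ... | inj₂ h = inj₁ h
      ... | inj₁ (u∈ , v∈) with u ≟ s | v ≟ s
      ...   | no p     | no q     = inj₂ (inj₁ (∈-minus u∈ p , ∈-minus v∈ q))
      ...   | yes e    | yes e′   = ⊥-elim (adj-irrefl G a (trans e (≡-sym e′)))
      ...   | yes refl | no _ with v ≟ c
      ...     | yes refl = inj₂ (inj₂ (s∈₂ , c∈₂))
      ...     | no ne    = inj₁ (s∈B , only v v∈ ne)
      edg u v a | inj₁ (u∈ , v∈) | no _ | yes refl with u ≟ c
      ...     | yes refl = inj₂ (inj₂ (c∈₂ , s∈₂))
      ...     | no ne    = inj₁ (only u u∈ ne , s∈B)

  σ-unique : ∀ ρ → Tangle G 4 ρ → ρ ≐ σ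
  σ-unique ρ R A B =
    (λ r → [ id , (λ t → ⊥-elim (small-not-big R t r)) ]′ (σ-complete A B (τ-sep R r) (τ-order R r))) ,
    λ t → orient R (proj₁ t) (proj₁ (proj₂ t)) (small-not-big R t)

-- The cube

-- The cube as a complete bipartite graph on 4 + 4 vertices without a perfect matching. In the
-- minor, `inj₁ i` is a corner of the tetrahedron and `inj₂ i` a component of the interior of the
-- opposite face.
CubeEdge : Fin 4 ⊎ Fin 4 → Fin 4 ⊎ Fin 4 → Set
CubeEdge (inj₁ i) (inj₂ j) = i ≢ j
CubeEdge (inj₂ i) (inj₁ j) = i ≢ j
CubeEdge _        _        = ⊥

cubeEdge? : ∀ p q → Dec (CubeEdge p q)
cubeEdge? (inj₁ i) (inj₂ j) = ¬? (i ≟ j)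
cubeEdge? (inj₂ i) (inj₁ j) = ¬? (i ≟ j)
cubeEdge? (inj₁ _) (inj₁ _) = no id
cubeEdge? (inj₂ _) (inj₂ _) = no id

cubeEdge-sym : ∀ p q → CubeEdge p q → CubeEdge q p
cubeEdge-sym (inj₁ i) (inj₂ j) ne = ne ∘ ≡-sym
cubeEdge-sym (inj₂ i) (inj₁ j) ne = ne ∘ ≡-sym

cubeEdge-irrefl : ∀ p → ¬ CubeEdge p p
cubeEdge-irrefl (inj₁ i) ()
cubeEdge-irrefl (inj₂ i) ()

cube : Graph 8
cube = relGraph (λ u v → cubeEdge? (splitAt 4 u) (splitAt 4 v))
  (λ {u} {v} → cubeEdge-sym (splitAt 4 u) (splitAt 4 v)) (λ {u} → cubeEdge-irrefl (splitAt 4 u))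

cube-adj : ∀ c d → Adj cube c d → CubeEdge (splitAt 4 c) (splitAt 4 d)
cube-adj c d = relGraph-adj⁻ (λ u v → cubeEdge? (splitAt 4 u) (splitAt 4 v)) {c} {d}

-- Testing internal 4-connectivity by evaluation

module _ (G : Graph n) where

  -- One round of search inside W, written with set operations alone so that it evaluates cheaply;
  -- the proofs carried by `Component` would be a burden here.
  spread : Subset n → Subset n → Subset n
  spread W R = W ∩ (R ∪ ⋃ (List.map (λ u → if lookup R u then tabulate (E G u) else ∅) (List.allFin n)))

  closure : ℕ → Subset n → Fin n → Subset n
  closure zero    W r = W ∩ ⁅ r ⁆
  closure (suc k) W r = spread W (closure k W r)

  ∈⋃ : (Xs : List (Subset n)) → ∀ {v} → v ∈ ⋃ Xs → Any (v ∈_) Xs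
  ∈⋃ []       h = ⊥-elim (∉⊥ h)
  ∈⋃ (X ∷ Xs) h = [ here , there ∘ ∈⋃ Xs ]′ (x∈p∪q⁻ X (⋃ Xs) h)

  closure-reach : ∀ k {W r v} → v ∈ closure k W r → Reach G (_∈ W) r v
  closure-reach zero {W} {r} h with x∈⁅y⁆⇒x≡y r (∩ʳ W ⁅ r ⁆ h)
  ... | refl = here (∩ˡ W ⁅ r ⁆ h)
  closure-reach (suc k) {W} {r} {v} h with x∈p∪q⁻ (closure k W r) _ (∩ʳ W (closure k W r ∪ _) h)
  ... | inj₁ h′ = closure-reach k h′
  ... | inj₂ h′ = go (satisfied (map⁻ {xs = List.allFin n} (∈⋃ _ h′)))
    where
    go : (∃ λ u → v ∈ (if lookup (closure k W r) u then tabulate (E G u) else ∅)) → Reach G (_∈ W) r v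
    go (u , h″) with lookup (closure k W r) u in eq
    ... | true  = reach-snoc G (closure-reach k (lookup⇒[]= u _ eq))
                    (trans (≡-sym (lookup∘tabulate (E G u) v)) ([]=⇒lookup h″)) (∩ˡ W (closure k W r ∪ _) h)
    ... | false = ⊥-elim (∉⊥ h″)

  -- A sufficient test for connectedness: one root reaches all of W within n rounds.
  Spanned : Subset n → Set
  Spanned W = ∃ λ r → W ⊆ closure n W r

  spanned? : ∀ W → Dec (Spanned W)
  spanned? W = any? λ r → W ⊆? closure n W r

  spanned⇒connected : ∀ {W} → Spanned W → Connected G (_∈ W)
  spanned⇒connected (r , h) = connected-via G r λ v v∈ → closure-reach n (h v∈)

  Good : Subset n → Set
  Good S = Independent G S × ∃ λ v → v ∉ S × (∀ w → w ∉ S → E G v w ≡ false) ×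
           (∃ λ u → u ∉ S × u ≢ v) × Spanned (∁ S - v)

  good? : ∀ S → Dec (Good S)
  good? S = (all? λ u → all? λ v → (u ∈? S) →-dec ((v ∈? S) →-dec (E G u v Bool.≟ false))) ×-dec
    any? λ v → ¬? (v ∈? S) ×-dec
    (all? (λ w → ¬? (w ∈? S) →-dec (E G v w Bool.≟ false)) ×-dec
    (any? (λ u → ¬? (u ∈? S) ×-dec ¬? (u ≟ v)) ×-dec spanned? (∁ S - v)))

  good⇒ : ∀ {S} → Good S → Independent G S × TwoComponentsOneTrivial G S
  good⇒ {S} (i , v , v∉ , iso , other , sp) = i , v , v∉ , iso , other , λ u w u∉ w∉ u≢v w≢v →
    reach-mono G (λ _ → minus⊆) (spanned⇒connected sp u w (∈-minus (x∉p⇒x∈∁p u∉) u≢v) (∈-minus (x∉p⇒x∈∁p w∉) w≢v))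

  Checked : Subset n → Set
  Checked S = (∣ S ∣ < 3 → Spanned (∁ S)) × (∣ S ∣ ≡ 3 → Spanned (∁ S) ⊎ Good S)

  checked? : ∀ S → Dec (Checked S)
  checked? S = ((∣ S ∣ <? 3) →-dec spanned? (∁ S)) ×-dec ((∣ S ∣ ≟ℕ 3) →-dec (spanned? (∁ S) ⊎-dec good? S))

  checked⇒internally4Connected : 4 < n → ¬ (∃ λ S → ¬ Checked S) → Internally4Connected G
  checked⇒internally4Connected 4<n ok =
    (≤-trans (n≤1+n 4) 4<n , λ X <3 → spanned⇒connected (proj₁ (all X) <3)) , 4<n ,
    λ S ≡3 ¬con → good⇒ ([ (λ sp → ⊥-elim (¬con (spanned⇒connected sp))) , id ]′ (proj₂ (all S) ≡3))
    where
    all : ∀ S → Checked S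
    all S = decidable-stable (checked? S) λ ¬c → ok (S , ¬c)

abstract
  -- Decided by evaluating the test on all 256 vertex sets; `abstract` keeps the result from being
  -- unfolded later.
  cube-internally4Connected : Internally4Connected cube
  cube-internally4Connected = checked⇒internally4Connected cube (s≤s (s≤s (s≤s (s≤s (s≤s z≤n)))))
    (from-no (anySubset? λ S → ¬? (checked? cube S)))

abstract
  two-more : {i j : Fin 4} → i ≢ j → ∃ λ k → ∃ λ l → (k ≢ i × k ≢ j) × (l ≢ i × l ≢ j) × k ≢ l
  two-more {i} {j} ne =
    let (k , _ , k≢) = fresh (i ∷ j ∷ []) ⊤ (s≤s (s≤s (s≤s z≤n)))
        (l , _ , l≢) = fresh (k ∷ i ∷ j ∷ []) ⊤ (s≤s (s≤s (s≤s (s≤s z≤n))))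
    in k , l , (All.head k≢ , All.head (All.tail k≢)) ,
       (All.head (All.tail l≢) , All.head (All.tail (All.tail l≢))) , All.head l≢ ∘ ≡-sym

  three-more : (i : Fin 4) → ∃ λ j → ∃ λ k → ∃ λ l → (j ≢ i × k ≢ i × l ≢ i) × (j ≢ k × j ≢ l × k ≢ l)
  three-more i =
    let (j , _ , j≢)                                 = fresh (i ∷ []) ⊤ (s≤s (s≤s z≤n))
        (k , l , (k≢j , k≢i) , (l≢j , l≢i) , k≢l) = two-more (All.head j≢)
    in j , k , l , (All.head j≢ , k≢i , l≢i) , (k≢j ∘ ≡-sym , l≢j ∘ ≡-sym , k≢l)

some-or-all : ∀ {k} {P Q : Fin k → Set} → (∀ i → P i ⊎ Q i) → ∃ P ⊎ (∀ i → Q i)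
some-or-all {zero}  h = inj₂ λ ()
some-or-all {suc k} h with h zero | some-or-all (h ∘ suc)
... | inj₁ p | _            = inj₁ (zero , p)
... | inj₂ _ | inj₁ (i , p) = inj₁ (suc i , p)
... | inj₂ q | inj₂ qs      = inj₂ λ { zero → q ; (suc i) → qs i }

module FromPieces {G : Graph n} {H : Graph m} (Piece : Fin m → Fin n → Set) (piece? : ∀ c u → Dec (Piece c u))
  (piece-unique : ∀ c d {u} → Piece c u → Piece d u → c ≡ d)
  (piece-connected : ∀ c → Connected G (Piece c)) (piece-inhabited : ∀ c → ∃ (Piece c))
  (piece-edge : ∀ c d → Adj H c d → ∃ λ u → ∃ λ w → Piece c u × Piece d w × Adj G u w) where

  private
    to : Fin n → Maybe (Fin m)
    to u with any? (λ c → piece? c u)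
    ... | yes (c , _) = just c
    ... | no _        = nothing

  to⁺ : ∀ {u c} → Piece c u → to u ≡ just c
  to⁺ {u} {c} h with any? (λ c → piece? c u)
  ... | yes (d , k) = cong just (piece-unique d c k h)
  ... | no ¬k       = ⊥-elim (¬k (c , h))

  to⁻ : ∀ {u c} → to u ≡ just c → Piece c u
  to⁻ {u} e with any? (λ c → piece? c u)
  to⁻ refl | yes (d , k) = k
  to⁻ ()   | no _

  φ : MinorMap G H
  φ = record
    { f = to
    ; surj = λ c → let (u , h) = piece-inhabited c in u , to⁺ h
    ; branchConnected = λ c → connected-resp G (λ _ → to⁺) (λ _ → to⁻) (piece-connected c)
    ; edges = λ c d a → let (u , w , h , k , b) = piece-edge c d a in u , w , to⁺ h , to⁺ k , b
    }

-- The cube minor of a tetrahedron and its lift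

module CubeMinor {G : Graph n} {τ : OSeps n} (T : Tangle G 4 τ) (con : TangleConnected T 3)
                 (Θ : Corners.Tetrahedron T con) where
  open Separations G
  open Corners.Tetrahedron Θ

  private
    t : ∀ i → τ (A i) (B i)
    t i = proj₁ (max i)

    v∈A : ∀ {i j} → i ≢ j → v j ∈ A i
    v∈A {i} {j} ne = ∩ˡ (A i) (B i) (corner∈ i j ne)

    v∈B : ∀ {i j} → i ≢ j → v j ∈ B i
    v∈B {i} {j} ne = ∩ʳ (A i) (B i) (corner∈ i j ne)

    v-injective : ∀ {i j} → v i ≡ v j → i ≡ j
    v-injective {i} {j} e = decidable-stable (i ≟ j) λ ne → corner∉ i (subst (_∈ A i) (≡-sym e) (v∈A ne))

    C : ∀ i → Component G (_∉ B i) (proj₁ (inner i))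
    C i = component G (λ u → ¬? (u ∈? B i)) (proj₁ (inner i)) (proj₂ (inner i))

    K : Fin 4 → Subset n
    K i = Component.K (C i)

    K∉B : ∀ {i u} → u ∈ K i → u ∉ B i
    K∉B {i} = Component.within (C i) _

    K⊆A : ∀ {i u} → u ∈ K i → u ∈ A i
    K⊆A {i} h = sep-∉ʳ (τ-sep T (t i)) (K∉B h)

    joined : ∀ {i j} → i ≢ j → ∃ λ u → u ∈ K i × Adj G u (v j)
    joined {i} {j} ne = attached T (t i) (weaken T (≤-pred (τ-order T (t i))) con) (C i) (v j) (corner∈ i j ne)

    v≢ : ∀ {i j} → i ≢ j → v i ≢ v j
    v≢ ne = ne ∘ v-injective

    K≢v : ∀ {i j u} → i ≢ j → u ∈ K i → u ≢ v j
    K≢v ne h refl = K∉B h (v∈B ne)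

    -- A i and A j share two corners, hence nothing else.
    K∩A : ∀ {i j u} → i ≢ j → u ∈ K i → u ∉ A j
    K∩A {i} {j} {u} ne u∈ u∈′ = let (k , l , (k≢i , k≢j) , (l≢i , l≢j) , k≢l) = two-more ne in contradiction
      (≤-trans (distinct⇒≤ (u ∷ v k ∷ v l ∷ []) (A i ∩ A j)
        ((K≢v (k≢i ∘ ≡-sym) u∈ ∷ K≢v (l≢i ∘ ≡-sym) u∈ ∷ []) ∷ (v≢ k≢l ∷ []) ∷ [] ∷ [])
        (∈∩ (K⊆A u∈) u∈′ ∷ ∈∩ (v∈A (k≢i ∘ ≡-sym)) (v∈A (k≢j ∘ ≡-sym)) ∷ ∈∩ (v∈A (l≢i ∘ ≡-sym)) (v∈A (l≢j ∘ ≡-sym)) ∷ []))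
        (meet i j ne)) λ { (s≤s (s≤s ())) }

    Piece : Fin 4 ⊎ Fin 4 → Fin n → Set
    Piece (inj₁ i) u = u ≡ v i
    Piece (inj₂ i) u = u ∈ K i

    v∉K : ∀ i j → v i ∉ K j
    v∉K i j h with i ≟ j
    ... | yes refl = corner∉ i (K⊆A h)
    ... | no ne    = K∉B h (v∈B (ne ∘ ≡-sym))

    K-disjoint : ∀ {i j u} → u ∈ K i → u ∈ K j → i ≡ j
    K-disjoint {i} {j} h k = decidable-stable (i ≟ j) λ ne → K∩A ne h (K⊆A k)

    piece-unique : ∀ p q {u} → Piece p u → Piece q u → p ≡ q
    piece-unique (inj₁ i) (inj₁ j) e e′ = cong inj₁ (v-injective (trans (≡-sym e) e′))
    piece-unique (inj₁ i) (inj₂ j) refl h = ⊥-elim (v∉K i j h)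
    piece-unique (inj₂ i) (inj₁ j) h refl = ⊥-elim (v∉K j i h)
    piece-unique (inj₂ i) (inj₂ j) h h′ = cong inj₂ (K-disjoint h h′)

    piece? : ∀ p u → Dec (Piece p u)
    piece? (inj₁ i) u = u ≟ v i
    piece? (inj₂ i) u = u ∈? K i

    piece-connected : ∀ p → Connected G (Piece p)
    piece-connected (inj₁ i) u w refl refl = here refl
    piece-connected (inj₂ i) = Component.connected (C i)

    piece-inhabited : ∀ p → ∃ (Piece p)
    piece-inhabited (inj₁ i) = v i , refl
    piece-inhabited (inj₂ i) = _ , Component.root (C i)

    piece-edge : ∀ p q → CubeEdge p q → ∃ λ u → ∃ λ w → Piece p u × Piece q w × Adj G u w
    piece-edge (inj₁ i) (inj₂ j) ne = let (u , u∈ , a) = joined (ne ∘ ≡-sym) in v i , u , refl , u∈ , adj-sym G a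
    piece-edge (inj₂ i) (inj₁ j) ne = let (u , u∈ , a) = joined ne in u , v j , u∈ , refl , a

    splitAt-injective : ∀ {c d : Fin 8} → splitAt 4 c ≡ splitAt 4 d → c ≡ d
    splitAt-injective {c} {d} e = trans (≡-sym (join-splitAt 4 4 c)) (trans (cong (join 4 4) e) (join-splitAt 4 4 d))

  open FromPieces {G = G} {H = cube} (λ c → Piece (splitAt 4 c)) (λ c → piece? (splitAt 4 c))
    (λ c d h k → splitAt-injective (piece-unique (splitAt 4 c) (splitAt 4 d) h k))
    (λ c → piece-connected (splitAt 4 c)) (λ c → piece-inhabited (splitAt 4 c))
    (λ c d a → piece-edge (splitAt 4 c) (splitAt 4 d) (cube-adj c d a)) public

  private
    at : Fin 4 ⊎ Fin 4 → Fin 8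
    at = join 4 4

    hit-piece : ∀ {X Y} → IsImage φ X Y → ∀ p → at p ∈ Y → ∃ λ u → Piece p u × u ∈ X
    hit-piece i p ∈Y = let (u , u∈ , e) = proj₁ (i (at p)) ∈Y in u , subst (λ q → Piece q u) (splitAt-join 4 4 p) (to⁻ e) , u∈

    at-injective : ∀ {p q} → at p ≡ at q → p ≡ q
    at-injective {p} {q} e = trans (≡-sym (splitAt-join 4 4 p)) (trans (cong (splitAt 4) e) (splitAt-join 4 4 q))

    module _ {X X′ : Subset n} {Y : Subset 8} (x : τ X X′) (iX : IsImage φ X Y)
             (one : ∀ p q → at p ∉ Y → at q ∉ Y → p ≡ q) where

      hit-v : ∀ i → at (inj₁ i) ∈ Y → v i ∈ X
      hit-v i h = let (u , e , u∈) = hit-piece iX (inj₁ i) h in subst (_∈ X) e u∈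

      -- The set `A i` misses both the corner `v i` and every `K j` with j ≢ i, which makes two
      -- missed branch sets.
      not-inside : ∀ i → ¬ (∀ u → u ∈ X → u ∈ A i)
      not-inside i X⊆ = let (j , _ , _ , (j≢i , _) , _) = three-more i in
        contradiction (one (inj₁ i) (inj₂ j) (λ h → corner∉ i (X⊆ _ (hit-v i h)))
          (λ h → let (u , k , u∈) = hit-piece iX (inj₂ j) h in K∩A j≢i k (X⊆ u u∈))) λ ()

      module _ (meets≤2 : ∀ i → ∣ A i ∩ X ∣ ≤ 2) where

        three : ∀ i a b c → a ≢ b → a ≢ c → b ≢ c → a ∈ A i → b ∈ A i → c ∈ A i → a ∈ X → b ∈ X → c ∈ X → ⊥
        three i a b c p q r a∈ b∈ c∈ a∈X b∈X c∈X = contradiction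
          (≤-trans (distinct⇒≤ (a ∷ b ∷ c ∷ []) (A i ∩ X) ((p ∷ q ∷ []) ∷ (r ∷ []) ∷ [] ∷ [])
            (∈∩ a∈ a∈X ∷ ∈∩ b∈ b∈X ∷ ∈∩ c∈ c∈X ∷ [])) (meets≤2 i)) λ { (s≤s (s≤s ())) }

        -- If X contains all four corners, it shares three of them with `A zero`. If it misses
        -- `v i`, it meets all other branch sets, and for j ≢ i it shares with `A j` a vertex of
        -- `K j` and two corners.
        not-transversal : Dec (∃ λ i → at (inj₁ i) ∉ Y) → ⊥
        not-transversal (no all) =
          let (j , k , l , (j≢ , k≢ , l≢) , (j≢k , j≢l , k≢l)) = three-more zero in
          three zero (v j) (v k) (v l) (v≢ j≢k) (v≢ j≢l) (v≢ k≢l) (v∈A (j≢ ∘ ≡-sym)) (v∈A (k≢ ∘ ≡-sym)) (v∈A (l≢ ∘ ≡-sym))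
            (v∈X j) (v∈X k) (v∈X l)
          where
          v∈X : ∀ i → v i ∈ X
          v∈X i = hit-v i (decidable-stable (at (inj₁ i) ∈? Y) λ ∉Y → all (i , ∉Y))
        not-transversal (yes (i , ∉Y)) =
          let (j , k , l , (j≢ , k≢ , l≢) , (j≢k , j≢l , k≢l)) = three-more i
              (u , u∈K , u∈X) = hit-piece iX (inj₂ j) (hit (inj₂ j) λ ())
          in three j u (v k) (v l) (K≢v j≢k u∈K) (K≢v j≢l u∈K) (v≢ k≢l) (K⊆A u∈K) (v∈A j≢k) (v∈A j≢l)
               u∈X (v∈X k k≢) (v∈X l l≢)
          where
          hit : ∀ p → p ≢ inj₁ i → at p ∈ Y
          hit p ne = decidable-stable (at p ∈? Y) λ ∉Y′ → ne (one p (inj₁ i) ∉Y′ ∉Y)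
          v∈X : ∀ m → m ≢ i → v m ∈ X
          v∈X m ne = hit-v m (hit (inj₁ m) (ne ∘ inj₁-injective))

      -- X lies in some A i or meets every A i in at most two vertices,
      -- so it misses at least two branch sets.
      misses-two : ⊥
      misses-two = [ (λ (i , X⊆) → not-inside i X⊆) , (λ ≤2 → not-transversal ≤2 (any? λ i → ¬? (at (inj₁ i) ∈? Y))) ]′
        (some-or-all λ i → Sum.map₁ (λ X⊆ u u∈ → X⊆ u∈) (crossing T con (t i) (proj₂ (max i)) x))

  open UniqueTangle cube-internally4Connected

  cube-lift : Lift φ 4 σ ≐ τ
  cube-lift = lift-≐ φ T σ-tangle λ X X′ Y Y′ x iX iX′ →
    [ id , (λ { (s , o , le) → ⊥-elim (misses-two x iX λ p q p∉ q∉ → at-injective (one s le (at p) (at q) p∉ q∉)) }) ]′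
    (Tangle.complete σ-tangle Y Y′ (image-sep φ (τ-sep T x) iX iX′) (≤-trans (s≤s (image-order φ (τ-sep T x) iX iX′)) (τ-order T x)))
    where
    one : ∀ {Y Y′} → IsSeparation cube Y′ Y → ∣ Y′ ∩ ∁ Y ∣ ≤ 1 → ∀ c d → c ∉ Y → d ∉ Y → c ≡ d
    one {Y} {Y′} s le c d c∉ d∉ = decidable-stable (c ≟ d) λ ne → contradiction
      (≤-trans (distinct⇒≤ (c ∷ d ∷ []) (Y′ ∩ ∁ Y) ((ne ∷ []) ∷ [] ∷ [])
        (∈∩ (Separations.sep-∉ʳ cube s c∉) (x∉p⇒x∈∁p c∉) ∷ ∈∩ (Separations.sep-∉ʳ cube s d∉) (x∉p⇒x∈∁p d∉) ∷ [])) le)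
      λ { (s≤s ()) }

  represented-by-cube : Σ ℕ λ m → Σ (Graph m) λ H → Internally4Connected H ×
    Σ (MinorMap G H) λ φ → Σ (OSeps m) λ σ → Tangle H 4 σ × (Lift φ 4 σ ≐ τ)
  represented-by-cube = 8 , cube , cube-internally4Connected , φ , σ , σ-tangle , cube-lift

-- Reduction to an internally 4-connected minor

module _ (G : Graph n) where
  open Separations G

  component-sep : ∀ {X a} (C : Component G (Del X) a) → IsSeparation G (Component.K C ∪ X) (∁ (Component.K C))
  component-sep {X} C = mkSep cov λ u v _ u∉ v∈ v∉ a → edge u v (x∉∁p⇒x∈p u∉) v∉ a
    where
    open Component C
    cov : ∀ v → v ∈ K ∪ X ⊎ v ∈ ∁ K
    cov v with v ∈? K
    ... | yes h = inj₁ (∈∪ˡ h)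
    ... | no h  = inj₂ (x∉p⇒x∈∁p h)
    edge : ∀ u v → u ∈ K → v ∉ K ∪ X → ¬ Adj G u v
    edge u v u∈ v∉ a = v∉ (∈∪ˡ (closed u v u∈ (x∉p⇒x∈∁p (v∉ ∘ ∈∪ʳ)) a))

  component-order : ∀ {X a} (C : Component G (Del X) a) → order (Component.K C ∪ X) (∁ (Component.K C)) ≤ ∣ X ∣
  component-order {X} C = ⊆-card λ v h → [ (λ k → ⊥-elim (x∈∁p⇒x∉p (∩ʳ (K ∪ X) (∁ K) h) k)) , id ]′
    (x∈p∪q⁻ K X (∩ˡ (K ∪ X) (∁ K) h))
    where open Component C

  del? : (X : Subset n) → ∀ v → Dec (Del X v)
  del? X v = v ∈? ∁ X

two-extra : ∀ {S P : Subset n} {u w} → S ⊆ P → u ∈ P → w ∈ P → u ∉ S → w ∉ S → u ≢ w → 2 + ∣ S ∣ ≤ ∣ P ∣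
two-extra {S = S} {P} {u} {w} S⊆P u∈ w∈ u∉ w∉ u≢w = ≤-trans (s≤s (≤-trans
  (s≤s (⊆-card {X = S} {P - u - w} λ v h → ∈-minus (∈-minus (S⊆P h) λ { refl → u∉ h }) λ { refl → w∉ h }))
  (x∈p⇒∣p-x∣<∣p∣ {p = P - u} (∈-minus w∈ (u≢w ∘ ≡-sym))))) (x∈p⇒∣p-x∣<∣p∣ {p = P} u∈)

module _ {G : Graph n} {τ : OSeps n} (T : Tangle G 4 τ) where
  open Separations G

  -- At most three vertices would form a small side themselves. With four, deleting any one vertex
  -- leaves a small side, and three such sides cover G, because every edge avoids one of three given
  -- vertices.
  more-than-four : 4 < n
  more-than-four with 4 <? n
  ... | yes h = h
  ... | no ¬h with ∣ ⊤ {n} ∣ ≤? 3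
  ...   | yes ≤3 = ⊥-elim (not-full T (few-small T ⊤ ≤3) λ v → ∈⊤)
  ...   | no >3 = ⊥-elim (go (fresh [] ⊤ (≤-trans (s≤s z≤n) (≰⇒> >3))))
    where
    small : ∀ a → τ (⊤ - a) ⊤
    small a = few-small T (⊤ - a) (≤-pred (≤-trans (x∈p⇒∣p-x∣<∣p∣ (∈⊤ {x = a})) ∣⊤∣≤4))
      where
      ∣⊤∣≤4 : ∣ ⊤ {n} ∣ ≤ 4
      ∣⊤∣≤4 = ≤-trans (≤-reflexive (∣⊤∣≡n n)) (≮⇒≥ ¬h)
    go : ¬ (∃ λ a → a ∈ ⊤ {n} × All (a ≢_) [])
    go (a , _) with fresh (a ∷ []) ⊤ (≤-trans (s≤s (s≤s z≤n)) (≰⇒> >3))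
    ... | b , _ , b≢a ∷ [] with fresh (a ∷ b ∷ []) ⊤ (≤-trans (s≤s (s≤s (s≤s z≤n))) (≰⇒> >3))
    ...   | c , _ , c≢a ∷ c≢b ∷ [] = Tangle.noCover T _ _ _ _ _ _ (small a) (small b) (small c)
            ((λ v → Sum.map proj₁ (Sum.map proj₁ proj₁) (avoid v v)) , λ u v _ → avoid u v)
      where
      X : Subset n
      X = ⁅ a ⁆ ∪ (⁅ b ⁆ ∪ ⁅ c ⁆)
      avoid : ∀ u v → (u ∈ ⊤ - a × v ∈ ⊤ - a) ⊎ (u ∈ ⊤ - b × v ∈ ⊤ - b) ⊎ (u ∈ ⊤ - c × v ∈ ⊤ - c)
      avoid u v with fresh (u ∷ v ∷ []) X (distinct⇒≤ (a ∷ b ∷ c ∷ []) X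
        ((b≢a ∘ ≡-sym ∷ c≢a ∘ ≡-sym ∷ []) ∷ (c≢b ∘ ≡-sym ∷ []) ∷ [] ∷ [])
        (∈∪ˡ (x∈⁅x⁆ a) ∷ ∈∪ʳ (∈∪ˡ (x∈⁅x⁆ b)) ∷ ∈∪ʳ (∈∪ʳ (x∈⁅x⁆ c)) ∷ []))
      ... | i , i∈ , i≢u ∷ i≢v ∷ [] = Sum.map (to a) (Sum.map (to b) (to c) ∘ x∈p∪q⁻ ⁅ b ⁆ ⁅ c ⁆) (x∈p∪q⁻ ⁅ a ⁆ (⁅ b ⁆ ∪ ⁅ c ⁆) i∈)
        where
        to : ∀ d → i ∈ ⁅ d ⁆ → u ∈ ⊤ - d × v ∈ ⊤ - d
        to d h with x∈⁅y⁆⇒x≡y d h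
        ... | refl = ∈-minus ∈⊤ (i≢u ∘ ≡-sym) , ∈-minus ∈⊤ (i≢v ∘ ≡-sym)

  module _ (con : TangleConnected T 3) where

    -- If X separates u from v, the component K of u yields a separation with interior vertices on
    -- both sides, u on one and v on the other. Either orientation contradicts `con`.
    three-connected : KConnected 3 G
    three-connected = ≤-trans (n≤1+n 4) more-than-four , λ X <3 u v u∈ v∈ →
      decidable-stable (reach? G (del? G X) u v) λ ¬r →
        let C = component G (del? G X) u u∈
            open Component C
            o = ≤-trans (s≤s (component-order G C)) <3
            v∉K = λ h → ¬r (reach v h)
        in [ (λ t → x∈∁p⇒x∉p (con _ _ t o (∈∪ˡ root)) root)
           , (λ t → [ v∉K , x∈∁p⇒x∉p v∈ ]′ (x∈p∪q⁻ K X (con _ _ t (subst (_< 3) (order-sym (K ∪ X) (∁ K)) o) (x∉p⇒x∈∁p v∉K)))) ]′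
           (Tangle.complete T (K ∪ X) (∁ K) (component-sep G C) (≤-trans o (n≤1+n 3)))

    -- Every element of τ with nonempty interior is a claw whose leaves are its separator.
    module _ (≤4 : ∀ A B → τ A B → ∣ A ∣ ≤ 4)
             (independent : ∀ A B → τ A B → 4 ≤ ∣ A ∣ → Independent G (A ∩ B)) where

      module _ (S : Subset n) (≡3 : ∣ S ∣ ≡ 3) where

        private
          no-two : ∀ {P P′ u w} → τ P P′ → S ⊆ P → u ∈ P → w ∈ P → u ∉ S → w ∉ S → u ≡ w
          no-two {u = u} {w} t S⊆ u∈ w∈ u∉ w∉ = decidable-stable (u ≟ w) λ ne → contradiction
            (≤-trans (subst (λ k → 2 + k ≤ _) ≡3 (two-extra S⊆ u∈ w∈ u∉ w∉ ne)) (≤4 _ _ t)) (<-irrefl refl)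

          at-least-4 : ∀ {P : Subset n} {u} → S ⊆ P → u ∈ P → u ∉ S → 4 ≤ ∣ P ∣
          at-least-4 {P} {u} S⊆ u∈ u∉ = ≤-trans (s≤s (≤-trans (≤-reflexive (≡-sym ≡3))
            (⊆-card {X = S} {P - u} λ v h → ∈-minus (S⊆ h) λ { refl → u∉ h }))) (x∈p⇒∣p-x∣<∣p∣ {p = P} u∈)

          -- The set P is a small side whose only vertex beyond S is c. It is kept so that it can be
          -- united with a further small component.
          record Leaf : Set where
            field
              c     : Fin n
              c∉    : c ∉ S
              P P′  : Subset n
              small : τ P P′
              c∈P   : c ∈ P
              c∉P′  : c ∉ P′
              S⊆P   : S ⊆ P
              S⊆P′  : S ⊆ P′
              iso   : ∀ w → w ∉ S → ¬ Adj G c w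
              u     : Fin n
              u∉    : u ∉ S
              u≢c   : u ≢ c

          oriented : ∀ {p} (C : Component G (Del S) p) → let open Component C in τ (K ∪ S) (∁ K) ⊎ τ (∁ K) (K ∪ S)
          oriented C = Tangle.complete T _ _ (component-sep G C) (s≤s (≤-trans (component-order G C) (≤-reflexive ≡3)))

          S⊆∁K : ∀ {p} (C : Component G (Del S) p) → S ⊆ ∁ (Component.K C)
          S⊆∁K C h = x∉p⇒x∈∁p λ k → x∈∁p⇒x∉p (Component.within C _ k) h

          -- Whichever side of the separation at K is small, it contains S and, having at most four
          -- vertices, only one vertex more.
          leaf : ∀ {p q} → p ∉ S → q ∉ S → ¬ Reach G (Del S) p q → Leaf
          leaf {p} {q} p∉ q∉ ¬r = go (oriented C)
            where
            C : Component G (Del S) p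
            C = component G (del? G S) p (x∉p⇒x∈∁p p∉)
            open Component C
            q∉K : q ∉ K
            q∉K h = ¬r (reach q h)
            p≢q : p ≢ q
            p≢q refl = q∉K root
            go : τ (K ∪ S) (∁ K) ⊎ τ (∁ K) (K ∪ S) → Leaf
            go (inj₁ t) = record
              { c = p ; c∉ = p∉ ; P = K ∪ S ; P′ = ∁ K ; small = t ; c∈P = ∈∪ˡ root
              ; c∉P′ = λ h → x∈∁p⇒x∉p h root ; S⊆P = ∈∪ʳ ; S⊆P′ = S⊆∁K C
              ; iso = λ w w∉ a → adj-irrefl G a (no-two t ∈∪ʳ (∈∪ˡ root) (∈∪ˡ (closed p w root (x∉p⇒x∈∁p w∉) a)) p∉ w∉)
              ; u = q ; u∉ = q∉ ; u≢c = p≢q ∘ ≡-sym }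
            go (inj₂ t) = record
              { c = q ; c∉ = q∉ ; P = ∁ K ; P′ = K ∪ S ; small = t ; c∈P = x∉p⇒x∈∁p q∉K
              ; c∉P′ = λ h → [ q∉K , q∉ ]′ (x∈p∪q⁻ K S h) ; S⊆P = S⊆∁K C ; S⊆P′ = ∈∪ʳ
              ; iso = λ w w∉ a → adj-irrefl G a (no-two t (S⊆∁K C) (x∉p⇒x∈∁p q∉K)
                  (x∉p⇒x∈∁p λ k → q∉K (closed w q k (x∉p⇒x∈∁p q∉) (adj-sym G a))) q∉ w∉)
              ; u = p ; u∉ = p∉ ; u≢c = p≢q }

          -- Let K be the component of p, and suppose that it misses q. If its complement were
          -- small, that side would contain q and c beyond S. If `K ∪ S` is small, its union with P
          -- contains p and c beyond S. Both exceed four vertices.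
          rest-connected : (L : Leaf) → ∀ p q → p ∉ S → q ∉ S → p ≢ Leaf.c L → q ≢ Leaf.c L → Reach G (Del S) p q
          rest-connected L p q p∉ q∉ p≢c q≢c = decidable-stable (reach? G (del? G S) p q) λ ¬r →
            let C = component G (del? G S) p (x∉p⇒x∈∁p p∉) in absurd C ¬r (oriented C)
            where
            open Leaf L
            absurd : (C : Component G (Del S) p) → ¬ Reach G (Del S) p q →
                     τ (Component.K C ∪ S) (∁ (Component.K C)) ⊎ τ (∁ (Component.K C)) (Component.K C ∪ S) → ⊥
            absurd C ¬r (inj₂ t) = q≢c (no-two t (S⊆∁K C) (x∉p⇒x∈∁p λ h → ¬r (Component.reach C q h)) (x∉p⇒x∈∁p c∉K) q∉ c∉)
              where
              c∉K : c ∉ Component.K C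
              c∉K h with reach-sym G (Component.reach C c h)
              ... | here _     = p≢c refl
              ... | step _ a r = iso _ (x∈∁p⇒x∉p (reach-start G r)) a
            absurd C ¬r (inj₁ t) = p≢c (no-two union (∈∪ˡ ∘ S⊆P) (∈∪ʳ (∈∪ˡ root)) (∈∪ˡ c∈P) p∉ c∉)
              where
              open Component C
              -- The separator of the union stays within S, since c is the only vertex of P beyond S
              -- and is not in P′.
              union : τ (P ∪ (K ∪ S)) (P′ ∩ ∁ K)
              union = τ-union T small t (s≤s (≤-trans (⊆-card sub) (≤-reflexive ≡3)))
                where
                sub : ∀ v → v ∈ (P ∪ (K ∪ S)) ∩ (P′ ∩ ∁ K) → v ∈ S
                sub v h with x∈p∪q⁻ P (K ∪ S) (∩ˡ (P ∪ (K ∪ S)) (P′ ∩ ∁ K) h) | ∩ʳ (P ∪ (K ∪ S)) (P′ ∩ ∁ K) h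
                ... | inj₁ k | l = decidable-stable (v ∈? S) λ v∉ →
                  c∉P′ (subst (_∈ P′) (no-two small S⊆P k c∈P v∉ c∉) (∩ˡ P′ (∁ K) l))
                ... | inj₂ k | l = [ (λ m → ⊥-elim (x∈∁p⇒x∉p (∩ʳ P′ (∁ K) l) m)) , id ]′ (x∈p∪q⁻ K S k)

        separator-good : ¬ Connected G (Del S) → Independent G S × TwoComponentsOneTrivial G S
        separator-good ¬con with any? (λ p → any? λ q → del? G S p ×-dec (del? G S q ×-dec ¬? (reach? G (del? G S) p q)))
        ... | no ¬h = ⊥-elim (¬con λ p q p∈ q∈ → decidable-stable (reach? G (del? G S) p q) λ ¬r → ¬h (p , q , p∈ , q∈ , ¬r))
        ... | yes (p , q , p∈ , q∈ , ¬r) =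
          (λ s t s∈ t∈ → independent P P′ small (at-least-4 S⊆P c∈P c∉) s t (∈∩ (S⊆P s∈) (S⊆P′ s∈)) (∈∩ (S⊆P t∈) (S⊆P′ t∈))) ,
          c , c∉ , (λ w w∉ → ¬adj⇒false G (iso w w∉)) , (u , u∉ , u≢c) , rest-connected L
          where
          L : Leaf
          L = leaf (x∈∁p⇒x∉p p∈) (x∈∁p⇒x∉p q∈) ¬r
          open Leaf L

      internally4Connected : Internally4Connected G
      internally4Connected = three-connected , more-than-four , λ S ≡3 → separator-good S ≡3

module _ {n} {G : Graph n} {τ : OSeps n} (T : Tangle G 4 τ) where

  Represented : Set₁
  Represented = Σ ℕ λ m → Σ (Graph m) λ H → Internally4Connected H ×
    Σ (MinorMap G H) λ φ → Σ (OSeps m) λ σ → Tangle H 4 σ × (Lift φ 4 σ ≐ τ)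

  Reduced : Set₁
  Reduced = Σ ℕ λ m → m < n × Σ (Graph m) λ H →
    Σ (MinorMap G H) λ φ → Σ (OSeps m) λ σ → Tangle H 4 σ × (Lift φ 4 σ ≐ τ)

  torso-reduction : ∀ {A B a} → τ A B → Retraction G A B → ¬ HasFourCover G τ A B → a ∉ B → Reduced
  torso-reduction {A} {B} {a} t ρ no4 a∉ = ∣ B ∣ ,
    ≤-trans (p⊂q⇒∣p∣<∣q∣ {q = ⊤} (⊆⊤ , a , ∈⊤ , a∉)) (≤-reflexive (∣⊤∣≡n n)) ,
    H , φ , σ , σ-tangle no4 , σ-lift no4
    where open TorsoReduction T t ρ

  nontrivial? : ∀ k → Dec (∃ λ A → ∃ λ B → τ A B × order A B < k × (∃ λ a → a ∈ A × a ∉ B))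
  nontrivial? k = anySubset? λ A → anySubset? λ B → τ? T A B ×-dec ((order A B <? k) ×-dec
    any? λ a → (a ∈? A) ×-dec ¬? (a ∈? B))

  trivial⇒connected : ∀ {k} → ¬ (∃ λ A → ∃ λ B → τ A B × order A B < k × (∃ λ a → a ∈ A × a ∉ B)) → TangleConnected T k
  trivial⇒connected ¬h A B t o {a} a∈ = decidable-stable (a ∈? B) λ a∉ → ¬h (A , B , t , o , a , a∈ , a∉)

  -- One component of A ∖ B is contracted onto x; the roots y and z are joined by an edge or equal.
  component-triangle : ∀ {A B a x y z} → τ A B → TangleConnected T (order A B) → a ∉ B →
    x ∈ A ∩ B → y ∈ A ∩ B → z ∈ A ∩ B → (y ≢ z → Adj G y z) → RootedTriangle G B x y z
  component-triangle {B = B} {a} {x} {y} {z} t con a∉ x∈ y∈ z∈ yz = record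
    { X = K ; Y = ∅ ; Z = ∅ ; bX = component-branch G C (att x x∈) ; bY = empty-branch G ; bZ = empty-branch G
    ; X#Y = λ v _ → ∉⊥ ; X#Z = λ v _ → ∉⊥ ; Y#Z = λ v _ → ∉⊥
    ; X~Y = let (u , u∈ , e) = att y y∈ in u , y , inj₂ u∈ , inj₁ refl , e
    ; X~Z = let (u , u∈ , e) = att z z∈ in u , z , inj₂ u∈ , inj₁ refl , e
    ; Y~Z = λ ne → y , z , inj₁ refl , inj₁ refl , yz ne }
    where
    C : Component G (_∉ B) a
    C = component G (λ v → ¬? (v ∈? B)) a a∉
    open Component C
    att = attached T t con C

  module _ (con : TangleConnected T 3) where

    -- The elements of τ with nonempty interior that are not claws with independent leaves.
    Thick : Subset n → Subset n → Set
    Thick A B = τ A B × 4 ≤ ∣ A ∣ × (5 ≤ ∣ A ∣ ⊎ (∃ λ u → ∃ λ v → u ∈ A ∩ B × v ∈ A ∩ B × Adj G u v))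

    thick? : ∀ A B → Dec (Thick A B)
    thick? A B = τ? T A B ×-dec ((4 ≤? ∣ A ∣) ×-dec ((5 ≤? ∣ A ∣) ⊎-dec
      any? λ u → any? λ v → (u ∈? A ∩ B) ×-dec ((v ∈? A ∩ B) ×-dec adj? G u v)))

    -- A maximal extension with at least five vertices is thick by its size. One with at most four
    -- has no more vertices than A, so A was maximal already.
    maximal-thick : ∀ {A B} → Thick A B → ∃ λ A′ → ∃ λ B′ → Maximal T A′ B′ × Thick A′ B′
    maximal-thick {A} {B} th@(t , ≥4 , _) with extend-max T t
    ... | A′ , B′ , m , A⊆A′ with 5 ≤? ∣ A′ ∣
    ...   | yes ≥5 = A′ , B′ , m , proj₁ m , ≤-trans (n≤1+n 4) ≥5 , inj₁ ≥5
    ...   | no <5  = A , B , (t , λ E F r A⊆E e → A′⊆A (proj₂ m E F r (A⊆E ∘ A′⊆A) e)) , th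
      where
      A′⊆A : A′ ⊆ A
      A′⊆A = ⊆∧∣∣≥⇒⊇ A⊆A′ (≤-trans (≤-pred (≰⇒> <5)) ≥4)

    hasFourCover? : ∀ A B → Dec (HasFourCover G τ A B)
    hasFourCover? A B = anySubset? λ P → anySubset? λ P′ → anySubset? λ Q → anySubset? λ Q′ → anySubset? λ R → anySubset? λ R′ →
      τ? T P P′ ×-dec (τ? T Q Q′ ×-dec (τ? T R R′ ×-dec
      (all? (λ v → (v ∈? A) ⊎-dec ((v ∈? P) ⊎-dec ((v ∈? Q) ⊎-dec (v ∈? R)))) ×-dec
      (all? (λ u → all? λ v → adj? G u v →-dec (both? u v A ⊎-dec (both? u v P ⊎-dec (both? u v Q ⊎-dec both? u v R)))) ×-dec
      all? (λ s → all? λ t → (s ∈? A ∩ B) →-dec ((t ∈? A ∩ B) →-dec (both? s t P ⊎-dec (both? s t Q ⊎-dec both? s t R))))))))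
      where
      both? : ∀ u v X → Dec (u ∈ X × v ∈ X)
      both? u v X = (u ∈? X) ×-dec (v ∈? X)

    module _ {A B : Subset n} (m : Maximal T A B) (th : Thick A B) where

      private
        t : τ A B
        t = proj₁ m
        ≥3 : 3 ≤ ∣ A ∩ B ∣
        ≥3 = ≮⇒≥ λ <3 → contradiction (≤-trans (proj₁ (proj₂ th)) (≤-trans (⊆-card λ v h → ∈∩ h (con A B t <3 h)) (≤-pred <3)))
          λ { (s≤s (s≤s ())) }
        ≤3 : ∣ A ∩ B ∣ ≤ 3
        ≤3 = ≤-pred (τ-order T t)
        con′ : TangleConnected T (order A B)
        con′ = weaken T ≤3 con
        ∣A∣≤ : ∣ A ∣ ≤ 3 + ∣ A ∩ ∁ B ∣
        ∣A∣≤ = ≤-trans (⊆-card {Y = (A ∩ B) ∪ (A ∩ ∁ B)} λ v h → cov v h) (≤-trans (∣∪∣≤ (A ∩ B) (A ∩ ∁ B)) (+-monoˡ-≤ _ ≤3))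
          where
          cov : ∀ v → v ∈ A → v ∈ (A ∩ B) ∪ (A ∩ ∁ B)
          cov v h with v ∈? B
          ... | yes k = ∈∪ˡ (∈∩ h k)
          ... | no k  = ∈∪ʳ (∈∩ h (x∉p⇒x∈∁p k))
        inner : ∃ λ a → a ∈ A ∩ ∁ B
        inner = pick (A ∩ ∁ B) (+-cancelˡ-≤ 3 _ _ (≤-trans (proj₁ (proj₂ th)) ∣A∣≤))
        a : Fin n
        a = proj₁ inner
        a∉ : a ∉ B
        a∉ = x∈∁p⇒x∉p (∩ʳ A (∁ B) (proj₂ inner))

        exhaust : ∀ {x y z} → x ∈ A ∩ B → y ∈ A ∩ B → z ∈ A ∩ B → x ≢ y → x ≢ z → y ≢ z →
                  ∀ s → s ∈ A ∩ B → s ≡ x ⊎ s ≡ y ⊎ s ≡ z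
        exhaust x∈ y∈ z∈ x≢y x≢z y≢z = exhausted₃ {X = A ∩ B} x≢y x≢z y≢z x∈ y∈ z∈ ≤3

      thick-step : Represented ⊎ Reduced
      thick-step with fresh [] (A ∩ B) (≤-trans (s≤s z≤n) ≥3)
      ... | x , x∈ , _ with fresh (x ∷ []) (A ∩ B) (≤-trans (s≤s (s≤s z≤n)) ≥3)
      ...   | y , y∈ , y≢x ∷ [] with fresh (x ∷ y ∷ []) (A ∩ B) ≥3
      ...     | z , z∈ , z≢x ∷ z≢y ∷ [] with hasFourCover? A B
      ...       | yes h = inj₁ (CubeMinor.represented-by-cube T con (Corners.four-cover⇒tetrahedron T con m
                    (Absorb.family T t h) x∈ y∈ z∈ (y≢x ∘ ≡-sym) (z≢y ∘ ≡-sym) z≢x a∉))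
      ...       | no no4 with any? (λ u → any? λ v → (u ∈? A ∩ B) ×-dec ((v ∈? A ∩ B) ×-dec adj? G u v))
      ...         | yes (u , v , u∈ , v∈ , e) = inj₂ (torso-reduction t retract no4 a∉)
        where
        retract : Retraction G A B
        retract with fresh (u ∷ v ∷ []) (A ∩ B) ≥3
        ... | r , r∈ , r≢u ∷ r≢v ∷ [] = triangle-retraction G (exhaust r∈ u∈ v∈ r≢u r≢v (adj-irrefl G e)) r∈ u∈ v∈
              (component-triangle t con′ a∉ r∈ u∈ v∈ λ _ → e)
      ...         | no ¬e = inj₂ (torso-reduction t retract no4 a∉)
        where
        nonadjacent : ∀ {u v} → u ∈ A ∩ B → v ∈ A ∩ B → ¬ Adj G u v
        nonadjacent u∈ v∈ e = ¬e (_ , _ , u∈ , v∈ , e)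
        ≥5 : 5 ≤ ∣ A ∣
        ≥5 = [ id , (λ h → ⊥-elim (¬e h)) ]′ (proj₂ (proj₂ th))
        retract : Retraction G A B
        -- At least five vertices, of which at most three are in the separator, provide the second
        -- interior vertex that peeling requires.
        retract with fresh (a ∷ []) (A ∩ ∁ B) (+-cancelˡ-≤ 3 _ _ (≤-trans ≥5 ∣A∣≤))
        ... | b , b∈ , b≢a ∷ [] = triangle-retraction G S⊆ x∈ y∈ z∈
              (Peeling.rooted-triangle T con t x y z S⊆ x∈ y∈ z∈ (nonadjacent x∈ y∈) (nonadjacent x∈ z∈) (nonadjacent y∈ z∈)
                a b a∉ (x∈∁p⇒x∉p (∩ʳ A (∁ B) b∈)) (b≢a ∘ ≡-sym))
          where
          S⊆ = exhaust x∈ y∈ z∈ (y≢x ∘ ≡-sym) (z≢x ∘ ≡-sym) (z≢y ∘ ≡-sym)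

    connected-step : Represented ⊎ Reduced
    connected-step with anySubset? (λ A → anySubset? (thick? A))
    ... | yes (A , B , th) = let (_ , _ , m , th′) = maximal-thick th in thick-step m th′
    ... | no ¬th = inj₁ (n , G , internally4Connected T con
            (λ A B t → ≤-pred (≰⇒> λ ≥5 → ¬th (A , B , t , ≤-trans (n≤1+n 4) ≥5 , inj₁ ≥5)))
            (λ A B t ≥4 u v u∈ v∈ → ¬adj⇒false G λ a → ¬th (A , B , t , ≥4 , inj₂ (u , v , u∈ , v∈ , a))) ,
            id-minor G , τ , T , id-lift G T)

  two-separation : TangleConnected T 2 → ∀ {A B a} → τ A B → order A B < 3 → a ∈ A → a ∉ B → Reduced
  two-separation con {A} {B} {a} t o a∈ a∉ with fresh [] (A ∩ B) (≤-trans (s≤s z≤n) ≥2) | ≥2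
    where
    ≥2 : 2 ≤ ∣ A ∩ B ∣
    ≥2 = ≮⇒≥ λ <2 → a∉ (con A B t <2 a∈)
  ... | x , x∈ , _ | ≥2 with fresh (x ∷ []) (A ∩ B) ≥2
  ...   | y , y∈ , y≢x ∷ [] = torso-reduction t
          (triangle-retraction G S⊆ x∈ y∈ y∈
            (component-triangle t (weaken T (≤-pred o) con) a∉ x∈ y∈ y∈ λ ne → ⊥-elim (ne refl)))
          (Absorb.no-four-cover T t (≤-pred o)) a∉
    where
    S⊆ : ∀ s → s ∈ A ∩ B → s ≡ x ⊎ s ≡ y ⊎ s ≡ y
    S⊆ s s∈ = Sum.map₂ inj₁ (exhausted₂ {X = A ∩ B} (y≢x ∘ ≡-sym) x∈ y∈ (≤-pred o) s s∈)

  -- Orders are treated increasingly because contracting an interior component requires it to be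
  -- attached to every vertex of the separator, which `attached` derives from the absence of
  -- interiors at lower orders.
  step-down : Represented ⊎ Reduced
  step-down with nontrivial? 2
  ... | yes (A , B , t , o , a , _ , a∉) = inj₂ (torso-reduction t (trivial-retraction G (≤-pred o))
          (Absorb.no-four-cover T t (≤-trans (≤-pred o) (n≤1+n 1))) a∉)
  ... | no ¬2 with nontrivial? 3
  ...   | yes (A , B , t , o , a , a∈ , a∉) = inj₂ (two-separation (trivial⇒connected ¬2) t o a∈ a∉)
  ...   | no ¬3 = connected-step (trivial⇒connected ¬3)

represented : ∀ fuel {n} {G : Graph n} {τ : OSeps n} (T : Tangle G 4 τ) → n < fuel → Represented T
represented (suc fuel) T lt with step-down T
... | inj₁ r = r
... | inj₂ (m , m<n , H , φ , σ , S , p) =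
  let (k , L , I , ψ , ρ , R , q) = represented fuel S (≤-trans m<n (≤-pred lt))
  in k , L , I , φ ∘-minor ψ , ρ , R , lift-∘ φ ψ T R p q

theorem1 : (∀ (n : ℕ) (G : Graph n) → Internally4Connected G →
    Σ (OSeps n) λ τ → Tangle G 4 τ × (∀ (σ : OSeps n) → Tangle G 4 σ → σ ≐ τ))
    ×
    (∀ (n : ℕ) (G : Graph n) (τ : OSeps n) → Tangle G 4 τ →
    Σ ℕ λ m → Σ (Graph m) λ H → Internally4Connected H ×
    Σ (MinorMap G H) λ φ →
    Σ (OSeps m) λ σ → Tangle H 4 σ × (Lift φ 4 σ ≐ τ))
theorem1 = (λ n G I → UniqueTangle.σ I , UniqueTangle.σ-tangle I , UniqueTangle.σ-unique I) ,
  λ n G τ T → represented (suc n) T ≤-refl
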